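{- Let $G$ be a connected graph of order $n$ with diameter $d\ge 2$, and suppose $G$ is not isomorphic to the path $P_{d+1}$. Then $m_G[n-d+2,n]\le n-d$.
   Context: For a graph $G$ of order $n$, the Laplacian eigenvalues are the eigenvalues of the Laplacian matrix $L(G)=D(G)-A(G)$ (they lie in $[0,n]$), and for an interval $I\subseteq[0,n]$, $m_G I$ denotes the number of Laplacian eigenvalues of $G$ (counted with multiplicity) in $I$. $P_k$ is the path on $k$ vertices. -}

module Defs where

open import Algebra.Bundles using (CommutativeMonoid; RawRing)
import Algebra.Definitions.RawMonoid as RawMonoidDefinitions
import Algebra.Definitions.RawSemiring as RawSemiringDefinitions
import Algebra.Properties.CommutativeSemigroup as CommutativeSemigroupProperties
open import Data.Bool.Base using (Bool; true; false; if_then_else_)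
open import Data.Fin.Base using (Fin; zero; suc; toℕ; punchIn)
import Data.Fin.Properties as Fin
open import Data.Fin.Subset using (Subset; _∈_; ∣_∣)
open import Data.Integer.Base as ℤ using (ℤ; +_)
open import Data.Nat.Base as ℕ using (ℕ; zero; suc)
import Data.Nat.Properties as ℕ
open import Data.Product.Base using (Σ; ∃; ∃₂; _×_; _,_)
open import Data.Rational.Base as ℚ using (ℚ; 0ℚ; 1ℚ; ½)
import Data.Rational.Properties as ℚ
open import Data.Sum.Base using (_⊎_; [_,_]; swap)
open import Data.Vec.Base using (tabulate)
open import Function.Base using (_∘_)
open import Function.Bundles using (_⇔_; mk⇔; _⤖_; Bijection)
open import Level using (0ℓ)
open import Relation.Binary.PropositionalEquality using (_≡_; refl; sym; trans; cong; cong₂; subst; module ≡-Reasoning)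
open import Relation.Nullary.Decidable using (Dec; does; does-⇔; dec-false; _⊎-dec_)

-- ℝ is the setoid of Cauchy sequences of rationals under _≃_; the standard
-- library has no real numbers.
IsCauchy : (ℕ → ℚ) → Set
IsCauchy s = ∀ ε → 0ℚ ℚ.< ε →
  ∃ λ N → ∀ m n → N ℕ.≤ m → N ℕ.≤ n → ℚ.∣ s m ℚ.- s n ∣ ℚ.< ε

record ℝ : Set where
  constructor mkℝ
  field
    seq    : ℕ → ℚ
    cauchy : IsCauchy seq

open ℝ public

infix 4 _≃_ _≤ᴿ_

_≃_ : ℝ → ℝ → Set
x ≃ y = ∀ ε → 0ℚ ℚ.< ε →
  ∃ λ N → ∀ n → N ℕ.≤ n → ℚ.∣ seq x n ℚ.- seq y n ∣ ℚ.< ε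

_≤ᴿ_ : ℝ → ℝ → Set
x ≤ᴿ y = ∀ ε → 0ℚ ℚ.< ε →
  ∃ λ N → ∀ n → N ℕ.≤ n → seq x n ℚ.< seq y n ℚ.+ ε

module CauchyClosure where
  half-pos : ∀ {ε} → 0ℚ ℚ.< ε → 0ℚ ℚ.< ½ ℚ.* ε
  half-pos {ε} 0<ε =
    subst (ℚ._< ½ ℚ.* ε) (ℚ.*-zeroʳ ½) (ℚ.*-monoʳ-<-pos ½ 0<ε)

  half+half : ∀ ε → ½ ℚ.* ε ℚ.+ ½ ℚ.* ε ≡ ε
  half+half ε = trans (sym (ℚ.*-distribʳ-+ ε ½ ½)) (ℚ.*-identityˡ ε)

  telescope : ∀ a b c → (a ℚ.- b) ℚ.+ (b ℚ.- c) ≡ a ℚ.- c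
  telescope a b c = begin
    (a ℚ.- b) ℚ.+ (b ℚ.- c)          ≡⟨ ℚ.+-assoc a (ℚ.- b) (b ℚ.- c) ⟩
    a ℚ.+ (ℚ.- b ℚ.+ (b ℚ.- c))      ≡⟨ cong (a ℚ.+_) (sym (ℚ.+-assoc (ℚ.- b) b (ℚ.- c))) ⟩
    a ℚ.+ ((ℚ.- b ℚ.+ b) ℚ.- c)      ≡⟨ cong (λ z → a ℚ.+ (z ℚ.- c)) (ℚ.+-inverseˡ b) ⟩
    a ℚ.+ (0ℚ ℚ.- c)                 ≡⟨ cong (a ℚ.+_) (ℚ.+-identityˡ (ℚ.- c)) ⟩
    a ℚ.- c                          ∎
    where open ≡-Reasoning

  +-rearrange : ∀ a b c d → (a ℚ.+ b) ℚ.- (c ℚ.+ d) ≡ (a ℚ.- c) ℚ.+ (b ℚ.- d)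
  +-rearrange a b c d = trans
    (cong ((a ℚ.+ b) ℚ.+_) (ℚ.neg-distrib-+ c d))
    (interchange a b (ℚ.- c) (ℚ.- d))
    where open CommutativeSemigroupProperties (CommutativeMonoid.commutativeSemigroup ℚ.+-0-commutativeMonoid) using (interchange)

  *-distribˡ-- : ∀ a b c → a ℚ.* (b ℚ.- c) ≡ a ℚ.* b ℚ.- a ℚ.* c
  *-distribˡ-- a b c = trans
    (ℚ.*-distribˡ-+ a b (ℚ.- c))
    (cong (a ℚ.* b ℚ.+_) (sym (ℚ.neg-distribʳ-* a c)))

  *-rearrange : ∀ a b c d → a ℚ.* b ℚ.- c ℚ.* d ≡ a ℚ.* (b ℚ.- d) ℚ.+ d ℚ.* (a ℚ.- c)
  *-rearrange a b c d = sym (begin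
    a ℚ.* (b ℚ.- d) ℚ.+ d ℚ.* (a ℚ.- c)
      ≡⟨ cong₂ ℚ._+_ (*-distribˡ-- a b d) (*-distribˡ-- d a c) ⟩
    (a ℚ.* b ℚ.- a ℚ.* d) ℚ.+ (d ℚ.* a ℚ.- d ℚ.* c)
      ≡⟨ cong₂ (λ p q → (a ℚ.* b ℚ.- a ℚ.* d) ℚ.+ (p ℚ.- q)) (ℚ.*-comm d a) (ℚ.*-comm d c) ⟩
    (a ℚ.* b ℚ.- a ℚ.* d) ℚ.+ (a ℚ.* d ℚ.- c ℚ.* d)
      ≡⟨ telescope (a ℚ.* b) (a ℚ.* d) (c ℚ.* d) ⟩
    a ℚ.* b ℚ.- c ℚ.* d ∎)
    where open ≡-Reasoning

  neg-rearrange : ∀ a b → ℚ.- a ℚ.- ℚ.- b ≡ ℚ.- (a ℚ.- b)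
  neg-rearrange a b = sym (ℚ.neg-distrib-+ a (ℚ.- b))

  shift : ∀ a b → a ≡ b ℚ.+ (a ℚ.- b)
  shift a b = sym (begin
    b ℚ.+ (a ℚ.- b)        ≡⟨ ℚ.+-comm b (a ℚ.- b) ⟩
    (a ℚ.- b) ℚ.+ b        ≡⟨ ℚ.+-assoc a (ℚ.- b) b ⟩
    a ℚ.+ (ℚ.- b ℚ.+ b)    ≡⟨ cong (a ℚ.+_) (ℚ.+-inverseˡ b) ⟩
    a ℚ.+ 0ℚ               ≡⟨ ℚ.+-identityʳ a ⟩
    a                      ∎)
    where open ≡-Reasoning

  0<1 : 0ℚ ℚ.< 1ℚ
  0<1 = ℚ.positive⁻¹ 1ℚ

  eventuallyBounded : ∀ s → IsCauchy s →
    ∃₂ λ B N → 0ℚ ℚ.< B × (∀ m → N ℕ.≤ m → ℚ.∣ s m ∣ ℚ.≤ B)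
  eventuallyBounded s c with c 1ℚ 0<1
  ... | N , close = B , N , 0<B , bound
    where
    B = ℚ.∣ s N ∣ ℚ.+ 1ℚ
    0<B : 0ℚ ℚ.< B
    0<B = ℚ.+-mono-≤-< (ℚ.0≤∣p∣ (s N)) 0<1
    bound : ∀ m → N ℕ.≤ m → ℚ.∣ s m ∣ ℚ.≤ B
    bound m N≤m = begin
      ℚ.∣ s m ∣                              ≡⟨ cong ℚ.∣_∣ (shift (s m) (s N)) ⟩
      ℚ.∣ s N ℚ.+ (s m ℚ.- s N) ∣            ≤⟨ ℚ.∣p+q∣≤∣p∣+∣q∣ (s N) (s m ℚ.- s N) ⟩
      ℚ.∣ s N ∣ ℚ.+ ℚ.∣ s m ℚ.- s N ∣        ≤⟨ ℚ.+-monoʳ-≤ ℚ.∣ s N ∣ (ℚ.<⇒≤ (close m N N≤m ℕ.≤-refl)) ⟩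
      B                                      ∎
      where open ℚ.≤-Reasoning

  scale : ∀ {B ε} → 0ℚ ℚ.< B → 0ℚ ℚ.< ε → ∃ λ δ → 0ℚ ℚ.< δ × B ℚ.* δ ≡ ε
  scale {B} {ε} 0<B 0<ε = B⁻¹ ℚ.* ε , pos , eq
    where
    instance
      B-pos : ℚ.Positive B
      B-pos = ℚ.positive 0<B
      B-nonZero : ℚ.NonZero B
      B-nonZero = ℚ.pos⇒nonZero B
    B⁻¹ = ℚ.1/ B
    instance
      B⁻¹-pos : ℚ.Positive B⁻¹
      B⁻¹-pos = ℚ.1/pos⇒pos B
    pos : 0ℚ ℚ.< B⁻¹ ℚ.* ε
    pos = subst (ℚ._< B⁻¹ ℚ.* ε) (ℚ.*-zeroʳ B⁻¹) (ℚ.*-monoʳ-<-pos B⁻¹ 0<ε)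
    eq : B ℚ.* (B⁻¹ ℚ.* ε) ≡ ε
    eq = trans (sym (ℚ.*-assoc B B⁻¹ ε))
        (trans (cong (ℚ._* ε) (ℚ.*-inverseʳ B)) (ℚ.*-identityˡ ε))

  const-cauchy : ∀ q → IsCauchy (λ _ → q)
  const-cauchy q ε 0<ε = 0 , λ _ _ _ _ →
    subst (ℚ._< ε) (sym (cong ℚ.∣_∣ (ℚ.+-inverseʳ q))) 0<ε

  +-cauchy : ∀ s t → IsCauchy s → IsCauchy t → IsCauchy (λ n → s n ℚ.+ t n)
  +-cauchy s t cs ct ε 0<ε
    with cs (½ ℚ.* ε) (half-pos 0<ε) | ct (½ ℚ.* ε) (half-pos 0<ε)
  ... | M , hs | N , ht = M ℕ.⊔ N , λ m n Km Kn → begin-strict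
      ℚ.∣ (s m ℚ.+ t m) ℚ.- (s n ℚ.+ t n) ∣        ≡⟨ cong ℚ.∣_∣ (+-rearrange (s m) (t m) (s n) (t n)) ⟩
      ℚ.∣ (s m ℚ.- s n) ℚ.+ (t m ℚ.- t n) ∣        ≤⟨ ℚ.∣p+q∣≤∣p∣+∣q∣ (s m ℚ.- s n) (t m ℚ.- t n) ⟩
      ℚ.∣ s m ℚ.- s n ∣ ℚ.+ ℚ.∣ t m ℚ.- t n ∣      <⟨ ℚ.+-mono-<
                                                       (hs m n (ℕ.m⊔n≤o⇒m≤o M N Km) (ℕ.m⊔n≤o⇒m≤o M N Kn))
                                                       (ht m n (ℕ.m⊔n≤o⇒n≤o M N Km) (ℕ.m⊔n≤o⇒n≤o M N Kn)) ⟩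
      ½ ℚ.* ε ℚ.+ ½ ℚ.* ε                          ≡⟨ half+half ε ⟩
      ε                                            ∎
    where open ℚ.≤-Reasoning

  neg-cauchy : ∀ s → IsCauchy s → IsCauchy (λ n → ℚ.- s n)
  neg-cauchy s cs ε 0<ε with cs ε 0<ε
  ... | N , hs = N , λ m n Nm Nn →
    subst (ℚ._< ε)
      (sym (trans (cong ℚ.∣_∣ (neg-rearrange (s m) (s n))) (ℚ.∣-p∣≡∣p∣ (s m ℚ.- s n))))
      (hs m n Nm Nn)

  *-cauchy : ∀ s t → IsCauchy s → IsCauchy t → IsCauchy (λ n → s n ℚ.* t n)
  *-cauchy s t cs ct ε 0<ε
    with eventuallyBounded s cs | eventuallyBounded t ct
  ... | A , M₁ , 0<A , bs | B , N₁ , 0<B , bt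
    with scale 0<A (half-pos 0<ε) | scale 0<B (half-pos 0<ε)
  ... | δ , 0<δ , Aδ | η , 0<η , Bη
    with cs η 0<η | ct δ 0<δ
  ... | M₂ , hs | N₂ , ht = (M₁ ℕ.⊔ N₁) ℕ.⊔ (M₂ ℕ.⊔ N₂) , λ m n Km Kn → begin-strict
      ℚ.∣ s m ℚ.* t m ℚ.- s n ℚ.* t n ∣
        ≡⟨ cong ℚ.∣_∣ (*-rearrange (s m) (t m) (s n) (t n)) ⟩
      ℚ.∣ s m ℚ.* (t m ℚ.- t n) ℚ.+ t n ℚ.* (s m ℚ.- s n) ∣
        ≤⟨ ℚ.∣p+q∣≤∣p∣+∣q∣ (s m ℚ.* (t m ℚ.- t n)) (t n ℚ.* (s m ℚ.- s n)) ⟩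
      ℚ.∣ s m ℚ.* (t m ℚ.- t n) ∣ ℚ.+ ℚ.∣ t n ℚ.* (s m ℚ.- s n) ∣
        ≡⟨ cong₂ ℚ._+_ (ℚ.∣p*q∣≡∣p∣*∣q∣ (s m) (t m ℚ.- t n)) (ℚ.∣p*q∣≡∣p∣*∣q∣ (t n) (s m ℚ.- s n)) ⟩
      ℚ.∣ s m ∣ ℚ.* ℚ.∣ t m ℚ.- t n ∣ ℚ.+ ℚ.∣ t n ∣ ℚ.* ℚ.∣ s m ℚ.- s n ∣
        <⟨ ℚ.+-mono-<
             (*-bound (s m) (t m ℚ.- t n) 0<A (bs m (m₁ Km)) (ht m n (n₂ Km) (n₂ Kn)))
             (*-bound (t n) (s m ℚ.- s n) 0<B (bt n (n₁ Kn)) (hs m n (m₂ Km) (m₂ Kn))) ⟩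
      A ℚ.* δ ℚ.+ B ℚ.* η
        ≡⟨ cong₂ ℚ._+_ Aδ Bη ⟩
      ½ ℚ.* ε ℚ.+ ½ ℚ.* ε
        ≡⟨ half+half ε ⟩
      ε ∎
    where
    open ℚ.≤-Reasoning
    K = (M₁ ℕ.⊔ N₁) ℕ.⊔ (M₂ ℕ.⊔ N₂)
    m₁ : ∀ {k} → K ℕ.≤ k → M₁ ℕ.≤ k
    m₁ = ℕ.m⊔n≤o⇒m≤o M₁ N₁ ∘ ℕ.m⊔n≤o⇒m≤o (M₁ ℕ.⊔ N₁) (M₂ ℕ.⊔ N₂)
    n₁ : ∀ {k} → K ℕ.≤ k → N₁ ℕ.≤ k
    n₁ = ℕ.m⊔n≤o⇒n≤o M₁ N₁ ∘ ℕ.m⊔n≤o⇒m≤o (M₁ ℕ.⊔ N₁) (M₂ ℕ.⊔ N₂)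
    m₂ : ∀ {k} → K ℕ.≤ k → M₂ ℕ.≤ k
    m₂ = ℕ.m⊔n≤o⇒m≤o M₂ N₂ ∘ ℕ.m⊔n≤o⇒n≤o (M₁ ℕ.⊔ N₁) (M₂ ℕ.⊔ N₂)
    n₂ : ∀ {k} → K ℕ.≤ k → N₂ ℕ.≤ k
    n₂ = ℕ.m⊔n≤o⇒n≤o M₂ N₂ ∘ ℕ.m⊔n≤o⇒n≤o (M₁ ℕ.⊔ N₁) (M₂ ℕ.⊔ N₂)
    *-bound : ∀ {C γ} p q → 0ℚ ℚ.< C → ℚ.∣ p ∣ ℚ.≤ C → ℚ.∣ q ∣ ℚ.< γ →
              ℚ.∣ p ∣ ℚ.* ℚ.∣ q ∣ ℚ.< C ℚ.* γ
    *-bound {C} {γ} p q 0<C p≤C q<γ = ℚ.≤-<-trans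
      (ℚ.*-monoʳ-≤-nonNeg ℚ.∣ q ∣ ⦃ ℚ.∣-∣-nonNeg q ⦄ p≤C)
      (ℚ.*-monoʳ-<-pos C ⦃ ℚ.positive 0<C ⦄ q<γ)

open CauchyClosure

fromℚ : ℚ → ℝ
fromℚ q = mkℝ (λ _ → q) (const-cauchy q)

fromℤ : ℤ → ℝ
fromℤ i = fromℚ (i ℚ./ 1)

fromℕ : ℕ → ℝ
fromℕ n = fromℤ (+ n)

infixl 6 _+ᴿ_ _-ᴿ_
infixl 7 _*ᴿ_
infix  8 -ᴿ_

_+ᴿ_ : ℝ → ℝ → ℝ
x +ᴿ y = mkℝ (λ n → seq x n ℚ.+ seq y n) (+-cauchy (seq x) (seq y) (cauchy x) (cauchy y))

_*ᴿ_ : ℝ → ℝ → ℝ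
x *ᴿ y = mkℝ (λ n → seq x n ℚ.* seq y n) (*-cauchy (seq x) (seq y) (cauchy x) (cauchy y))

-ᴿ_ : ℝ → ℝ
-ᴿ x = mkℝ (λ n → ℚ.- seq x n) (neg-cauchy (seq x) (cauchy x))

_-ᴿ_ : ℝ → ℝ → ℝ
x -ᴿ y = x +ᴿ (-ᴿ y)

ℝ-rawRing : RawRing 0ℓ 0ℓ
ℝ-rawRing = record
  { Carrier = ℝ
  ; _≈_     = _≃_
  ; _+_     = _+ᴿ_
  ; _*_     = _*ᴿ_
  ; -_      = -ᴿ_
  ; 0#      = fromℕ 0
  ; 1#      = fromℕ 1
  }

infix 4 _∈[_,_]

_∈[_,_] : ℝ → ℝ → ℝ → Set
x ∈[ a , b ] = a ≤ᴿ x × x ≤ᴿ b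

Matrix : ∀ {a} → Set a → ℕ → Set a
Matrix A n = Fin n → Fin n → A

module Determinant {c ℓ} (R : RawRing c ℓ) where
  open RawRing R
  open RawMonoidDefinitions +-rawMonoid using (sum) public
  open RawMonoidDefinitions *-rawMonoid using () renaming (sum to product) public
  open RawSemiringDefinitions rawSemiring using (_^_)

  -- Laplace expansion along the first row.
  det : ∀ {n} → Matrix Carrier n → Carrier
  det {zero}  M = 1#
  det {suc n} M = sum λ j →
    (- 1#) ^ toℕ j * (M zero j * det (λ i k → M (suc i) (punchIn j k)))

open Determinant ℝ-rawRing public using (det; product)

charPoly : ∀ {n} → Matrix ℝ n → ℝ → ℝ
charPoly M x = det λ i j → (if does (i Fin.≟ j) then x else fromℕ 0) -ᴿ M i j

-- The eigenvalues of M with algebraic multiplicity: the identity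
-- det (x I − M) = ∏ᵢ (x − λᵢ) of polynomial functions on ℝ, which is the
-- same as equality of polynomials since ℝ is infinite.
AreEigenvalues : ∀ {n} → Matrix ℝ n → (Fin n → ℝ) → Set
AreEigenvalues M λs = ∀ x → charPoly M x ≃ product (λ i → x -ᴿ λs i)

record Graph (n : ℕ) : Set where
  field
    adj       : Fin n → Fin n → Bool
    symmetric : ∀ u v → adj u v ≡ adj v u
    loopless  : ∀ v → adj v v ≡ false

  Adjacent : Fin n → Fin n → Set
  Adjacent u v = adj u v ≡ true

  degree : Fin n → ℕ
  degree v = ∣ tabulate (adj v) ∣

  data Walk : Fin n → Fin n → ℕ → Set where
    nil  : ∀ {v} → Walk v v 0
    cons : ∀ {u v w k} → Adjacent u v → Walk v w k → Walk u w (suc k)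

  Connected : Set
  Connected = ∀ u v → ∃ λ k → Walk u v k

  Distance : Fin n → Fin n → ℕ → Set
  Distance u v k = Walk u v k × (∀ j → Walk u v j → k ℕ.≤ j)

  Diameter : ℕ → Set
  Diameter d = (∃₂ λ u v → Distance u v d)
             × (∀ u v k → Distance u v k → k ℕ.≤ d)

  degreeMatrix : Matrix ℤ n
  degreeMatrix i j = if does (i Fin.≟ j) then + degree i else + 0

  adjacencyMatrix : Matrix ℤ n
  adjacencyMatrix i j = if adj i j then + 1 else + 0

  laplacian : Matrix ℤ n
  laplacian i j = degreeMatrix i j ℤ.- adjacencyMatrix i j

  AreLaplacianEigenvalues : (Fin n → ℝ) → Set
  AreLaplacianEigenvalues = AreEigenvalues (λ i j → fromℤ (laplacian i j))

  -- LaplacianCount a b m says m_G[a , b] = m.  It is a relation because the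
  -- order on ℝ is not decidable; S is the set of indices i with λᵢ ∈ [a , b].
  LaplacianCount : ℝ → ℝ → ℕ → Set
  LaplacianCount a b m =
    Σ (Fin n → ℝ) λ λs → AreLaplacianEigenvalues λs ×
    Σ (Subset n) λ S → (∀ i → i ∈ S ⇔ λs i ∈[ a , b ]) × ∣ S ∣ ≡ m

open Graph public

record _≅_ {m n} (G : Graph m) (H : Graph n) : Set where
  field
    bijection : Fin m ⤖ Fin n
    preserves : ∀ u v → adj G u v ≡ adj H (Bijection.to bijection u) (Bijection.to bijection v)

path : ∀ k → Graph k
path k = record
  { adj       = λ u v → does (consecutive? u v)
  ; symmetric = λ u v → does-⇔ (mk⇔ swap swap) (consecutive? u v) (consecutive? v u)
  ; loopless  = λ v → dec-false (consecutive? v v) [ ℕ.1+n≢n , ℕ.1+n≢n ]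
  }
  where
  consecutive? : (u v : Fin k) → Dec (suc (toℕ u) ≡ toℕ v ⊎ suc (toℕ v) ≡ toℕ u)
  consecutive? u v = (suc (toℕ u) ℕ.≟ toℕ v) ⊎-dec (suc (toℕ v) ℕ.≟ toℕ u)

{-# OPTIONS --safe #-}
module Submission where

-- Let c = n − d + 2 and let v₀, …, v_d be a diametral path. As G is not that path,
-- there is a vertex w off it, and the neighbours of w on the path lie within
-- {v_{j-1}, v_j, v_{j+1}} for some j. On the span of the d coordinate vectors of the
-- path without v_j, the form of c − L is Σ eₖ xₖ² + Σ (xₖ + xₗ)² over the remaining
-- path edges, with all eₖ ≥ 0 and eₖ > 0 at the ends of the path; hence it is
-- positive definite.
--
-- It remains to see that a symmetric matrix with c − L positive definite on a
-- d-dimensional space W has at most n − d eigenvalues μ ≥ c. Given such a μ with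
-- eigenvector v, replacing L by L − s v vᵀ with s large only moves the eigenvalue μ,
-- to a value below c, and c − L becomes positive definite on W + ⟨v⟩. After all
-- these eigenvalues have been moved, m + d vectors of ℝⁿ are independent.
--
-- The conclusion being decidable, all of this is argued up to double negation, so
-- that real numbers may be compared.

open import Defs hiding (det; product)
open import Algebra.Bundles using (CommutativeRing; Semiring)
import Algebra.Definitions.RawSemiring as RawSemiringDefinitions
import Algebra.Properties.AbelianGroup as AbelianGroupProperties
import Algebra.Properties.Group as GroupProperties
import Algebra.Properties.Ring as RingProperties
import Algebra.Properties.Semiring.Mult as SemiringMult
import Algebra.Properties.Semiring.Sum as SemiringSum
import Algebra.Solver.Ring as RingSolver
open import Algebra.Solver.Ring.AlmostCommutativeRing using (fromCommutativeRing; Induced-equivalence; _-Raw-AlmostCommutative⟶_)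
open import Data.Bool.Base using (Bool; true; false; not; if_then_else_)
import Data.Bool.Properties as Bool
open import Data.Empty using (⊥)
open import Data.Fin.Base using (Fin; zero; suc; toℕ; punchIn; punchOut; inject₁; fromℕ<)
import Data.Fin.Properties as Fin
open import Data.Fin.Subset using (Subset; _∈_; ∣_∣)
open import Data.Integer.Base as ℤ using (ℤ; +_; -[1+_])
import Data.Integer.Properties as ℤ
open import Data.Maybe.Base using (just; nothing)
open import Data.Nat.Base as ℕ using (ℕ; zero; suc; _≤_; _∸_)
import Data.Nat.Coprimality as Coprimality
import Data.Nat.Properties as ℕ
open import Data.Nat.Tactic.RingSolver using (solve-∀)
open import Data.Product.Base using (∃; ∃₂; _×_; _,_; proj₁; proj₂)
open import Data.Rational.Base as ℚ using (ℚ; 0ℚ; 1ℚ; ½)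
import Data.Rational.Properties as ℚ
open import Data.Sum.Base using (_⊎_; inj₁; inj₂)
open import Data.Vec.Base using ([]; _∷_; here; there; tabulate)
open import Data.Vec.Functional using (insertAt)
open import Data.Vec.Functional.Properties using (insertAt-lookup; insertAt-punchIn)
open import Function.Base using (_∘_; const; id)
open import Function.Bundles using (Equivalence; mk⇔; mk⤖)
open import Level using (0ℓ; _⊔_) renaming (suc to lsuc)
open import Relation.Binary.Definitions using (WeaklyDecidable; tri<; tri≈; tri>)
open import Relation.Binary.PropositionalEquality as ≡ using (_≡_; _≢_)
import Relation.Binary.Reasoning.Setoid as SetoidReasoning
open import Relation.Nullary.Decidable using (Dec; yes; no; does; dec-true; dec-false; does-⇔; ¬?; _×-dec_; _⊎-dec_)
open import Relation.Nullary.Negation using (¬_; contradiction)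

-- The constant c is what the degrees allow. Let u be a path vertex other than v_j with P neighbours
-- on the path, and write [u ~ x] for 1 if u and x are adjacent and 0 otherwise. Among the d + 2
-- vertices formed by w and the path, u is adjacent to P + [u ~ w] only, so c - deg u ≥ 4 - P -
-- [u ~ w]. Removing v_j leaves u with P - [u ~ v_j] path neighbours, and [u ~ w] ≤ [u ~ v_j] by the
-- choice of j. The coefficient e of u is therefore at least 4 - 2P, which is non-negative on the
-- path and at least 2 at its ends. The eigenvalues are given only through a factorisation of the
-- characteristic polynomial, without an eigenbasis, so they are treated one at a time. The
-- determinant identity for L - s v vᵀ carries a factor y - μ on both sides, and at y = μ it says
-- nothing; that point matters when μ is a multiple eigenvalue. Cancelling the factor everywhere
-- uses that both sides are polynomial in y.

module IntegerSolver {c ℓ} (R : CommutativeRing c ℓ) where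
  open CommutativeRing R
  open RingProperties ring using (-‿distribˡ-*; -‿distribʳ-*; -0#≈0#; -‿involutive)
  open AbelianGroupProperties +-abelianGroup using (⁻¹-∙-comm)
  open SemiringMult semiring using (×-homo-+; ×1-homo-*) renaming (_×_ to _⋆_)
  open SetoidReasoning setoid

  -- Equality in the ring is not decidable, so the solver normalises with integer coefficients,
  -- whose equality `weaklyDecide` can test; this is what lets opposite terms cancel.
  ⟦_⟧ℤ : ℤ → Carrier
  ⟦ + n ⟧ℤ      = n ⋆ 1#
  ⟦ -[1+ n ] ⟧ℤ = - (suc n ⋆ 1#)

  private
    cancel : ∀ a x y → (a + x) - (a + y) ≈ x - y
    cancel a x y = begin
      (a + x) - (a + y)        ≈⟨ +-congˡ (⁻¹-∙-comm a y) ⟨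
      (a + x) + (- a + - y)    ≈⟨ +-congʳ (+-comm a x) ⟩
      (x + a) + (- a + - y)    ≈⟨ +-assoc x a _ ⟩
      x + (a + (- a + - y))    ≈⟨ +-congˡ (+-assoc a (- a) (- y)) ⟨
      x + ((a + - a) + - y)    ≈⟨ +-congˡ (+-congʳ (-‿inverseʳ a)) ⟩
      x + (0# + - y)           ≈⟨ +-congˡ (+-identityˡ _) ⟩
      x - y                    ∎

    ⊖-homo : ∀ m n → ⟦ m ℤ.⊖ n ⟧ℤ ≈ m ⋆ 1# - n ⋆ 1#
    ⊖-homo zero    zero    = sym (-‿inverseʳ 0#)
    ⊖-homo zero    (suc n) = sym (+-identityˡ _)
    ⊖-homo (suc m) zero    = sym (trans (+-congˡ -0#≈0#) (+-identityʳ _))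
    ⊖-homo (suc m) (suc n) = begin
      ⟦ suc m ℤ.⊖ suc n ⟧ℤ      ≡⟨ ≡.cong ⟦_⟧ℤ (ℤ.[1+m]⊖[1+n]≡m⊖n m n) ⟩
      ⟦ m ℤ.⊖ n ⟧ℤ              ≈⟨ ⊖-homo m n ⟩
      m ⋆ 1# - n ⋆ 1#           ≈⟨ cancel 1# _ _ ⟨
      suc m ⋆ 1# - suc n ⋆ 1#   ∎

    +-homo : ∀ i j → ⟦ i ℤ.+ j ⟧ℤ ≈ ⟦ i ⟧ℤ + ⟦ j ⟧ℤ
    +-homo (+ m)    (+ n)    = ×-homo-+ 1# m n
    +-homo (+ m)    -[1+ n ] = ⊖-homo m (suc n)
    +-homo -[1+ m ] (+ n)    = trans (⊖-homo n (suc m)) (+-comm _ _)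
    +-homo -[1+ m ] -[1+ n ] = begin
      - (suc (suc (m ℕ.+ n)) ⋆ 1#)          ≡⟨ ≡.cong (λ k → - (suc k ⋆ 1#)) (ℕ.+-suc m n) ⟨
      - ((suc m ℕ.+ suc n) ⋆ 1#)            ≈⟨ -‿cong (×-homo-+ 1# (suc m) (suc n)) ⟩
      - (suc m ⋆ 1# + suc n ⋆ 1#)           ≈⟨ ⁻¹-∙-comm _ _ ⟨
      - (suc m ⋆ 1#) + - (suc n ⋆ 1#)       ∎

    -‿homo : ∀ i → ⟦ ℤ.- i ⟧ℤ ≈ - ⟦ i ⟧ℤ
    -‿homo (+ zero)  = sym -0#≈0#
    -‿homo (+ suc n) = refl
    -‿homo -[1+ n ]  = sym (-‿involutive _)

    pos-*-homo : ∀ m j → ⟦ + m ℤ.* j ⟧ℤ ≈ m ⋆ 1# * ⟦ j ⟧ℤ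
    pos-*-homo m (+ n)    = trans (reflexive (≡.cong ⟦_⟧ℤ (≡.sym (ℤ.pos-* m n)))) (×1-homo-* m n)
    pos-*-homo m -[1+ n ] = begin
      ⟦ + m ℤ.* -[1+ n ] ⟧ℤ           ≡⟨ ≡.cong ⟦_⟧ℤ (ℤ.neg-distribʳ-* (+ m) (+ suc n)) ⟨
      ⟦ ℤ.- (+ m ℤ.* + suc n) ⟧ℤ      ≈⟨ -‿homo (+ m ℤ.* + suc n) ⟩
      - ⟦ + m ℤ.* + suc n ⟧ℤ          ≈⟨ -‿cong (pos-*-homo m (+ suc n)) ⟩
      - (m ⋆ 1# * suc n ⋆ 1#)         ≈⟨ -‿distribʳ-* _ _ ⟩
      m ⋆ 1# * - (suc n ⋆ 1#)         ∎

    *-homo : ∀ i j → ⟦ i ℤ.* j ⟧ℤ ≈ ⟦ i ⟧ℤ * ⟦ j ⟧ℤ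
    *-homo (+ m)    j = pos-*-homo m j
    *-homo -[1+ m ] j = begin
      ⟦ -[1+ m ] ℤ.* j ⟧ℤ             ≡⟨ ≡.cong ⟦_⟧ℤ (ℤ.neg-distribˡ-* (+ suc m) j) ⟨
      ⟦ ℤ.- (+ suc m ℤ.* j) ⟧ℤ        ≈⟨ -‿homo (+ suc m ℤ.* j) ⟩
      - ⟦ + suc m ℤ.* j ⟧ℤ            ≈⟨ -‿cong (pos-*-homo (suc m) j) ⟩
      - (suc m ⋆ 1# * ⟦ j ⟧ℤ)         ≈⟨ -‿distribˡ-* _ _ ⟩
      - (suc m ⋆ 1#) * ⟦ j ⟧ℤ         ∎

    homomorphism : ℤ.+-*-rawRing -Raw-AlmostCommutative⟶ fromCommutativeRing R
    homomorphism = record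
      { ⟦_⟧    = ⟦_⟧ℤ
      ; +-homo = +-homo
      ; *-homo = *-homo
      ; -‿homo = -‿homo
      ; 0-homo = refl
      ; 1-homo = +-identityʳ 1#
      }

    weaklyDecide : WeaklyDecidable (Induced-equivalence homomorphism)
    weaklyDecide i j with i ℤ.≟ j
    ... | yes i≡j = just (reflexive (≡.cong ⟦_⟧ℤ i≡j))
    ... | no  _   = nothing

  open RingSolver ℤ.+-*-rawRing (fromCommutativeRing R) homomorphism weaklyDecide public
    using (solve; _:=_; _:+_; _:*_; _:-_; :-_; con)

-- Determinants: linearity and alternation in the columns.

module Determinants {c ℓ} (R : CommutativeRing c ℓ) where
  open CommutativeRing R hiding (zero)
  open Determinant rawRing using (det) public
  open SemiringSum semiring using (sum; sum-cong-≋; sum-remove; sum-replicate-zero; ∑-distrib-+; ∑-comm; *-distribˡ-sum; *-distribʳ-sum) public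
  open RawSemiringDefinitions (Semiring.rawSemiring semiring) using (_^_)
  open IntegerSolver R
  open SetoidReasoning setoid

  sum-zero : ∀ {n} {f : Fin n → Carrier} → (∀ i → f i ≈ 0#) → sum f ≈ 0#
  sum-zero {n} f≈0 = trans (sum-cong-≋ f≈0) (sum-replicate-zero n)

  sum-single : ∀ {n} (f : Fin n → Carrier) p → (∀ i → i ≢ p → f i ≈ 0#) → sum f ≈ f p
  sum-single {suc n} f p f≈0 = begin
    sum f                               ≈⟨ sum-remove {i = p} f ⟩
    f p + sum (λ i → f (punchIn p i))   ≈⟨ +-congˡ (sum-zero (λ i → f≈0 _ (Fin.punchInᵢ≢i p i))) ⟩
    f p + 0#                            ≈⟨ +-identityʳ _ ⟩
    f p                                 ∎

  sum-cancel-adjacent : ∀ {n} (f : Fin (suc n) → Carrier) (p : Fin n) →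
    f (inject₁ p) + f (suc p) ≈ 0# →
    (∀ i → i ≢ inject₁ p → i ≢ suc p → f i ≈ 0#) → sum f ≈ 0#
  sum-cancel-adjacent {suc n} f zero f₀+f₁ f≈0 = begin
    f zero + (f (suc zero) + sum (λ i → f (suc (suc i))))
      ≈⟨ +-assoc _ _ _ ⟨
    (f zero + f (suc zero)) + sum (λ i → f (suc (suc i)))
      ≈⟨ +-cong f₀+f₁ (sum-zero (λ i → f≈0 (suc (suc i)) (λ ()) (λ ()))) ⟩
    0# + 0#
      ≈⟨ +-identityʳ 0# ⟩
    0# ∎
  sum-cancel-adjacent {suc n} f (suc p) fₚ+fₛₚ f≈0 = trans
    (+-cong (f≈0 zero (λ ()) (λ ()))
            (sum-cancel-adjacent (f ∘ suc) p fₚ+fₛₚ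
              (λ i i≢p i≢sp → f≈0 (suc i) (i≢p ∘ Fin.suc-injective) (i≢sp ∘ Fin.suc-injective))))
    (+-identityʳ 0#)

  minor : ∀ {n} → Matrix Carrier (suc n) → Fin (suc n) → Matrix Carrier n
  minor A j i k = A (suc i) (punchIn j k)

  cofactorTerm : ∀ {n} → Matrix Carrier (suc n) → Fin (suc n) → Carrier
  cofactorTerm A j = (- 1#) ^ toℕ j * (A zero j * det (minor A j))

  det-cong : ∀ {n} {A B : Matrix Carrier n} → (∀ i j → A i j ≈ B i j) → det A ≈ det B
  det-cong {zero}  A≈B = refl
  det-cong {suc n} A≈B = sum-cong-≋ λ j →
    *-congˡ {(- 1#) ^ toℕ j} (*-cong (A≈B zero j) (det-cong (λ i k → A≈B (suc i) (punchIn j k))))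

  -- The three matrices are compared off column `p` rather than built by updates, because minors
  -- inherit this shape: deleting column `p` makes the minors equal, and deleting another column `j`
  -- leaves `p` at position `punchOut j≢p`.
  det-linear : ∀ {n} (p : Fin n) α β {A B C : Matrix Carrier n} →
    (∀ i → A i p ≈ α * B i p + β * C i p) →
    (∀ i j → j ≢ p → A i j ≈ B i j) → (∀ i j → j ≢ p → A i j ≈ C i j) →
    det A ≈ α * det B + β * det C
  det-linear {suc n} p α β {A} {B} {C} at-p A≈B A≈C = begin
    sum (cofactorTerm A)
      ≈⟨ sum-cong-≋ term ⟩
    sum (λ j → α * cofactorTerm B j + β * cofactorTerm C j)
      ≈⟨ ∑-distrib-+ (λ j → α * cofactorTerm B j) (λ j → β * cofactorTerm C j) ⟩
    sum (λ j → α * cofactorTerm B j) + sum (λ j → β * cofactorTerm C j)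
      ≈⟨ +-cong (*-distribˡ-sum α (cofactorTerm B)) (*-distribˡ-sum β (cofactorTerm C)) ⟨
    α * det B + β * det C ∎
    where
    term : ∀ j → cofactorTerm A j ≈ α * cofactorTerm B j + β * cofactorTerm C j
    term j with j Fin.≟ p
    ... | yes ≡.refl = begin
      s * (A zero p * D)
        ≈⟨ *-congˡ (*-congʳ (at-p zero)) ⟩
      s * ((α * B zero p + β * C zero p) * D)
        ≈⟨ solve 6 (λ s α β b c D → s :* ((α :* b :+ β :* c) :* D) := α :* (s :* (b :* D)) :+ β :* (s :* (c :* D))) refl s α β (B zero p) (C zero p) D ⟩
      α * (s * (B zero p * D)) + β * (s * (C zero p * D))
        ≈⟨ +-cong (*-congˡ (*-congˡ (*-congˡ (det-cong λ i k → A≈B (suc i) _ (Fin.punchInᵢ≢i p k)))))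
                  (*-congˡ (*-congˡ (*-congˡ (det-cong λ i k → A≈C (suc i) _ (Fin.punchInᵢ≢i p k))))) ⟩
      α * cofactorTerm B p + β * cofactorTerm C p ∎
      where
      s = (- 1#) ^ toℕ j
      D = det (minor A p)
    ... | no j≢p = begin
      s * (A zero j * det (minor A j))
        ≈⟨ *-congˡ (*-congˡ (det-linear q α β at-q
             (λ i k k≢q → A≈B (suc i) _ (avoids k≢q)) (λ i k k≢q → A≈C (suc i) _ (avoids k≢q)))) ⟩
      s * (A zero j * (α * det (minor B j) + β * det (minor C j)))
        ≈⟨ solve 6 (λ s a α β D E → s :* (a :* (α :* D :+ β :* E)) := α :* (s :* (a :* D)) :+ β :* (s :* (a :* E))) refl s (A zero j) α β _ _ ⟩
      α * (s * (A zero j * det (minor B j))) + β * (s * (A zero j * det (minor C j)))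
        ≈⟨ +-cong (*-congˡ (*-congˡ (*-congʳ (A≈B zero j j≢p)))) (*-congˡ (*-congˡ (*-congʳ (A≈C zero j j≢p)))) ⟩
      α * cofactorTerm B j + β * cofactorTerm C j ∎
      where
      s = (- 1#) ^ toℕ j
      q = punchOut j≢p
      avoids : ∀ {k} → k ≢ q → punchIn j k ≢ p
      avoids k≢q eq = k≢q (Fin.punchIn-injective j _ _ (≡.trans eq (≡.sym (Fin.punchIn-punchOut j≢p))))
      at-q : ∀ i → minor A j i q ≈ α * minor B j i q + β * minor C j i q
      at-q i rewrite Fin.punchIn-punchOut j≢p = at-p (suc i)

  det-zero-column : ∀ {n} (p : Fin n) {A : Matrix Carrier n} → (∀ i → A i p ≈ 0#) → det A ≈ 0#
  det-zero-column p {A} Aₚ≈0 = begin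
    det A                         ≈⟨ det-linear p 0# 0# {A} {A} {A} (λ i → trans (Aₚ≈0 i) (sym (zero-combination _))) (λ _ _ _ → refl) (λ _ _ _ → refl) ⟩
    0# * det A + 0# * det A       ≈⟨ zero-combination _ ⟩
    0#                            ∎
    where
    zero-combination : ∀ x → 0# * x + 0# * x ≈ 0#
    zero-combination x = trans (+-cong (zeroˡ x) (zeroˡ x)) (+-identityʳ 0#)

  infixl 10 _[_]≔_

  _[_]≔_ : ∀ {m n} → (Fin m → Fin n → Carrier) → Fin n → (Fin m → Carrier) → Fin m → Fin n → Carrier
  (A [ p ]≔ u) i j = if does (j Fin.≟ p) then u i else A i j

  []≔-at : ∀ {m n} (A : Fin m → Fin n → Carrier) p u i → (A [ p ]≔ u) i p ≡ u i
  []≔-at A p u i rewrite dec-true (p Fin.≟ p) ≡.refl = ≡.refl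

  []≔-off : ∀ {m n} (A : Fin m → Fin n → Carrier) {p} u i {j} → j ≢ p → (A [ p ]≔ u) i j ≡ A i j
  []≔-off A {p} u i {j} j≢p rewrite dec-false (j Fin.≟ p) j≢p = ≡.refl

  Alternating : ∀ {n} → Fin n → Fin n → Set _
  Alternating {n} p q = ∀ (A : Matrix Carrier n) → (∀ i → A i p ≈ A i q) → det A ≈ 0#

  inject₁≢suc : ∀ {n} (p : Fin n) → inject₁ p ≢ suc p
  inject₁≢suc zero    ()
  inject₁≢suc (suc p) eq = inject₁≢suc p (Fin.suc-injective eq)

  punchIn-adjacent : ∀ {n} (p : Fin (suc n)) (j : Fin (suc (suc n))) → j ≢ inject₁ p → j ≢ suc p →
    ∃ λ (q : Fin n) → punchIn j (inject₁ q) ≡ inject₁ p × punchIn j (suc q) ≡ suc p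
  punchIn-adjacent zero    zero          j≢p _    = contradiction ≡.refl j≢p
  punchIn-adjacent (suc p) zero          _   _    = p , ≡.refl , ≡.refl
  punchIn-adjacent zero    (suc zero)    _   j≢sp = contradiction ≡.refl j≢sp
  punchIn-adjacent {suc n} zero (suc (suc j)) _ _ = zero , ≡.refl , ≡.refl
  punchIn-adjacent {suc n} (suc p) (suc j) j≢p j≢sp
    with punchIn-adjacent p j (j≢p ∘ ≡.cong suc) (j≢sp ∘ ≡.cong suc)
  ... | q , eq₁ , eq₂ = suc q , ≡.cong suc eq₁ , ≡.cong suc eq₂

  -- The two cofactor terms that delete one of the equal columns have equal minors, because the
  -- columns are adjacent, and opposite signs. Every other minor still contains both columns, still
  -- adjacent, so the induction stays within the adjacent case.
  alternating-adjacent : ∀ {n} (p : Fin n) → Alternating (inject₁ p) (suc p)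
  alternating-adjacent {suc n} p A Aₚ≈Aₛₚ = sum-cancel-adjacent (cofactorTerm A) p cancel vanish
    where
    minors : ∀ {n m} (p : Fin (suc n)) (B : Fin m → Fin (suc (suc n)) → Carrier) →
             (∀ i → B i (inject₁ p) ≈ B i (suc p)) →
             ∀ i k → B i (punchIn (inject₁ p) k) ≈ B i (punchIn (suc p) k)
    minors zero    B eq i zero    = sym (eq i)
    minors zero    B eq i (suc k) = refl
    minors {suc n} (suc p) B eq i zero    = refl
    minors {suc n} (suc p) B eq i (suc k) = minors p (λ i → B i ∘ suc) eq i k

    cancel : cofactorTerm A (inject₁ p) + cofactorTerm A (suc p) ≈ 0#
    cancel = begin
      (- 1#) ^ toℕ (inject₁ p) * (A zero (inject₁ p) * det (minor A (inject₁ p))) + cofactorTerm A (suc p)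
        ≈⟨ +-congʳ (*-cong (reflexive (≡.cong ((- 1#) ^_) (Fin.toℕ-inject₁ p)))
                           (*-cong (Aₚ≈Aₛₚ zero) (det-cong (minors p (A ∘ suc) (Aₚ≈Aₛₚ ∘ suc))))) ⟩
      (- 1#) ^ toℕ p * (A zero (suc p) * D) + - 1# * (- 1#) ^ toℕ p * (A zero (suc p) * D)
        ≈⟨ solve 4 (λ o s a D → s :* (a :* D) :+ (:- o) :* s :* (a :* D) := s :* (a :* D) :- o :* (s :* (a :* D))) refl 1# ((- 1#) ^ toℕ p) (A zero (suc p)) D ⟩
      z - 1# * z
        ≈⟨ +-congˡ (-‿cong (*-identityˡ z)) ⟩
      z - z
        ≈⟨ -‿inverseʳ z ⟩
      0# ∎
      where
      D = det (minor A (suc p))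
      z = (- 1#) ^ toℕ p * (A zero (suc p) * D)

    vanish : ∀ j → j ≢ inject₁ p → j ≢ suc p → cofactorTerm A j ≈ 0#
    vanish j j≢p j≢sp with punchIn-adjacent p j j≢p j≢sp
    ... | q , eq₁ , eq₂ = begin
      (- 1#) ^ toℕ j * (A zero j * det (minor A j))
        ≈⟨ *-congˡ (*-congˡ (alternating-adjacent q (minor A j) (λ i →
             trans (reflexive (≡.cong (A (suc i)) eq₁)) (trans (Aₚ≈Aₛₚ (suc i)) (reflexive (≡.cong (A (suc i)) (≡.sym eq₂))))))) ⟩
      (- 1#) ^ toℕ j * (A zero j * 0#)
        ≈⟨ *-congˡ (zeroʳ _) ⟩
      (- 1#) ^ toℕ j * 0#
        ≈⟨ zeroʳ _ ⟩
      0# ∎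

  -- With a, b the columns p and r, the matrix whose columns r and r+1 are both
  -- a + b has determinant 0, and expanding it leaves only the term with columns a, b, a.
  alternating-step : ∀ {n} (p : Fin (suc n)) (r : Fin n) → p ≢ suc r →
    Alternating p (inject₁ r) → Alternating p (suc r)
  alternating-step p r p≢q alt A Aₚ≈A_q = begin
    det A
      ≈⟨ solve 1 (λ x → x := con (+ 1) :* x :+ con (+ 1) :* con (+ 0)) refl _ ⟩
    1ℤ * det A + 1ℤ * 0#
      ≈⟨ +-congˡ (*-congˡ (alternating-adjacent r (A [ q ]≔ b) (λ i → reflexive (≡.trans ([]≔-off A b i (inject₁≢suc r)) (≡.sym ([]≔-at A q b i)))))) ⟨
    1ℤ * det A + 1ℤ * det (A [ q ]≔ b)
      ≈⟨ det-linear q 1ℤ 1ℤ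
           (λ i → trans (reflexive ([]≔-at A q a+b i)) (trans (sum-as-combination _ _) (+-cong (*-congˡ (Aₚ≈A_q i)) (*-congˡ (reflexive (≡.sym ([]≔-at A q b i)))))))
           (λ i j j≢q → reflexive ([]≔-off A a+b i j≢q))
           (λ i j j≢q → reflexive (≡.trans ([]≔-off A a+b i j≢q) (≡.sym ([]≔-off A b i j≢q)))) ⟨
    det (A [ q ]≔ a+b)
      ≈⟨ solve 1 (λ x → x := con (+ 1) :* con (+ 0) :+ con (+ 1) :* x) refl _ ⟩
    1ℤ * 0# + 1ℤ * det (A [ q ]≔ a+b)
      ≈⟨ +-congʳ (*-congˡ (alt ((A [ r′ ]≔ a) [ q ]≔ a+b) first-vanishes)) ⟨
    1ℤ * det ((A [ r′ ]≔ a) [ q ]≔ a+b) + 1ℤ * det (A [ q ]≔ a+b)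
      ≈⟨ det-linear r′ 1ℤ 1ℤ
           (λ i → trans (reflexive (≡.trans ([]≔-off (A [ r′ ]≔ a+b) a+b i r′≢q) ([]≔-at A r′ a+b i))) (trans (sum-as-combination _ _)
             (+-cong (*-congˡ (reflexive (≡.sym (≡.trans ([]≔-off (A [ r′ ]≔ a) a+b i r′≢q) ([]≔-at A r′ a i)))))
                     (*-congˡ (reflexive (≡.sym ([]≔-off A a+b i r′≢q)))))))
           (λ i j j≢r → reflexive (off-r j≢r (A [ r′ ]≔ a+b) (A [ r′ ]≔ a) i (≡.trans ([]≔-off A a+b i j≢r) (≡.sym ([]≔-off A a i j≢r)))))
           (λ i j j≢r → reflexive (off-r j≢r (A [ r′ ]≔ a+b) A i ([]≔-off A a+b i j≢r))) ⟨
    det ((A [ r′ ]≔ a+b) [ q ]≔ a+b)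
      ≈⟨ alternating-adjacent r ((A [ r′ ]≔ a+b) [ q ]≔ a+b) (λ i → reflexive (≡.trans (≡.trans ([]≔-off (A [ r′ ]≔ a+b) a+b i r′≢q) ([]≔-at A r′ a+b i)) (≡.sym ([]≔-at (A [ r′ ]≔ a+b) q a+b i)))) ⟩
    0# ∎
    where
    q = suc r
    r′ = inject₁ r
    r′≢q = inject₁≢suc r
    1ℤ = ⟦ + 1 ⟧ℤ
    a b a+b : Fin _ → Carrier
    a i = A i p
    b i = A i r′
    a+b i = a i + b i
    sum-as-combination : ∀ x y → x + y ≈ 1ℤ * x + 1ℤ * y
    sum-as-combination = solve 2 (λ x y → x :+ y := con (+ 1) :* x :+ con (+ 1) :* y) refl
    off-r : ∀ {j} → j ≢ r′ → ∀ B C i → B i j ≡ C i j → (B [ q ]≔ a+b) i j ≡ (C [ q ]≔ a+b) i j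
    off-r {j} _ B C i eq with does (j Fin.≟ q)
    ... | true  = ≡.refl
    ... | false = eq
    first-vanishes : ∀ i → ((A [ r′ ]≔ a) [ q ]≔ a+b) i p ≈ ((A [ r′ ]≔ a) [ q ]≔ a+b) i r′
    first-vanishes i = reflexive (≡.trans (≡.trans ([]≔-off (A [ r′ ]≔ a) a+b i p≢q) aₚ)
      (≡.sym (≡.trans ([]≔-off (A [ r′ ]≔ a) a+b i r′≢q) ([]≔-at A r′ a i))))
      where
      aₚ : (A [ r′ ]≔ a) i p ≡ a i
      aₚ with does (p Fin.≟ r′)
      ... | true  = ≡.refl
      ... | false = ≡.refl

  -- Induction on the gap `k` between the columns, `alternating-step` moving the right one by a
  -- place.
  alternating-< : ∀ {n} k (p q : Fin n) → suc k ℕ.+ toℕ p ≡ toℕ q → Alternating p q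
  alternating-< zero    p (suc r) eq
    with Fin.toℕ-injective {i = p} {inject₁ r} (≡.trans (ℕ.suc-injective eq) (≡.sym (Fin.toℕ-inject₁ r)))
  ... | ≡.refl = alternating-adjacent r
  alternating-< (suc k) p (suc r) eq = alternating-step p r
    (λ p≡q → ℕ.<⇒≢ (ℕ.m≤n⇒m≤1+n (ℕ.≤-trans (ℕ.m≤n+m (suc (toℕ p)) k) (ℕ.≤-reflexive (ℕ.+-suc k (toℕ p))))) (≡.trans (≡.cong toℕ p≡q) (≡.sym eq)))
    (alternating-< k p (inject₁ r) (≡.trans (ℕ.suc-injective eq) (≡.sym (Fin.toℕ-inject₁ r))))

  alternating : ∀ {n} {p q : Fin n} → p ≢ q → Alternating p q
  alternating {p = p} {q} p≢q A eq with ℕ.<-cmp (toℕ p) (toℕ q)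
  ... | tri≈ _ p≡q _ = contradiction (Fin.toℕ-injective p≡q) p≢q
  ... | tri< p<q _ _ with ℕ.m≤n⇒∃[o]m+o≡n p<q
  ...   | k , eq′ = alternating-< k p q (≡.trans (≡.cong suc (ℕ.+-comm k (toℕ p))) eq′) A eq
  alternating {p = p} {q} p≢q A eq | tri> _ _ q<p with ℕ.m≤n⇒∃[o]m+o≡n q<p
  ...   | k , eq′ = alternating-< k q p (≡.trans (≡.cong suc (ℕ.+-comm k (toℕ q))) eq′) A (sym ∘ eq)

-- Cramer's rule and rank-one updates.

module RankOne {c ℓ} (R : CommutativeRing c ℓ) where
  open CommutativeRing R hiding (zero)
  open Determinants R
  open IntegerSolver R
  open SetoidReasoning setoid

  []≔-cong : ∀ {m n} (A : Fin m → Fin n → Carrier) p {u w : Fin m → Carrier} → (∀ i → u i ≈ w i) →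
    ∀ i j → (A [ p ]≔ u) i j ≈ (A [ p ]≔ w) i j
  []≔-cong A p u≈w i j with does (j Fin.≟ p)
  ... | true  = u≈w i
  ... | false = refl

  []≔-self : ∀ {m n} (A : Fin m → Fin n → Carrier) p i j → (A [ p ]≔ (λ i → A i p)) i j ≡ A i j
  []≔-self A p i j with j Fin.≟ p
  ... | yes ≡.refl = ≡.refl
  ... | no  _      = ≡.refl

  det-[]≔-linear : ∀ {n} (A : Matrix Carrier n) p α β u w →
    det (A [ p ]≔ (λ i → α * u i + β * w i)) ≈ α * det (A [ p ]≔ u) + β * det (A [ p ]≔ w)
  det-[]≔-linear A p α β u w = det-linear p α β {A [ p ]≔ αu+βw} {A [ p ]≔ u} {A [ p ]≔ w}
    (λ i → reflexive (≡.trans ([]≔-at A p αu+βw i)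
      (≡.sym (≡.cong₂ (λ x y → α * x + β * y) ([]≔-at A p u i) ([]≔-at A p w i)))))
    (λ i j j≢p → reflexive (≡.trans ([]≔-off A αu+βw i j≢p) (≡.sym ([]≔-off A u i j≢p))))
    (λ i j j≢p → reflexive (≡.trans ([]≔-off A αu+βw i j≢p) (≡.sym ([]≔-off A w i j≢p))))
    where αu+βw = λ i → α * u i + β * w i

  det-[]≔-scale : ∀ {n} (A : Matrix Carrier n) p α u →
    det (A [ p ]≔ (λ i → α * u i)) ≈ α * det (A [ p ]≔ u)
  det-[]≔-scale A p α u = begin
    det (A [ p ]≔ (λ i → α * u i))
      ≈⟨ det-cong ([]≔-cong A p (λ i → sym (absorb _ _))) ⟩
    det (A [ p ]≔ (λ i → α * u i + 0# * u i))
      ≈⟨ det-[]≔-linear A p α 0# u u ⟩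
    α * det (A [ p ]≔ u) + 0# * det (A [ p ]≔ u)
      ≈⟨ absorb _ _ ⟩
    α * det (A [ p ]≔ u) ∎
    where
    absorb : ∀ x y → x + 0# * y ≈ x
    absorb x y = trans (+-congˡ (zeroˡ y)) (+-identityʳ x)

  infixl 8 _·_ _∙ᵥ_

  _·_ : ∀ {m n} → (Fin m → Fin n → Carrier) → (Fin n → Carrier) → Fin m → Carrier
  (A · v) i = sum λ j → A i j * v j

  _∙ᵥ_ : ∀ {n} → (Fin n → Carrier) → (Fin n → Carrier) → Carrier
  u ∙ᵥ v = sum λ i → u i * v i

  det-[]≔-sum : ∀ {n m} (A : Matrix Carrier n) p (U : Fin n → Fin m → Carrier) v →
    det (A [ p ]≔ (U · v)) ≈ sum λ j → v j * det (A [ p ]≔ (λ i → U i j))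
  det-[]≔-sum {m = zero}  A p U v = det-zero-column p λ i → reflexive ([]≔-at A p (U · v) i)
  det-[]≔-sum {m = suc m} A p U v = begin
    det (A [ p ]≔ (U · v))
      ≈⟨ det-cong ([]≔-cong A p λ i →
           solve 3 (λ x y z → x :* y :+ z := y :* x :+ con (+ 1) :* z) refl (U i zero) (v zero) (((λ i j → U i (suc j)) · (v ∘ suc)) i)) ⟩
    det (A [ p ]≔ (λ i → v zero * U i zero + ⟦ + 1 ⟧ℤ * ((λ i j → U i (suc j)) · (v ∘ suc)) i))
      ≈⟨ det-[]≔-linear A p (v zero) ⟦ + 1 ⟧ℤ (λ i → U i zero) ((λ i j → U i (suc j)) · (v ∘ suc)) ⟩
    v zero * det (A [ p ]≔ (λ i → U i zero)) + ⟦ + 1 ⟧ℤ * det (A [ p ]≔ ((λ i j → U i (suc j)) · (v ∘ suc)))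
      ≈⟨ +-congˡ (solve 1 (λ x → con (+ 1) :* x := x) refl _) ⟩
    v zero * det (A [ p ]≔ (λ i → U i zero)) + det (A [ p ]≔ ((λ i j → U i (suc j)) · (v ∘ suc)))
      ≈⟨ +-congˡ (det-[]≔-sum A p (λ i j → U i (suc j)) (v ∘ suc)) ⟩
    sum (λ j → v j * det (A [ p ]≔ (λ i → U i j))) ∎

  -- The new column is a combination of the columns of `A`; by linearity, every summand except that
  -- of column `p` repeats a column. Nothing is divided, so the rule holds for singular matrices
  -- too.
  cramer : ∀ {n} (A : Matrix Carrier n) v p → det (A [ p ]≔ (A · v)) ≈ v p * det A
  cramer A v p = begin
    det (A [ p ]≔ (A · v))
      ≈⟨ det-[]≔-sum A p A v ⟩
    sum (λ j → v j * det (A [ p ]≔ (λ i → A i j)))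
      ≈⟨ sum-single _ p (λ j j≢p → trans (*-congˡ (repeated j j≢p)) (zeroʳ (v j))) ⟩
    v p * det (A [ p ]≔ (λ i → A i p))
      ≈⟨ *-congˡ (det-cong (λ i j → reflexive ([]≔-self A p i j))) ⟩
    v p * det A ∎
    where
    repeated : ∀ j → j ≢ p → det (A [ p ]≔ (λ i → A i j)) ≈ 0#
    repeated j j≢p = alternating j≢p (A [ p ]≔ (λ i → A i j))
      (λ i → reflexive (≡.trans ([]≔-off A (λ i → A i j) i j≢p) (≡.sym ([]≔-at A p (λ i → A i j) i))))

  addColumn : ∀ {n} → Matrix Carrier n → Fin n → (Fin n → Carrier) → Matrix Carrier n
  addColumn A p t i j = A i j + t j * A i p

  -- Induction on a bound k for the support of t, clearing one column at a time.
  det-addColumn-bounded : ∀ {n} (A : Matrix Carrier n) p k t → t p ≈ 0# → (∀ j → k ℕ.≤ toℕ j → t j ≈ 0#) →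
    det (addColumn A p t) ≈ det A
  det-addColumn-bounded A p zero t _ t≈0 = det-cong λ i j →
    trans (+-congˡ (trans (*-congʳ (t≈0 j ℕ.z≤n)) (zeroˡ _))) (+-identityʳ _)
  det-addColumn-bounded {n} A p (suc k) t tₚ≈0 t≈0 with k ℕ.<? n
  ... | no  k≮n = det-addColumn-bounded A p k t tₚ≈0
                    (λ j k≤j → contradiction (ℕ.≤-<-trans k≤j (Fin.toℕ<n j)) k≮n)
  ... | yes k<n with fromℕ< k<n | Fin.toℕ-fromℕ< k<n
  ...   | q | toℕq≡k with p Fin.≟ q
  ...     | yes ≡.refl = det-addColumn-bounded A p k t tₚ≈0 bound
    where
    bound : ∀ j → k ℕ.≤ toℕ j → t j ≈ 0#
    bound j k≤j with ℕ.m≤n⇒m<n∨m≡n k≤j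
    ... | inj₁ k<j = t≈0 j k<j
    ... | inj₂ k≡j = trans (reflexive (≡.cong t (Fin.toℕ-injective
                       (≡.trans (≡.sym k≡j) (≡.sym toℕq≡k))))) tₚ≈0
  ...     | no p≢q = begin
    det (addColumn A p t)
      ≈⟨ det-linear q ⟦ + 1 ⟧ℤ (t q) {addColumn A p t} {B} {B [ q ]≔ (λ i → A i p)} at-q B≈ (λ i j j≢q → trans (B≈ i j j≢q) (reflexive (≡.sym ([]≔-off B (λ i → A i p) i j≢q)))) ⟩
    ⟦ + 1 ⟧ℤ * det B + t q * det (B [ q ]≔ (λ i → A i p))
      ≈⟨ +-congˡ (*-congˡ (alternating p≢q (B [ q ]≔ (λ i → A i p)) repeated)) ⟩
    ⟦ + 1 ⟧ℤ * det B + t q * 0#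
      ≈⟨ solve 2 (λ x y → con (+ 1) :* x :+ y :* con (+ 0) := x) refl _ _ ⟩
    det B
      ≈⟨ det-addColumn-bounded A p k t′ (trans (reflexive (t′-off p≢q)) tₚ≈0) bound ⟩
    det A ∎
    where
    t′ : Fin n → Carrier
    t′ j = if does (j Fin.≟ q) then 0# else t j
    t′-off : ∀ {j} → j ≢ q → t′ j ≡ t j
    t′-off {j} j≢q rewrite dec-false (j Fin.≟ q) j≢q = ≡.refl
    t′-at : t′ q ≡ 0#
    t′-at rewrite dec-true (q Fin.≟ q) ≡.refl = ≡.refl
    B : Matrix Carrier n
    B = addColumn A p t′
    B≈ : ∀ i j → j ≢ q → addColumn A p t i j ≈ B i j
    B≈ i j j≢q = reflexive (≡.cong (λ x → A i j + x * A i p) (≡.sym (t′-off j≢q)))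
    at-q : ∀ i → addColumn A p t i q ≈ ⟦ + 1 ⟧ℤ * B i q + t q * (B [ q ]≔ (λ i → A i p)) i q
    at-q i = begin
      A i q + t q * A i p
        ≈⟨ solve 3 (λ x y z → x :+ y :* z := con (+ 1) :* (x :+ con (+ 0) :* z) :+ y :* z) refl _ _ _ ⟩
      ⟦ + 1 ⟧ℤ * (A i q + 0# * A i p) + t q * A i p
        ≡⟨ ≡.cong₂ (λ x y → ⟦ + 1 ⟧ℤ * (A i q + x * A i p) + t q * y) t′-at ([]≔-at B q (λ i → A i p) i) ⟨
      ⟦ + 1 ⟧ℤ * B i q + t q * (B [ q ]≔ (λ i → A i p)) i q ∎
    repeated : ∀ i → (B [ q ]≔ (λ i → A i p)) i p ≈ (B [ q ]≔ (λ i → A i p)) i q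
    repeated i = begin
      (B [ q ]≔ (λ i → A i p)) i p   ≡⟨ []≔-off B (λ i → A i p) i p≢q ⟩
      A i p + t′ p * A i p           ≈⟨ +-congˡ (*-congʳ (trans (reflexive (t′-off p≢q)) tₚ≈0)) ⟩
      A i p + 0# * A i p             ≈⟨ +-congˡ (zeroˡ _) ⟩
      A i p + 0#                     ≈⟨ +-identityʳ _ ⟩
      A i p                          ≡⟨ []≔-at B q (λ i → A i p) i ⟨
      (B [ q ]≔ (λ i → A i p)) i q   ∎
    bound : ∀ j → k ℕ.≤ toℕ j → t′ j ≈ 0#
    bound j k≤j with j Fin.≟ q
    ... | yes _  = refl
    ... | no j≢q with ℕ.m≤n⇒m<n∨m≡n k≤j
    ...   | inj₁ k<j = t≈0 j k<j
    ...   | inj₂ k≡j = contradiction (Fin.toℕ-injective (≡.trans (≡.sym k≡j) (≡.sym toℕq≡k))) j≢q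

  det-addColumn : ∀ {n} (A : Matrix Carrier n) p t → t p ≈ 0# → det (addColumn A p t) ≈ det A
  det-addColumn {n} A p t tₚ≈0 = det-addColumn-bounded A p n t tₚ≈0
    (λ j n≤j → contradiction (Fin.toℕ<n j) (ℕ.≤⇒≯ n≤j))

  ·-rankOne : ∀ {n} (A A′ : Matrix Carrier n) v s → (∀ i j → A′ i j ≈ A i j + s * (v i * v j)) →
    ∀ x i → (A′ · x) i ≈ (A · x) i + s * (v i * (v ∙ᵥ x))
  ·-rankOne A A′ v s A′≈ x i = begin
    sum (λ j → A′ i j * x j)
      ≈⟨ sum-cong-≋ (λ j → trans (*-congʳ (A′≈ i j))
           (solve 5 (λ a s u w x → (a :+ s :* (u :* w)) :* x := a :* x :+ s :* u :* (w :* x)) refl (A i j) s (v i) (v j) (x j))) ⟩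
    sum (λ j → A i j * x j + s * v i * (v j * x j))
      ≈⟨ ∑-distrib-+ (λ j → A i j * x j) (λ j → s * v i * (v j * x j)) ⟩
    (A · x) i + sum (λ j → s * v i * (v j * x j))
      ≈⟨ +-congˡ (*-distribˡ-sum (s * v i) (λ j → v j * x j)) ⟨
    (A · x) i + s * v i * (v ∙ᵥ x)
      ≈⟨ +-congˡ (*-assoc _ _ _) ⟩
    (A · x) i + s * (v i * (v ∙ᵥ x)) ∎

  -- Cramer's rule turns both determinants into multiples of the one whose
  -- column p is v, where the rank-one term is a sum of column operations.
  det-rankOne : ∀ {n} (A A′ : Matrix Carrier n) v κ s → (∀ i → (A · v) i ≈ κ * v i) →
    (∀ i j → A′ i j ≈ A i j + s * (v i * v j)) →
    ∀ p → v p * (κ * det A′) ≈ v p * ((κ + s * (v ∙ᵥ v)) * det A)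
  det-rankOne {n} A A′ v κ s Av≈κv A′≈ p = begin
    v p * (κ * det A′)
      ≈⟨ solve 3 (λ a b c → a :* (b :* c) := b :* (a :* c)) refl (v p) κ (det A′) ⟩
    κ * (v p * det A′)
      ≈⟨ *-congˡ (eigen A′ τ A′v≈τv) ⟩
    κ * (τ * det (A′ [ p ]≔ v))
      ≈⟨ *-congˡ (*-congˡ same) ⟩
    κ * (τ * det (A [ p ]≔ v))
      ≈⟨ solve 3 (λ a b c → a :* (b :* c) := b :* (a :* c)) refl κ τ (det (A [ p ]≔ v)) ⟩
    τ * (κ * det (A [ p ]≔ v))
      ≈⟨ *-congˡ (eigen A κ Av≈κv) ⟨
    τ * (v p * det A)
      ≈⟨ solve 3 (λ a b c → b :* (a :* c) := a :* (b :* c)) refl (v p) τ (det A) ⟩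
    v p * (τ * det A) ∎
    where
    τ = κ + s * (v ∙ᵥ v)
    eigen : ∀ B ρ → (∀ i → (B · v) i ≈ ρ * v i) → v p * det B ≈ ρ * det (B [ p ]≔ v)
    eigen B ρ Bv≈ρv = begin
      v p * det B                        ≈⟨ cramer B v p ⟨
      det (B [ p ]≔ (B · v))             ≈⟨ det-cong ([]≔-cong B p Bv≈ρv) ⟩
      det (B [ p ]≔ (λ i → ρ * v i))     ≈⟨ det-[]≔-scale B p ρ v ⟩
      ρ * det (B [ p ]≔ v)               ∎
    A′v≈τv : ∀ i → (A′ · v) i ≈ τ * v i
    A′v≈τv i = begin
      (A′ · v) i                         ≈⟨ ·-rankOne A A′ v s A′≈ v i ⟩
      (A · v) i + s * (v i * (v ∙ᵥ v))   ≈⟨ +-congʳ (Av≈κv i) ⟩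
      κ * v i + s * (v i * (v ∙ᵥ v))     ≈⟨ solve 4 (λ κ s x N → κ :* x :+ s :* (x :* N) := (κ :+ s :* N) :* x) refl κ s (v i) (v ∙ᵥ v) ⟩
      τ * v i                            ∎
    t : Fin n → Carrier
    t j = if does (j Fin.≟ p) then 0# else s * v j
    tₚ≈0 : t p ≈ 0#
    tₚ≈0 rewrite dec-true (p Fin.≟ p) ≡.refl = refl
    columns : ∀ i j → (A′ [ p ]≔ v) i j ≈ addColumn (A [ p ]≔ v) p t i j
    columns i j rewrite []≔-at A p v i with j Fin.≟ p
    ... | yes _ = sym (trans (+-congˡ (zeroˡ _)) (+-identityʳ _))
    ... | no  _ = trans (A′≈ i j) (solve 4 (λ a s x y → a :+ s :* (x :* y) := a :+ s :* y :* x) refl (A i j) s (v i) (v j))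
    same : det (A′ [ p ]≔ v) ≈ det (A [ p ]≔ v)
    same = trans (det-cong columns) (det-addColumn (A [ p ]≔ v) p t tₚ≈0)

-- Ordered rings with negative trichotomy.

-- An order is given by its positive elements. Trichotomy is stated negatively,
-- which is what a constructive model of ℝ satisfies.
record ArchimedeanOrder {c ℓ} (R : CommutativeRing c ℓ) p : Set (c ⊔ ℓ ⊔ lsuc p) where
  open CommutativeRing R
  field
    Positive        : Carrier → Set p
    positive-resp   : ∀ {x y} → x ≈ y → Positive x → Positive y
    positive-+      : ∀ {x y} → Positive x → Positive y → Positive (x + y)
    positive-*      : ∀ {x y} → Positive x → Positive y → Positive (x * y)
    positive-1      : Positive 1#
    0-not-positive  : ¬ Positive 0#
    trichotomous    : ∀ {x} → ¬ Positive x → ¬ Positive (- x) → x ≈ 0#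
    archimedean     : ∀ {x} → Positive x → ∀ y → ∃ λ s → Positive (s * x - y)

module OrderProperties {c ℓ p} {R : CommutativeRing c ℓ} (O : ArchimedeanOrder R p) where
  open CommutativeRing R hiding (zero)
  open ArchimedeanOrder O
  open Determinants R using (sum)
  open IntegerSolver R

  -- Trichotomy being negative, a case split on a sign is possible only towards absurdity. This is
  -- that split, with one refutation for each of positive, zero and negative.
  compare : ∀ x → ¬ Positive x → ¬ (x ≈ 0#) → ¬ Positive (- x) → ⊥
  compare x ¬x>0 x≉0 ¬x<0 = x≉0 (trichotomous ¬x>0 ¬x<0)

  positive⇒≉0 : ∀ {x} → Positive x → ¬ (x ≈ 0#)
  positive⇒≉0 x>0 x≈0 = 0-not-positive (positive-resp x≈0 x>0)

  positive-asym : ∀ {x} → Positive x → ¬ Positive (- x)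
  positive-asym {x} x>0 x<0 = 0-not-positive (positive-resp (-‿inverseʳ x) (positive-+ x>0 x<0))

  ≈0-stable : ∀ {x} → ¬ ¬ (x ≈ 0#) → x ≈ 0#
  ≈0-stable {x} ¬¬x≈0 = trichotomous (λ x>0 → ¬¬x≈0 (positive⇒≉0 x>0))
    (λ x<0 → ¬¬x≈0 λ x≈0 → positive⇒≉0 x<0 (trans (-‿cong x≈0) (solve 0 (:- con (+ 0) := con (+ 0)) refl)))

  -- Cancellation without inverses: if `y` had a sign then, whichever sign `x` has, the product
  -- would have one as well.
  integral : ∀ {x y} → x * y ≈ 0# → ¬ (x ≈ 0#) → y ≈ 0#
  integral {x} {y} xy≈0 x≉0 = trichotomous (λ y>0 → not-positive y>0 xy≈0) (λ y<0 → not-positive y<0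
    (trans (solve 2 (λ x y → x :* (:- y) := :- (x :* y)) refl x y) (negated xy≈0)))
    where
    negated : ∀ {z} → z ≈ 0# → - z ≈ 0#
    negated z≈0 = trans (-‿cong z≈0) (solve 0 (:- con (+ 0) := con (+ 0)) refl)
    not-positive : ∀ {z} → Positive z → ¬ (x * z ≈ 0#)
    not-positive {z} z>0 xz≈0 = compare x
      (λ x>0 → positive⇒≉0 (positive-* x>0 z>0) xz≈0)
      x≉0
      (λ x<0 → positive⇒≉0 (positive-* x<0 z>0)
        (trans (solve 2 (λ x z → (:- x) :* z := :- (x :* z)) refl x z) (negated xz≈0)))

  -- Being a negation, it is proved by deriving absurdity, which is where `compare` applies.
  Nonneg : Carrier → Set p
  Nonneg x = ¬ Positive (- x)

  positive⇒nonneg : ∀ {x} → Positive x → Nonneg x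
  positive⇒nonneg = positive-asym

  ≈0⇒nonneg : ∀ {x} → x ≈ 0# → Nonneg x
  ≈0⇒nonneg x≈0 -x>0 = positive⇒≉0 -x>0 (trans (-‿cong x≈0) (solve 0 (:- con (+ 0) := con (+ 0)) refl))

  -- The double negation comes from splitting on the sign of `y`.
  positive-+-nonneg : ∀ {x y} → Positive x → Nonneg y → ¬ ¬ Positive (x + y)
  positive-+-nonneg {x} {y} x>0 y≥0 ¬x+y>0 = compare y
    (λ y>0 → ¬x+y>0 (positive-+ x>0 y>0))
    (λ y≈0 → ¬x+y>0 (positive-resp (trans (sym (+-identityʳ x)) (+-congˡ (sym y≈0))) x>0))
    y≥0

  nonneg-+ : ∀ {x y} → Nonneg x → Nonneg y → Nonneg (x + y)
  nonneg-+ {x} {y} x≥0 y≥0 x+y<0 = positive-+-nonneg x+y<0 y≥0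
    (x≥0 ∘ positive-resp (solve 2 (λ x y → :- (x :+ y) :+ y := :- x) refl x y))

  nonneg-* : ∀ {x y} → Nonneg x → Nonneg y → Nonneg (x * y)
  nonneg-* {x} {y} x≥0 y≥0 xy<0 = compare x
    (λ x>0 → compare y
      (λ y>0 → positive-asym (positive-* x>0 y>0) xy<0)
      (λ y≈0 → ≈0⇒nonneg (trans (*-congˡ y≈0) (zeroʳ x)) xy<0)
      y≥0)
    (λ x≈0 → ≈0⇒nonneg (trans (*-congʳ x≈0) (zeroˡ y)) xy<0)
    x≥0

  square-nonneg : ∀ x → Nonneg (x * x)
  square-nonneg x x²<0 = compare x
    (λ x>0 → positive-asym (positive-* x>0 x>0) x²<0)
    (λ x≈0 → ≈0⇒nonneg (trans (*-congˡ x≈0) (zeroʳ x)) x²<0)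
    (λ x<0 → positive-asym (positive-* x<0 x<0) (positive-resp (solve 1 (λ x → :- (x :* x) := :- (:- x :* :- x)) refl x) x²<0))

  square≈0 : ∀ {x} → x * x ≈ 0# → x ≈ 0#
  square≈0 x²≈0 = ≈0-stable λ x≉0 → x≉0 (integral x²≈0 x≉0)

  +-nonpositive : ∀ {x y} → Nonneg x → Nonneg y → ¬ Positive (x + y) → x ≈ 0# × y ≈ 0#
  +-nonpositive {x} {y} x≥0 y≥0 ¬x+y>0 =
    trichotomous (λ x>0 → positive-+-nonneg x>0 y≥0 ¬x+y>0) x≥0 ,
    trichotomous (λ y>0 → positive-+-nonneg y>0 x≥0 (¬x+y>0 ∘ positive-resp (+-comm y x))) y≥0

  sum-nonneg : ∀ {n} {f : Fin n → Carrier} → (∀ i → Nonneg (f i)) → Nonneg (sum f)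
  sum-nonneg {zero}  f≥0 = ≈0⇒nonneg refl
  sum-nonneg {suc n} f≥0 = nonneg-+ (f≥0 zero) (sum-nonneg (f≥0 ∘ suc))

  sum-nonpositive : ∀ {n} {f : Fin n → Carrier} → (∀ i → Nonneg (f i)) → ¬ Positive (sum f) → ∀ i → f i ≈ 0#
  sum-nonpositive f≥0 ¬Σ>0 zero    = proj₁ (+-nonpositive (f≥0 zero) (sum-nonneg (f≥0 ∘ suc)) ¬Σ>0)
  sum-nonpositive f≥0 ¬Σ>0 (suc i) = sum-nonpositive (f≥0 ∘ suc)
    (λ Σ>0 → positive⇒≉0 Σ>0 (proj₂ (+-nonpositive (f≥0 zero) (sum-nonneg (f≥0 ∘ suc)) ¬Σ>0))) i

-- Polynomial functions and the cancellation of a linear factor.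

module Polynomials {c ℓ} (R : CommutativeRing c ℓ) where
  open CommutativeRing R hiding (zero)
  open Determinants R
  open Determinant rawRing using (product) public
  open IntegerSolver R
  open RawSemiringDefinitions (Semiring.rawSemiring semiring) using (_^_)
  open SetoidReasoning setoid

  -- Polynomial functions of degree at most n, through the factor theorem.
  Degree≤ : ℕ → (Carrier → Carrier) → Set (c ⊔ ℓ)
  Degree≤ zero    f = ∀ x y → f x ≈ f y
  Degree≤ (suc n) f = ∀ a → ∃ λ q → Degree≤ n q × (∀ x → f x ≈ f a + (x - a) * q x)

  degree-resp : ∀ n {f g} → (∀ x → f x ≈ g x) → Degree≤ n f → Degree≤ n g
  degree-resp zero    f≈g f-const = λ x y → trans (sym (f≈g x)) (trans (f-const x y) (f≈g y))
  degree-resp (suc n) f≈g f-deg a with f-deg a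
  ... | q , q-deg , eq = q , q-deg , λ x → trans (sym (f≈g x)) (trans (eq x) (+-congʳ (f≈g a)))

  degree-const : ∀ n z → Degree≤ n (const z)
  degree-const zero    z = λ _ _ → refl
  degree-const (suc n) z a = const 0# , degree-const n 0# , λ x → sym (trans (+-congˡ (zeroʳ _)) (+-identityʳ z))

  degree-suc : ∀ n {f} → Degree≤ n f → Degree≤ (suc n) f
  degree-suc zero    f-const a = const 0# , degree-const 0 0# , λ x →
    trans (f-const x a) (sym (trans (+-congˡ (zeroʳ _)) (+-identityʳ _)))
  degree-suc (suc n) f-deg a with f-deg a
  ... | q , q-deg , eq = q , degree-suc n q-deg , eq

  degree-raise : ∀ k {n f} → Degree≤ n f → Degree≤ (k ℕ.+ n) f
  degree-raise zero    f-deg = f-deg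
  degree-raise (suc k) f-deg = degree-suc _ (degree-raise k f-deg)

  degree-+ : ∀ n {f g} → Degree≤ n f → Degree≤ n g → Degree≤ n (λ x → f x + g x)
  degree-+ zero    f-const g-const = λ x y → +-cong (f-const x y) (g-const x y)
  degree-+ (suc n) {f} {g} f-deg g-deg a with f-deg a | g-deg a
  ... | q , q-deg , f≈ | r , r-deg , g≈ = (λ x → q x + r x) , degree-+ n q-deg r-deg , λ x →
    trans (+-cong (f≈ x) (g≈ x))
      (solve 5 (λ f g d q r → (f :+ d :* q) :+ (g :+ d :* r) := (f :+ g) :+ d :* (q :+ r)) refl (f a) (g a) (x - a) (q x) (r x))

  degree-scale : ∀ n z {f} → Degree≤ n f → Degree≤ n (λ x → z * f x)
  degree-scale zero    z f-const = λ x y → *-congˡ (f-const x y)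
  degree-scale (suc n) z {f} f-deg a with f-deg a
  ... | q , q-deg , f≈ = (λ x → z * q x) , degree-scale n z q-deg , λ x →
    trans (*-congˡ (f≈ x)) (solve 4 (λ z f d q → z :* (f :+ d :* q) := z :* f :+ d :* (z :* q)) refl z (f a) (x - a) (q x))

  degree-* : ∀ m n {f g} → Degree≤ m f → Degree≤ n g → Degree≤ (m ℕ.+ n) (λ x → f x * g x)
  degree-* zero    n {f} f-const g-deg =
    degree-resp n (λ x → *-congʳ (f-const 0# x)) (degree-scale n (f 0#) g-deg)
  degree-* (suc m) zero {f} {g} f-deg g-const a with f-deg a
  ... | q , q-deg , f≈ = (λ x → q x * g x) , degree-* m zero q-deg g-const , λ x → begin
    f x * g x                           ≈⟨ *-congʳ (f≈ x) ⟩
    (f a + (x - a) * q x) * g x         ≈⟨ distribʳ _ _ _ ⟩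
    f a * g x + (x - a) * q x * g x     ≈⟨ +-cong (*-congˡ (g-const x a)) (*-assoc _ _ _) ⟩
    f a * g a + (x - a) * (q x * g x)   ∎
  -- Leibniz rule for difference quotients: the quotient of the product at `a` is
  -- `q x * g x + f a * r x`. The second summand has degree at most `n` only and is raised to match
  -- the first.
  degree-* (suc m) (suc n) {f} {g} f-deg g-deg a with f-deg a | g-deg a
  ... | q , q-deg , f≈ | r , r-deg , g≈ = (λ x → q x * g x + f a * r x) ,
    degree-+ (m ℕ.+ suc n) (degree-* m (suc n) q-deg g-deg)
      (≡.subst (λ k → Degree≤ k (λ x → f a * r x)) (≡.sym (ℕ.+-suc m n)) (degree-raise (suc m) (degree-scale n (f a) r-deg))) ,
    λ x → begin
      f x * g x
        ≈⟨ *-congʳ (f≈ x) ⟩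
      (f a + (x - a) * q x) * g x
        ≈⟨ solve 4 (λ f d q g → (f :+ d :* q) :* g := f :* g :+ d :* (q :* g)) refl (f a) (x - a) (q x) (g x) ⟩
      f a * g x + (x - a) * (q x * g x)
        ≈⟨ +-congʳ (*-congˡ (g≈ x)) ⟩
      f a * (g a + (x - a) * r x) + (x - a) * (q x * g x)
        ≈⟨ solve 5 (λ f g d r h → f :* (g :+ d :* r) :+ d :* h := f :* g :+ d :* (h :+ f :* r)) refl (f a) (g a) (x - a) (r x) (q x * g x) ⟩
      f a * g a + (x - a) * (q x * g x + f a * r x) ∎

  Polynomial : (Carrier → Carrier) → Set (c ⊔ ℓ)
  Polynomial f = ∃ λ n → Degree≤ n f

  polynomial-const : ∀ z → Polynomial (const z)
  polynomial-const z = 0 , degree-const 0 z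

  polynomial-id : Polynomial id
  polynomial-id = 1 , λ a → const 1# , degree-const 0 1# , λ x →
    sym (trans (+-congˡ (*-identityʳ _)) (solve 2 (λ x a → a :+ (x :- a) := x) refl x a))

  polynomial-+ : ∀ {f g} → Polynomial f → Polynomial g → Polynomial (λ x → f x + g x)
  polynomial-+ {f} (m , f-deg) (n , g-deg) = m ℕ.+ n , degree-+ (m ℕ.+ n)
    (≡.subst (λ k → Degree≤ k f) (ℕ.+-comm n m) (degree-raise n f-deg)) (degree-raise m g-deg)

  polynomial-* : ∀ {f g} → Polynomial f → Polynomial g → Polynomial (λ x → f x * g x)
  polynomial-* (m , f-deg) (n , g-deg) = m ℕ.+ n , degree-* m n f-deg g-deg

  polynomial-resp : ∀ {f g} → (∀ x → f x ≈ g x) → Polynomial f → Polynomial g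
  polynomial-resp f≈g (n , f-deg) = n , degree-resp n f≈g f-deg

  polynomial-neg : ∀ {f} → Polynomial f → Polynomial (λ x → - f x)
  polynomial-neg {f} f-poly = polynomial-resp
    (λ x → solve 1 (λ y → :- con (+ 1) :* y := :- y) refl (f x))
    (polynomial-* (polynomial-const (- ⟦ + 1 ⟧ℤ)) f-poly)

  polynomial-sum : ∀ {n} {f : Fin n → Carrier → Carrier} → (∀ i → Polynomial (f i)) →
    Polynomial (λ x → sum (λ i → f i x))
  polynomial-sum {zero}  f-poly = polynomial-const 0#
  polynomial-sum {suc n} f-poly = polynomial-+ (f-poly zero) (polynomial-sum (f-poly ∘ suc))

  polynomial-product : ∀ {n} {f : Fin n → Carrier → Carrier} → (∀ i → Polynomial (f i)) →
    Polynomial (λ x → product (λ i → f i x))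
  polynomial-product {zero}  f-poly = polynomial-const 1#
  polynomial-product {suc n} f-poly = polynomial-* (f-poly zero) (polynomial-product (f-poly ∘ suc))

  polynomial-det : ∀ {n} {A : Fin n → Fin n → Carrier → Carrier} → (∀ i j → Polynomial (A i j)) →
    Polynomial (λ x → det (λ i j → A i j x))
  polynomial-det {zero}  A-poly = polynomial-const 1#
  polynomial-det {suc n} A-poly = polynomial-sum λ j →
    polynomial-* (polynomial-const ((- 1#) ^ toℕ j))
      (polynomial-* (A-poly zero j) (polynomial-det (λ i k → A-poly (suc i) (punchIn j k))))

module PolynomialRoots {c ℓ p} {R : CommutativeRing c ℓ} (O : ArchimedeanOrder R p) where
  open CommutativeRing R hiding (zero)
  open ArchimedeanOrder O
  open OrderProperties O
  open Polynomials R
  open IntegerSolver R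
  open SemiringMult semiring using (×-homo-+) renaming (_×_ to _⋆_)
  open SetoidReasoning setoid

  -- An infinite sequence of distinct roots spares counting them against the degree: its head is
  -- divided out, and its tail consists of roots of the quotient.
  vanishing : ∀ n {f} → Degree≤ n f → (a : ℕ → Carrier) → (∀ {i j} → i ℕ.< j → ¬ (a j - a i ≈ 0#)) →
    (∀ i → f (a i) ≈ 0#) → ∀ x → f x ≈ 0#
  vanishing zero    f-const a _ roots x = trans (f-const x (a 0)) (roots 0)
  vanishing (suc n) {f} f-deg a distinct roots x with f-deg (a 0)
  ... | q , q-deg , f≈ = begin
    f x                          ≈⟨ f≈ x ⟩
    f (a 0) + (x - a 0) * q x    ≈⟨ +-cong (roots 0) (*-congˡ (vanishing n q-deg (a ∘ suc) (distinct ∘ ℕ.s<s) q-roots x)) ⟩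
    0# + (x - a 0) * 0#          ≈⟨ +-cong refl (zeroʳ _) ⟩
    0# + 0#                      ≈⟨ +-identityʳ 0# ⟩
    0#                           ∎
    where
    q-roots : ∀ i → q (a (suc i)) ≈ 0#
    q-roots i = integral (begin
      (a (suc i) - a 0) * q (a (suc i))              ≈⟨ +-identityˡ _ ⟨
      0# + (a (suc i) - a 0) * q (a (suc i))         ≈⟨ +-congʳ (roots 0) ⟨
      f (a 0) + (a (suc i) - a 0) * q (a (suc i))    ≈⟨ f≈ (a (suc i)) ⟨
      f (a (suc i))                                  ≈⟨ roots (suc i) ⟩
      0#                                             ∎) (distinct (ℕ.s≤s ℕ.z≤n))

  positive-⋆ : ∀ n → Positive (suc n ⋆ 1#)
  positive-⋆ zero    = positive-resp (sym (+-identityʳ 1#)) positive-1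
  positive-⋆ (suc n) = positive-+ positive-1 (positive-⋆ n)

  -- At `x = a` the hypothesis is void. Away from `a` the factor is nonzero, so `f` vanishes at
  -- `a + 1`, `a + 2` and so on, and a polynomial with these roots vanishes at `a` as well.
  cancel-root : ∀ {f} → Polynomial f → ∀ a → (∀ x → (x - a) * f x ≈ 0#) → ∀ x → f x ≈ 0#
  cancel-root {f} (n , f-deg) a af≈0 = vanishing n f-deg point distinct roots
    where
    point : ℕ → Carrier
    point i = a + suc i ⋆ 1#
    roots : ∀ i → f (point i) ≈ 0#
    roots i = integral (af≈0 (point i))
      (positive⇒≉0 (positive-resp (solve 2 (λ a k → k := a :+ k :- a) refl a (suc i ⋆ 1#)) (positive-⋆ i)))
    distinct : ∀ {i j} → i ℕ.< j → ¬ (point j - point i ≈ 0#)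
    distinct {i} {j} i<j with ℕ.m≤n⇒∃[o]m+o≡n i<j
    ... | k , ≡.refl = positive⇒≉0 (positive-resp (begin
      suc k ⋆ 1#                                          ≈⟨ solve 3 (λ a x y → x := a :+ (y :+ x) :- (a :+ y)) refl a (suc k ⋆ 1#) (suc i ⋆ 1#) ⟩
      a + (suc i ⋆ 1# + suc k ⋆ 1#) - (a + suc i ⋆ 1#)    ≈⟨ +-congʳ (+-congˡ (×-homo-+ 1# (suc i) (suc k))) ⟨
      a + (suc i ℕ.+ suc k) ⋆ 1# - (a + suc i ⋆ 1#)       ≡⟨ ≡.cong (λ m → a + m ⋆ 1# - (a + suc i ⋆ 1#)) (ℕ.+-suc (suc i) k) ⟩
      a + (suc (suc i ℕ.+ k)) ⋆ 1# - (a + suc i ⋆ 1#)     ∎) (positive-⋆ k))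

-- Kernel vectors of underdetermined and of singular matrices.

module LinearSystems {c ℓ p} {R : CommutativeRing c ℓ} (O : ArchimedeanOrder R p) where
  open CommutativeRing R hiding (zero)
  open ArchimedeanOrder O
  open OrderProperties O
  open Determinants R
  open RankOne R
  open IntegerSolver R
  open RawSemiringDefinitions (Semiring.rawSemiring semiring) using (_^_)
  open SetoidReasoning setoid

  Nonzero : ∀ {n} → (Fin n → Carrier) → Set ℓ
  Nonzero v = ∃ λ i → ¬ (v i ≈ 0#)

  Kernel : ∀ {m n} → (Fin m → Fin n → Carrier) → (Fin n → Carrier) → Set ℓ
  Kernel A v = ∀ i → (A · v) i ≈ 0#

  1≉0 : ¬ (1# ≈ 0#)
  1≉0 = positive⇒≉0 positive-1

  *-≉0 : ∀ {x y} → ¬ (x ≈ 0#) → ¬ (y ≈ 0#) → ¬ (x * y ≈ 0#)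
  *-≉0 x≉0 y≉0 xy≈0 = y≉0 (integral xy≈0 x≉0)

  ·-insertAt : ∀ {m n} (A : Fin m → Fin (suc n) → Carrier) q x (u : Fin n → Carrier) i →
    (A · insertAt u q x) i ≈ A i q * x + sum (λ j → A i (punchIn q j) * u j)
  ·-insertAt A q x u i = trans (sum-remove {i = q} (λ j → A i j * insertAt u q x j))
    (+-cong (*-congˡ (reflexive (insertAt-lookup u q x)))
            (sum-cong-≋ (λ j → *-congˡ (reflexive (insertAt-punchIn u q x j)))))

  ·-combine : ∀ {m n} (A : Fin m → Fin n → Carrier) α β x y i →
    (A · (λ j → α * x j + β * y j)) i ≈ α * (A · x) i + β * (A · y) i
  ·-combine A α β x y i = begin
    sum (λ j → A i j * (α * x j + β * y j))
      ≈⟨ sum-cong-≋ (λ j → solve 5 (λ a α β x y → a :* (α :* x :+ β :* y) := α :* (a :* x) :+ β :* (a :* y)) refl (A i j) α β (x j) (y j)) ⟩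
    sum (λ j → α * (A i j * x j) + β * (A i j * y j))
      ≈⟨ ∑-distrib-+ (λ j → α * (A i j * x j)) (λ j → β * (A i j * y j)) ⟩
    sum (λ j → α * (A i j * x j)) + sum (λ j → β * (A i j * y j))
      ≈⟨ +-cong (*-distribˡ-sum α (λ j → A i j * x j)) (*-distribˡ-sum β (λ j → A i j * y j)) ⟨
    α * (A · x) i + β * (A · y) i ∎

  -- Fraction-free elimination: with pivot a = A₀q, the other columns are
  -- solved after multiplying the remaining rows by a.
  underdetermined : ∀ {m n} → m ℕ.< n → (A : Fin m → Fin n → Carrier) →
    ¬ ¬ (∃ λ v → Nonzero v × Kernel A v)
  underdetermined {zero}  {suc n} _ A none = none (const 1# , (zero , 1≉0) , λ ())
  underdetermined {suc m} {suc n} (ℕ.s≤s m<n) A none =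
    -- A nonzero entry of the first row would serve as a pivot and produce a solution. So the first
    -- row is zero, and any solution of the other rows satisfies it.
    underdetermined (ℕ.m≤n⇒m≤1+n m<n) (A ∘ suc) λ { (v , v≉0 , Av≈0) →
      none (v , v≉0 , λ { zero    → sum-zero (λ j → trans (*-congʳ (≈0-stable (pivot j))) (zeroˡ (v j)))
                        ; (suc i) → Av≈0 i }) }
    where
    pivot : ∀ q → ¬ ¬ (A zero q ≈ 0#)
    pivot q a≉0 = underdetermined m<n B λ { (u , (i , uᵢ≉0) , Bu≈0) →
      let v = insertAt (λ j → a * u j) q (- r u) in
      none (v ,
        (punchIn q i , λ vᵢ≈0 → *-≉0 a≉0 uᵢ≉0 (trans (reflexive (≡.sym (insertAt-punchIn _ q _ i))) vᵢ≈0)) ,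
        λ { zero    → trans (solution u zero) (solve 2 (λ a r → a :* (:- r) :+ a :* r := con (+ 0)) refl a (r u))
          ; (suc i) → begin
              (A · v) (suc i)
                ≈⟨ solution u (suc i) ⟩
              A (suc i) q * - r u + a * sum (λ j → A (suc i) (punchIn q j) * u j)
                ≈⟨ solve 4 (λ b r a s → b :* (:- r) :+ a :* s := a :* s :+ (:- b) :* r) refl (A (suc i) q) (r u) a _ ⟩
              a * sum (λ j → A (suc i) (punchIn q j) * u j) + - A (suc i) q * r u
                ≈⟨ +-cong (*-distribˡ-sum a (λ j → A (suc i) (punchIn q j) * u j)) (*-distribˡ-sum (- A (suc i) q) (λ j → A zero (punchIn q j) * u j)) ⟩
              sum (λ j → a * (A (suc i) (punchIn q j) * u j)) + sum (λ j → - A (suc i) q * (A zero (punchIn q j) * u j))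
                ≈⟨ ∑-distrib-+ (λ j → a * (A (suc i) (punchIn q j) * u j)) (λ j → - A (suc i) q * (A zero (punchIn q j) * u j)) ⟨
              sum (λ j → a * (A (suc i) (punchIn q j) * u j) + - A (suc i) q * (A zero (punchIn q j) * u j))
                ≈⟨ sum-cong-≋ (λ j → solve 5 (λ a x u b y → a :* (x :* u) :+ (:- b) :* (y :* u) := (a :* x :- b :* y) :* u) refl a (A (suc i) (punchIn q j)) (u j) (A (suc i) q) (A zero (punchIn q j))) ⟩
              (B · u) i
                ≈⟨ Bu≈0 i ⟩
              0# ∎ }) }
      where
      a = A zero q
      B : Fin m → Fin n → Carrier
      B i j = a * A (suc i) (punchIn q j) - A (suc i) q * A zero (punchIn q j)
      r : (Fin n → Carrier) → Carrier
      r u = sum (λ j → A zero (punchIn q j) * u j)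
      solution : ∀ u i → (A · insertAt (λ j → a * u j) q (- r u)) i ≈ A i q * - r u + a * sum (λ j → A i (punchIn q j) * u j)
      solution u i = trans (·-insertAt A q (- r u) (λ j → a * u j) i) (+-congˡ (begin
        sum (λ j → A i (punchIn q j) * (a * u j))
          ≈⟨ sum-cong-≋ (λ j → solve 3 (λ x a u → x :* (a :* u) := a :* (x :* u)) refl (A i (punchIn q j)) a (u j)) ⟩
        sum (λ j → a * (A i (punchIn q j) * u j))
          ≈⟨ *-distribˡ-sum a (λ j → A i (punchIn q j) * u j) ⟨
        a * sum (λ j → A i (punchIn q j) * u j) ∎))

  sign-cancel : ∀ k {x} → (- 1#) ^ k * x ≈ 0# → x ≈ 0#
  sign-cancel zero    eq = trans (sym (*-identityˡ _)) eq
  sign-cancel (suc k) {x} eq = sign-cancel k (begin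
    y                  ≈⟨ *-identityˡ y ⟨
    1# * y             ≈⟨ solve 3 (λ o s x → o :* (s :* x) := :- ((:- o) :* s :* x)) refl 1# ((- 1#) ^ k) x ⟩
    - (- 1# * (- 1#) ^ k * x)   ≈⟨ -‿cong eq ⟩
    - 0#               ≈⟨ solve 0 (:- con (+ 0) := con (+ 0)) refl ⟩
    0#                 ∎)
    where y = (- 1#) ^ k * x

  -- Solve all equations but the first; if the first fails, Cramer's rule makes
  -- the minor at a nonzero coordinate singular, and its kernel supplies a second
  -- solution to combine with.
  singular⇒kernel : ∀ {n} (A : Matrix Carrier n) → det A ≈ 0# → ¬ ¬ (∃ λ v → Nonzero v × Kernel A v)
  singular⇒kernel {zero}  A det≈0 _ = 1≉0 det≈0
  singular⇒kernel {suc n} A det≈0 none = underdetermined (ℕ.n<1+n n) (A ∘ suc) λ { (v , (q , v_q≉0) , Av≈0) →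
    let
      α = (A · v) zero
      α≉0 : ¬ (α ≈ 0#)
      α≉0 α≈0 = none (v , (q , v_q≉0) , λ { zero → α≈0 ; (suc i) → Av≈0 i })
      -- Column `q` of `B` has `α` on top and zeros below, so the expansion of `det B` along the
      -- first row reduces to its term at `q`.
      B = A [ q ]≔ (A · v)
      others : ∀ j → j ≢ q → cofactorTerm B j ≈ 0#
      others j j≢q = trans (*-congˡ (*-congˡ (det-zero-column (punchOut j≢q) {minor B j} (λ i →
        trans (reflexive (≡.cong (B (suc i)) (Fin.punchIn-punchOut j≢q)))
        (trans (reflexive ([]≔-at A q (A · v) (suc i))) (Av≈0 i))))))
        (trans (*-congˡ (zeroʳ _)) (zeroʳ _))
      expansion : (- 1#) ^ toℕ q * (α * det (minor A q)) ≈ 0#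
      expansion = begin
        (- 1#) ^ toℕ q * (α * det (minor A q))
          ≈⟨ *-congˡ (*-cong (reflexive (≡.sym ([]≔-at A q (A · v) zero)))
               (det-cong (λ i k → reflexive (≡.sym ([]≔-off A (A · v) (suc i) (Fin.punchInᵢ≢i q k)))))) ⟩
        cofactorTerm B q       ≈⟨ sum-single (cofactorTerm B) q others ⟨
        det B                  ≈⟨ cramer A v q ⟩
        v q * det A            ≈⟨ *-congˡ det≈0 ⟩
        v q * 0#               ≈⟨ zeroʳ _ ⟩
        0#                     ∎
    in singular⇒kernel (minor A q) (integral (sign-cancel (toℕ q) expansion) α≉0) λ { (u , (i , uᵢ≉0) , Mu≈0) →
      let
        u⁺ = insertAt u q 0#
        β = (A · u⁺) zero
        z = λ j → α * u⁺ j + (- β) * v j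
        Au⁺≈0 : ∀ i → (A · u⁺) (suc i) ≈ 0#
        Au⁺≈0 i = trans (·-insertAt A q 0# u (suc i)) (trans (+-cong (zeroʳ _) (Mu≈0 i)) (+-identityʳ 0#))
        Az≈0 : Kernel A z
        Az≈0 = λ
          { zero    → trans (·-combine A α (- β) u⁺ v zero) (solve 2 (λ α β → α :* β :+ (:- β) :* α := con (+ 0)) refl α β)
          ; (suc i) → trans (·-combine A α (- β) u⁺ v (suc i))
              (trans (+-cong (*-congˡ (Au⁺≈0 i)) (*-congˡ (Av≈0 i))) (solve 2 (λ α β → α :* con (+ 0) :+ (:- β) :* con (+ 0) := con (+ 0)) refl α β)) }
        z_q : z q ≈ - (β * v q)
        z_q = trans (+-congʳ (*-congˡ (reflexive (insertAt-lookup u q 0#)))) (solve 3 (λ α β x → α :* con (+ 0) :+ (:- β) :* x := :- (β :* x)) refl α β (v q))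
        -- Since `u⁺` vanishes at `q`, a nonzero `β` would make the combination `z` nonzero there,
        -- and `z` is in the kernel. With `β` zero, `u⁺` itself is in the kernel.
        β≈0 : β ≈ 0#
        β≈0 = ≈0-stable λ β≉0 → none (z , (q , λ z_q≈0 → *-≉0 β≉0 v_q≉0
          (trans (solve 1 (λ x → x := :- (:- x)) refl _) (trans (-‿cong (trans (sym z_q) z_q≈0)) (solve 0 (:- con (+ 0) := con (+ 0)) refl)))) , Az≈0)
      in none (u⁺ , (punchIn q i , λ eq → uᵢ≉0 (trans (reflexive (≡.sym (insertAt-punchIn u q 0# i))) eq)) ,
               λ { zero → β≈0 ; (suc i) → Au⁺≈0 i }) } }

-- Deflation of eigenvalues and the inertia bound.

module Inertia {c ℓ p} {R : CommutativeRing c ℓ} (O : ArchimedeanOrder R p) where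
  open CommutativeRing R hiding (zero)
  open ArchimedeanOrder O
  open OrderProperties O
  open Determinants R
  open RankOne R
  open Polynomials R
  open PolynomialRoots O
  open LinearSystems O
  open IntegerSolver R
  open SetoidReasoning setoid

  ∙ᵥ-comm : ∀ {n} (x y : Fin n → Carrier) → x ∙ᵥ y ≈ y ∙ᵥ x
  ∙ᵥ-comm x y = sum-cong-≋ (λ i → *-comm (x i) (y i))

  ∙ᵥ-cong : ∀ {n} {x x′ y y′ : Fin n → Carrier} → (∀ i → x i ≈ x′ i) → (∀ i → y i ≈ y′ i) → x ∙ᵥ y ≈ x′ ∙ᵥ y′
  ∙ᵥ-cong x≈x′ y≈y′ = sum-cong-≋ (λ i → *-cong (x≈x′ i) (y≈y′ i))

  ∙ᵥ-linearʳ : ∀ {n} α (z x y : Fin n → Carrier) → z ∙ᵥ (λ i → α * x i + y i) ≈ α * (z ∙ᵥ x) + z ∙ᵥ y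
  ∙ᵥ-linearʳ α z x y = begin
    sum (λ i → z i * (α * x i + y i))
      ≈⟨ sum-cong-≋ (λ i → solve 4 (λ z α x y → z :* (α :* x :+ y) := α :* (z :* x) :+ z :* y) refl (z i) α (x i) (y i)) ⟩
    sum (λ i → α * (z i * x i) + z i * y i)
      ≈⟨ ∑-distrib-+ (λ i → α * (z i * x i)) (λ i → z i * y i) ⟩
    sum (λ i → α * (z i * x i)) + z ∙ᵥ y
      ≈⟨ +-congʳ (*-distribˡ-sum α (λ i → z i * x i)) ⟨
    α * (z ∙ᵥ x) + z ∙ᵥ y ∎

  ∙ᵥ-linearˡ : ∀ {n} α (x y z : Fin n → Carrier) → (λ i → α * x i + y i) ∙ᵥ z ≈ α * (x ∙ᵥ z) + y ∙ᵥ z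
  ∙ᵥ-linearˡ α x y z = trans (∙ᵥ-comm (λ i → α * x i + y i) z)
    (trans (∙ᵥ-linearʳ α z x y) (+-cong (*-congˡ (∙ᵥ-comm z x)) (∙ᵥ-comm z y)))

  Symmetric : ∀ {n} → Matrix Carrier n → Set ℓ
  Symmetric A = ∀ i j → A i j ≈ A j i

  self-adjoint : ∀ {n} {A : Matrix Carrier n} → Symmetric A → ∀ x y → x ∙ᵥ (A · y) ≈ y ∙ᵥ (A · x)
  self-adjoint {A = A} A-sym x y = begin
    sum (λ i → x i * sum (λ j → A i j * y j))
      ≈⟨ sum-cong-≋ (λ i → *-distribˡ-sum (x i) (λ j → A i j * y j)) ⟩
    sum (λ i → sum (λ j → x i * (A i j * y j)))
      ≈⟨ ∑-comm (λ i j → x i * (A i j * y j)) ⟩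
    sum (λ j → sum (λ i → x i * (A i j * y j)))
      ≈⟨ sum-cong-≋ (λ j → sum-cong-≋ (λ i → trans (*-congˡ (*-congʳ (A-sym i j)))
           (solve 3 (λ x a y → x :* (a :* y) := y :* (a :* x)) refl (x i) (A j i) (y j)))) ⟩
    sum (λ j → sum (λ i → y j * (A j i * x i)))
      ≈⟨ sum-cong-≋ (λ j → *-distribˡ-sum (y j) (λ i → A j i * x i)) ⟨
    sum (λ j → y j * sum (λ i → A j i * x i)) ∎

  form : ∀ {n} → Matrix Carrier n → (Fin n → Carrier) → Carrier
  form A x = x ∙ᵥ (A · x)

  -- Spelled out entry by entry as in `charPoly`, so that over ℝ the eigenvalue hypothesis applies
  -- as it stands.
  characteristic : ∀ {n} → Matrix Carrier n → Carrier → Matrix Carrier n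
  characteristic L y i j = (if does (i Fin.≟ j) then y else 0#) - L i j

  characteristic-· : ∀ {n} (L : Matrix Carrier n) y z v i →
    (characteristic L y · v) i ≈ (characteristic L z · v) i + (y - z) * v i
  characteristic-· L y z v i = begin
    sum (λ j → characteristic L y i j * v j)
      ≈⟨ sum-cong-≋ split ⟩
    sum (λ j → characteristic L z i j * v j + δ j)
      ≈⟨ ∑-distrib-+ (λ j → characteristic L z i j * v j) δ ⟩
    (characteristic L z · v) i + sum δ
      ≈⟨ +-congˡ (trans (sum-single δ i off) at) ⟩
    (characteristic L z · v) i + (y - z) * v i ∎
    where
    δ : Fin _ → Carrier
    δ j = (if does (i Fin.≟ j) then y - z else 0#) * v j
    split : ∀ j → characteristic L y i j * v j ≈ characteristic L z i j * v j + δ j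
    split j with does (i Fin.≟ j)
    ... | true  = solve 4 (λ y l z v → (y :- l) :* v := (z :- l) :* v :+ (y :- z) :* v) refl y (L i j) z (v j)
    ... | false = solve 2 (λ l v → (con (+ 0) :- l) :* v := (con (+ 0) :- l) :* v :+ con (+ 0) :* v) refl (L i j) (v j)
    off : ∀ j → j ≢ i → δ j ≈ 0#
    off j j≢i rewrite dec-false (i Fin.≟ j) (j≢i ∘ ≡.sym) = zeroˡ (v j)
    at : δ i ≈ (y - z) * v i
    at rewrite dec-true (i Fin.≟ i) ≡.refl = refl

  characteristic-symmetric : ∀ {n} {L : Matrix Carrier n} → Symmetric L → ∀ y → Symmetric (characteristic L y)
  characteristic-symmetric L-sym y i j with i Fin.≟ j | j Fin.≟ i
  ... | yes _      | yes _  = +-congˡ (-‿cong (L-sym i j))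
  ... | no  _      | no  _  = +-congˡ (-‿cong (L-sym i j))
  ... | yes i≡j    | no j≢i = contradiction (≡.sym i≡j) j≢i
  ... | no  i≢j    | yes j≡i = contradiction (≡.sym j≡i) i≢j

  characteristic-polynomial : ∀ {n} (L : Matrix Carrier n) → Polynomial (λ y → det (characteristic L y))
  characteristic-polynomial L = polynomial-det entry
    where
    entry : ∀ i j → Polynomial (λ y → characteristic L y i j)
    entry i j with does (i Fin.≟ j)
    ... | true  = polynomial-+ polynomial-id (polynomial-const (- L i j))
    ... | false = polynomial-const (0# - L i j)

  -- Positive definiteness on the column space of W, in contrapositive form;
  -- it includes the independence of the columns.
  DefiniteOn : ∀ {n d} → Matrix Carrier n → (Fin n → Fin d → Carrier) → Set (c ⊔ ℓ ⊔ p)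
  DefiniteOn A W = ∀ a → ¬ Positive (form A (W · a)) → ∀ k → a k ≈ 0#

  prependColumn : ∀ {n d} → (Fin n → Carrier) → (Fin n → Fin d → Carrier) → Fin n → Fin (suc d) → Carrier
  prependColumn v W i zero    = v i
  prependColumn v W i (suc k) = W i k

  module Deflation {n} (L : Matrix Carrier n) (L-sym : Symmetric L) (μ : Carrier)
    (v : Fin n → Carrier) (Lv≈μv : Kernel (characteristic L μ) v) (s : Carrier) where

    N = v ∙ᵥ v

    -- The eigenvector is not normalised, as that would take a square root and an inverse. Its
    -- eigenvalue therefore drops from `μ` to `μ - s * N`, while vectors orthogonal to `v` have the
    -- same image as under `L`.
    deflated : Matrix Carrier n
    deflated i j = L i j - s * (v i * v j)

    deflated-symmetric : Symmetric deflated
    deflated-symmetric i j = +-cong (L-sym i j) (-‿cong (*-congˡ (*-comm (v i) (v j))))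

    deflated-characteristic : ∀ y i j → characteristic deflated y i j ≈ characteristic L y i j + s * (v i * v j)
    deflated-characteristic y i j =
      solve 3 (λ d l t → d :- (l :- t) := d :- l :+ t) refl _ (L i j) (s * (v i * v j))

    eigenvector : ∀ y i → (characteristic L y · v) i ≈ (y - μ) * v i
    eigenvector y i = trans (characteristic-· L y μ v i) (trans (+-congʳ (Lv≈μv i)) (+-identityˡ _))

    -- This is `det-rankOne` at `y - μ`, with the spare factor `v q` cancelled at a coordinate where
    -- `v` is nonzero.
    deflated-det : Nonzero v → ∀ y →
      (y - μ) * det (characteristic deflated y) ≈ (y - μ + s * N) * det (characteristic L y)
    deflated-det (q , v_q≉0) y = begin
      D′              ≈⟨ solve 2 (λ a b → a := (a :- b) :+ b) refl D′ D ⟩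
      (D′ - D) + D    ≈⟨ +-congʳ (integral difference v_q≉0) ⟩
      0# + D          ≈⟨ +-identityˡ D ⟩
      D               ∎
      where
      D′ = (y - μ) * det (characteristic deflated y)
      D  = (y - μ + s * N) * det (characteristic L y)
      difference : v q * (D′ - D) ≈ 0#
      difference = begin
        v q * (D′ - D)           ≈⟨ solve 3 (λ x a b → x :* (a :- b) := x :* a :- x :* b) refl (v q) D′ D ⟩
        v q * D′ - v q * D       ≈⟨ +-congʳ (det-rankOne (characteristic L y) (characteristic deflated y) v (y - μ) s (eigenvector y) (deflated-characteristic y) q) ⟩
        v q * D - v q * D        ≈⟨ -‿inverseʳ _ ⟩
        0#                       ∎

    -- The factor `y - μ` cannot be cancelled pointwise at `y = μ`, so `cancel-root` is applied to
    -- the difference of the two polynomials. Exactly one root moves: further copies of `μ` stay in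
    -- `g` and `h`, which is how multiplicities are respected.
    deflated-factors : Nonzero v → ∀ {g h} → Polynomial g → Polynomial h →
      (∀ y → det (characteristic L y) ≈ g y * ((y - μ) * h y)) →
      ∀ y → det (characteristic deflated y) ≈ g y * (y - μ + s * N) * h y
    deflated-factors v≉0 {g} {h} g-poly h-poly factors y = begin
      det (characteristic deflated y)   ≈⟨ solve 2 (λ a b → a := (a :- b) :+ b) refl _ (f y) ⟩
      F y + f y                         ≈⟨ +-congʳ (cancel-root F-poly μ root y) ⟩
      0# + f y                          ≈⟨ +-identityˡ _ ⟩
      f y                               ∎
      where
      f F : Carrier → Carrier
      f y = g y * (y - μ + s * N) * h y
      F y = det (characteristic deflated y) - f y
      F-poly : Polynomial F
      F-poly = polynomial-+ (characteristic-polynomial deflated) (polynomial-neg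
        (polynomial-* (polynomial-* g-poly
          (polynomial-+ (polynomial-+ polynomial-id (polynomial-const (- μ))) (polynomial-const (s * N)))) h-poly))
      root : ∀ y → (y - μ) * F y ≈ 0#
      root y = begin
        (y - μ) * (det (characteristic deflated y) - f y)
          ≈⟨ solve 3 (λ x a b → x :* (a :- b) := x :* a :- x :* b) refl (y - μ) _ (f y) ⟩
        (y - μ) * det (characteristic deflated y) - (y - μ) * f y
          ≈⟨ +-congʳ (trans (deflated-det v≉0 y) (*-congˡ (factors y))) ⟩
        (y - μ + s * N) * (g y * ((y - μ) * h y)) - (y - μ) * (g y * (y - μ + s * N) * h y)
          ≈⟨ solve 4 (λ κ τ g h → τ :* (g :* (κ :* h)) :- κ :* (g :* τ :* h) := con (+ 0)) refl (y - μ) (y - μ + s * N) (g y) (h y) ⟩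
        0# ∎

    module _ (c₀ : Carrier) where
      K  = characteristic L c₀
      K′ = characteristic deflated c₀
      δ  = μ - c₀

      -- Completing the square in a; multiplying by N avoids dividing by it.
      deflated-form : ∀ a w → let r = v ∙ᵥ w in
        N * form K′ (λ i → a * v i + w i) ≈
        N * form K w + (δ * (r * r) + (s * N - δ) * ((r + a * N) * (r + a * N)))
      deflated-form a w = begin
        N * form K′ x
          ≈⟨ *-congˡ form-K′ ⟩
        N * (form K x + s * ((a * N + r) * (a * N + r)))
          ≈⟨ *-congˡ (+-congʳ form-K) ⟩
        N * (a * ((c₀ - μ) * (a * N + r)) + (a * ((c₀ - μ) * r) + form K w) + s * ((a * N + r) * (a * N + r)))
          ≈⟨ solve 7 (λ N a c μ r Q s →
               N :* (a :* ((c :- μ) :* (a :* N :+ r)) :+ (a :* ((c :- μ) :* r) :+ Q) :+ s :* ((a :* N :+ r) :* (a :* N :+ r)))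
               := N :* Q :+ ((μ :- c) :* (r :* r) :+ (s :* N :- (μ :- c)) :* ((r :+ a :* N) :* (r :+ a :* N)))) refl
               N a c₀ μ r (form K w) s ⟩
        N * form K w + (δ * (r * r) + (s * N - δ) * ((r + a * N) * (r + a * N))) ∎
        where
        r = v ∙ᵥ w
        x : Fin n → Carrier
        x i = a * v i + w i
        v∙x : v ∙ᵥ x ≈ a * N + r
        v∙x = ∙ᵥ-linearʳ a v v w
        form-K′ : form K′ x ≈ form K x + s * ((a * N + r) * (a * N + r))
        form-K′ = begin
          x ∙ᵥ (K′ · x)
            ≈⟨ ∙ᵥ-cong (λ _ → refl) (λ i → trans (·-rankOne K K′ v s (deflated-characteristic c₀) x i)
                 (solve 4 (λ k s v t → k :+ s :* (v :* t) := s :* t :* v :+ k) refl ((K · x) i) s (v i) (v ∙ᵥ x))) ⟩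
          x ∙ᵥ (λ i → s * (v ∙ᵥ x) * v i + (K · x) i)
            ≈⟨ ∙ᵥ-linearʳ (s * (v ∙ᵥ x)) x v (K · x) ⟩
          s * (v ∙ᵥ x) * (x ∙ᵥ v) + form K x
            ≈⟨ +-congʳ (*-cong (*-congˡ v∙x) (trans (∙ᵥ-comm x v) v∙x)) ⟩
          s * (a * N + r) * (a * N + r) + form K x
            ≈⟨ solve 3 (λ s t k → s :* t :* t :+ k := k :+ s :* (t :* t)) refl s (a * N + r) (form K x) ⟩
          form K x + s * ((a * N + r) * (a * N + r)) ∎
        v∙K : ∀ y → v ∙ᵥ (K · y) ≈ (c₀ - μ) * (v ∙ᵥ y)
        v∙K y = begin
          v ∙ᵥ (K · y)                     ≈⟨ self-adjoint (characteristic-symmetric L-sym c₀) v y ⟩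
          y ∙ᵥ (K · v)                     ≈⟨ ∙ᵥ-cong (λ _ → refl) (λ i → trans (eigenvector c₀ i) (sym (+-identityʳ _))) ⟩
          y ∙ᵥ (λ i → (c₀ - μ) * v i + 0#) ≈⟨ ∙ᵥ-linearʳ (c₀ - μ) y v (const 0#) ⟩
          (c₀ - μ) * (y ∙ᵥ v) + y ∙ᵥ const 0#  ≈⟨ +-cong (*-congˡ (∙ᵥ-comm y v)) (sum-zero (λ i → zeroʳ (y i))) ⟩
          (c₀ - μ) * (v ∙ᵥ y) + 0#         ≈⟨ +-identityʳ _ ⟩
          (c₀ - μ) * (v ∙ᵥ y)              ∎
        form-K : form K x ≈ a * ((c₀ - μ) * (a * N + r)) + (a * ((c₀ - μ) * r) + form K w)
        form-K = begin
          x ∙ᵥ (K · x)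
            ≈⟨ ∙ᵥ-linearˡ a v w (K · x) ⟩
          a * (v ∙ᵥ (K · x)) + w ∙ᵥ (K · x)
            ≈⟨ +-cong (*-congˡ (trans (v∙K x) (*-congˡ v∙x)))
                      (trans (self-adjoint (characteristic-symmetric L-sym c₀) w x)
                      (trans (∙ᵥ-linearˡ a v w (K · w)) (+-congʳ (*-congˡ (v∙K w))))) ⟩
          a * ((c₀ - μ) * (a * N + r)) + (a * ((c₀ - μ) * r) + form K w) ∎

      -- By `deflated-form`, `N` times the new form is `N` times the old form at the `W`-part `w`,
      -- plus two non-negative terms. If the new form is not positive, neither is the old one at
      -- `w`, so the coefficients of `W` vanish. Then `w` and `r` are zero, and the last square
      -- forces the coefficient of `v` to vanish. The independence of `v` from `W` is thus part of
      -- the outcome.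
      deflated-definite : Positive N → Positive (s * N - δ) → ¬ Positive (c₀ - μ) →
        ∀ {d} (W : Fin n → Fin d → Carrier) → DefiniteOn K W → DefiniteOn K′ (prependColumn v W)
      deflated-definite N>0 sN>δ ¬c>μ W definite a ¬Q′>0 = λ { zero → a₀≈0 ; (suc k) → tail≈0 k }
        where
        w = W · (a ∘ suc)
        r = v ∙ᵥ w
        rest = δ * (r * r) + (s * N - δ) * ((r + a zero * N) * (r + a zero * N))
        δ≥0 : Nonneg δ
        δ≥0 = ¬c>μ ∘ positive-resp (solve 2 (λ m c → :- (m :- c) := c :- m) refl μ c₀)
        first≥0 : Nonneg (δ * (r * r))
        first≥0 = nonneg-* δ≥0 (square-nonneg r)
        second≥0 : Nonneg ((s * N - δ) * ((r + a zero * N) * (r + a zero * N)))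
        second≥0 = nonneg-* (positive⇒nonneg sN>δ) (square-nonneg _)
        rest≥0 : Nonneg rest
        rest≥0 = nonneg-+ first≥0 second≥0
        form-split : N * form K′ (prependColumn v W · a) ≈ N * form K w + rest
        form-split = trans (*-congˡ (∙ᵥ-cong shuffle (λ i → sum-cong-≋ (λ j → *-congˡ (shuffle j))))) (deflated-form (a zero) w)
          where
          shuffle : ∀ i → (prependColumn v W · a) i ≈ a zero * v i + w i
          shuffle i = +-congʳ (*-comm (v i) (a zero))
        ¬total>0 : ¬ Positive (N * form K w + rest)
        ¬total>0 total>0 = compare (form K′ (prependColumn v W · a)) ¬Q′>0
          (λ Q′≈0 → positive⇒≉0 NQ′>0 (trans (*-congˡ Q′≈0) (zeroʳ N)))
          (λ Q′<0 → positive-asym NQ′>0 (positive-resp (solve 2 (λ x y → x :* (:- y) := :- (x :* y)) refl N _) (positive-* N>0 Q′<0)))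
          where NQ′>0 = positive-resp (sym form-split) total>0
        tail≈0 : ∀ k → a (suc k) ≈ 0#
        tail≈0 = definite (a ∘ suc) λ Q>0 → positive-+-nonneg (positive-* N>0 Q>0) rest≥0 ¬total>0
        w≈0 : ∀ i → w i ≈ 0#
        w≈0 i = sum-zero (λ k → trans (*-congˡ (tail≈0 k)) (zeroʳ (W i k)))
        r≈0 : r ≈ 0#
        r≈0 = sum-zero (λ i → trans (*-congˡ (w≈0 i)) (zeroʳ (v i)))
        Q≈0 : form K w ≈ 0#
        Q≈0 = sum-zero (λ i → trans (*-congʳ (w≈0 i)) (zeroˡ ((K · w) i)))
        rest≈0 : rest ≈ 0#
        rest≈0 = proj₂ (+-nonpositive (≈0⇒nonneg (trans (*-congˡ Q≈0) (zeroʳ N))) rest≥0 ¬total>0)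
        second≈0 : (s * N - δ) * ((r + a zero * N) * (r + a zero * N)) ≈ 0#
        second≈0 = proj₂ (+-nonpositive first≥0 second≥0 (λ rest>0 → positive⇒≉0 rest>0 rest≈0))
        a₀≈0 : a zero ≈ 0#
        a₀≈0 = integral (begin
          N * a zero         ≈⟨ *-comm _ _ ⟩
          a zero * N         ≈⟨ +-identityˡ _ ⟨
          0# + a zero * N    ≈⟨ +-congʳ r≈0 ⟨
          r + a zero * N     ≈⟨ square≈0 (integral second≈0 (positive⇒≉0 sN>δ)) ⟩
          0#                 ∎) (positive⇒≉0 N>0)

  nonzero⇒norm-positive : ∀ {n} {v : Fin n → Carrier} → Nonzero v → ¬ ¬ Positive (v ∙ᵥ v)
  nonzero⇒norm-positive {v = v} (q , v_q≉0) ¬N>0 =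
    v_q≉0 (square≈0 (sum-nonpositive (λ i → square-nonneg (v i)) ¬N>0 q))

  -- Each eigenvalue μ ≥ c₀ is moved below c₀ by subtracting a multiple of v vᵀ,
  -- which adds its eigenvector v to the subspace where c₀ − L is positive definite.
  inertia : ∀ {n} c₀ m d (L : Matrix Carrier n) → Symmetric L →
    ∀ {g} → Polynomial g → (μ : Fin m → Carrier) → (∀ k → ¬ Positive (c₀ - μ k)) →
    (∀ y → det (characteristic L y) ≈ g y * product (λ k → y - μ k)) →
    (W : Fin n → Fin d → Carrier) → DefiniteOn (characteristic L c₀) W → ¬ (n ℕ.< m ℕ.+ d)
  inertia c₀ zero d L L-sym g-poly μ μ≥c₀ factors W definite n<d =
    underdetermined n<d W λ { (a , (k , aₖ≉0) , Wa≈0) →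
      aₖ≉0 (definite a (λ Q>0 → positive⇒≉0 Q>0
        (sum-zero (λ i → trans (*-congʳ (Wa≈0 i)) (zeroˡ ((characteristic L c₀ · (W · a)) i))))) k) }
  inertia {n} c₀ (suc m) d L L-sym {g} g-poly μ μ≥c₀ factors W definite n<m+d =
    singular⇒kernel (characteristic L μ₀) singular λ { (v , v≉0 , Lv≈μv) →
    nonzero⇒norm-positive v≉0 λ N>0 →
    let s , sN>δ = archimedean N>0 (μ₀ - c₀)
        open Deflation L L-sym μ₀ v Lv≈μv s
    in inertia c₀ m (suc d) deflated deflated-symmetric
         -- The moved root is absorbed into the arbitrary polynomial `g`; only the roots still to be
         -- moved have to be listed.
         (polynomial-* g-poly (polynomial-+ (polynomial-+ polynomial-id (polynomial-const (- μ₀))) (polynomial-const (s * N))))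
         (μ ∘ suc) (μ≥c₀ ∘ suc)
         (deflated-factors v≉0 g-poly
           (polynomial-product (λ k → polynomial-+ polynomial-id (polynomial-const (- μ (suc k))))) factors)
         (prependColumn v W) (deflated-definite c₀ N>0 sN>δ (μ≥c₀ zero) W definite)
         -- Each round trades one eigenvalue for one dimension of `W`, so the total `m + d` is
         -- preserved.
         (≡.subst (n ℕ.<_) (≡.sym (ℕ.+-suc m d)) n<m+d) }
    where
    μ₀ = μ zero
    singular : det (characteristic L μ₀) ≈ 0#
    singular = trans (factors μ₀)
      (solve 3 (λ g m h → g :* ((m :- m) :* h) := con (+ 0)) refl (g μ₀) μ₀ (product (λ k → μ₀ - μ (suc k))))

-- The Cauchy reals as an Archimedean ordered ring.

open CauchyClosure

-- `x ≃ y` unfolds to `Null` of the difference of the two sequences, so the congruence laws become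
-- closure properties of null sequences.
Null : (ℕ → ℚ) → Set
Null s = ∀ ε → 0ℚ ℚ.< ε → ∃ λ N → ∀ n → N ℕ.≤ n → ℚ.∣ s n ∣ ℚ.< ε

null-resp : ∀ {s t} → (∀ n → s n ≡ t n) → Null s → Null t
null-resp s≡t s-null ε 0<ε with s-null ε 0<ε
... | N , small = N , λ n N≤n → ≡.subst (λ z → ℚ.∣ z ∣ ℚ.< ε) (s≡t n) (small n N≤n)

null-0 : Null (λ _ → 0ℚ)
null-0 ε 0<ε = 0 , λ _ _ → 0<ε

null-neg : ∀ {s} → Null s → Null (λ n → ℚ.- s n)
null-neg {s} s-null ε 0<ε with s-null ε 0<ε
... | N , small = N , λ n N≤n → ≡.subst (ℚ._< ε) (≡.sym (ℚ.∣-p∣≡∣p∣ (s n))) (small n N≤n)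

null-+ : ∀ {s t} → Null s → Null t → Null (λ n → s n ℚ.+ t n)
null-+ {s} {t} s-null t-null ε 0<ε with s-null (½ ℚ.* ε) (half-pos 0<ε) | t-null (½ ℚ.* ε) (half-pos 0<ε)
... | M , s-small | N , t-small = M ℕ.⊔ N , λ n K≤n → begin-strict
  ℚ.∣ s n ℚ.+ t n ∣             ≤⟨ ℚ.∣p+q∣≤∣p∣+∣q∣ (s n) (t n) ⟩
  ℚ.∣ s n ∣ ℚ.+ ℚ.∣ t n ∣       <⟨ ℚ.+-mono-< (s-small n (ℕ.m⊔n≤o⇒m≤o M N K≤n)) (t-small n (ℕ.m⊔n≤o⇒n≤o M N K≤n)) ⟩
  ½ ℚ.* ε ℚ.+ ½ ℚ.* ε           ≡⟨ half+half ε ⟩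
  ε                             ∎
  where open ℚ.≤-Reasoning

null-* : ∀ {s t} → IsCauchy s → Null t → Null (λ n → s n ℚ.* t n)
null-* {s} {t} s-cauchy t-null ε 0<ε with eventuallyBounded s s-cauchy
... | B , M , 0<B , bound with scale 0<B 0<ε
...   | δ , 0<δ , Bδ≡ε with t-null δ 0<δ
...     | N , small = M ℕ.⊔ N , λ n K≤n → begin-strict
  ℚ.∣ s n ℚ.* t n ∣             ≡⟨ ℚ.∣p*q∣≡∣p∣*∣q∣ (s n) (t n) ⟩
  ℚ.∣ s n ∣ ℚ.* ℚ.∣ t n ∣       ≤⟨ ℚ.*-monoʳ-≤-nonNeg ℚ.∣ t n ∣ ⦃ ℚ.∣-∣-nonNeg (t n) ⦄ (bound n (ℕ.m⊔n≤o⇒m≤o M N K≤n)) ⟩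
  B ℚ.* ℚ.∣ t n ∣               <⟨ ℚ.*-monoʳ-<-pos B ⦃ ℚ.positive 0<B ⦄ (small n (ℕ.m⊔n≤o⇒n≤o M N K≤n)) ⟩
  B ℚ.* δ                       ≡⟨ Bδ≡ε ⟩
  ε                             ∎
  where open ℚ.≤-Reasoning

pointwise : ∀ {x y} → (∀ n → seq x n ≡ seq y n) → x ≃ y
pointwise {x} {y} x≡y = null-resp
  (λ n → ≡.sym (≡.trans (≡.cong (ℚ._- seq y n) (x≡y n)) (ℚ.+-inverseʳ (seq y n)))) null-0

≃-sym : ∀ {x y} → x ≃ y → y ≃ x
≃-sym {x} {y} x≃y = null-resp
  (λ n → GroupProperties.⁻¹-anti-homo-// ℚ.+-0-group (seq x n) (seq y n))
  (null-neg x≃y)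

≃-trans : ∀ {x y z} → x ≃ y → y ≃ z → x ≃ z
≃-trans {x} {y} {z} x≃y y≃z = null-resp (λ n → telescope (seq x n) (seq y n) (seq z n)) (null-+ x≃y y≃z)

+ᴿ-cong : ∀ {x x′ y y′} → x ≃ x′ → y ≃ y′ → x +ᴿ y ≃ x′ +ᴿ y′
+ᴿ-cong {x} {x′} {y} {y′} x≃x′ y≃y′ = null-resp
  (λ n → ≡.sym (+-rearrange (seq x n) (seq y n) (seq x′ n) (seq y′ n))) (null-+ x≃x′ y≃y′)

*ᴿ-cong : ∀ {x x′ y y′} → x ≃ x′ → y ≃ y′ → x *ᴿ y ≃ x′ *ᴿ y′
*ᴿ-cong {x} {x′} {y} {y′} x≃x′ y≃y′ = null-resp
  (λ n → ≡.sym (*-rearrange (seq x n) (seq y n) (seq x′ n) (seq y′ n)))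
  (null-+ {λ n → seq x n ℚ.* (seq y n ℚ.- seq y′ n)} {λ n → seq y′ n ℚ.* (seq x n ℚ.- seq x′ n)}
    (null-* {seq x} (cauchy x) y≃y′) (null-* {seq y′} (cauchy y′) x≃x′))

-ᴿ-cong : ∀ {x y} → x ≃ y → -ᴿ x ≃ -ᴿ y
-ᴿ-cong {x} {y} x≃y = null-resp (λ n → ≡.sym (neg-rearrange (seq x n) (seq y n))) (null-neg x≃y)

ℝ-commutativeRing : CommutativeRing 0ℓ 0ℓ
ℝ-commutativeRing = record
  { Carrier = ℝ ; _≈_ = _≃_ ; _+_ = _+ᴿ_ ; _*_ = _*ᴿ_ ; -_ = -ᴿ_ ; 0# = fromℕ 0 ; 1# = fromℕ 1
  ; isCommutativeRing = record
    { isRing = record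
      { +-isAbelianGroup = record
        { isGroup = record
          { isMonoid = record
            { isSemigroup = record
              { isMagma = record
                { isEquivalence = record
                  { refl = λ {x} → pointwise {x} {x} (λ _ → ≡.refl)
                  ; sym = λ {x} {y} → ≃-sym {x} {y}
                  ; trans = λ {x} {y} {z} → ≃-trans {x} {y} {z} }
                ; ∙-cong = λ {x} {x′} {y} {y′} → +ᴿ-cong {x} {x′} {y} {y′} }
              ; assoc = λ x y z → pointwise {(x +ᴿ y) +ᴿ z} {x +ᴿ (y +ᴿ z)} (λ n → ℚ.+-assoc (seq x n) (seq y n) (seq z n)) }
            ; identity = (λ x → pointwise {fromℕ 0 +ᴿ x} {x} (λ n → ℚ.+-identityˡ (seq x n))) ,
                         (λ x → pointwise {x +ᴿ fromℕ 0} {x} (λ n → ℚ.+-identityʳ (seq x n))) }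
          ; inverse = (λ x → pointwise { -ᴿ x +ᴿ x} {fromℕ 0} (λ n → ℚ.+-inverseˡ (seq x n))) ,
                      (λ x → pointwise {x +ᴿ -ᴿ x} {fromℕ 0} (λ n → ℚ.+-inverseʳ (seq x n)))
          ; ⁻¹-cong = λ {x} {y} → -ᴿ-cong {x} {y} }
        ; comm = λ x y → pointwise {x +ᴿ y} {y +ᴿ x} (λ n → ℚ.+-comm (seq x n) (seq y n)) }
      ; *-cong = λ {x} {x′} {y} {y′} → *ᴿ-cong {x} {x′} {y} {y′}
      ; *-assoc = λ x y z → pointwise {(x *ᴿ y) *ᴿ z} {x *ᴿ (y *ᴿ z)} (λ n → ℚ.*-assoc (seq x n) (seq y n) (seq z n))
      ; *-identity = (λ x → pointwise {fromℕ 1 *ᴿ x} {x} (λ n → ℚ.*-identityˡ (seq x n))) ,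
                     (λ x → pointwise {x *ᴿ fromℕ 1} {x} (λ n → ℚ.*-identityʳ (seq x n)))
      ; distrib = (λ x y z → pointwise {x *ᴿ (y +ᴿ z)} {x *ᴿ y +ᴿ x *ᴿ z} (λ n → ℚ.*-distribˡ-+ (seq x n) (seq y n) (seq z n))) ,
                  (λ x y z → pointwise {(y +ᴿ z) *ᴿ x} {y *ᴿ x +ᴿ z *ᴿ x} (λ n → ℚ.*-distribʳ-+ (seq x n) (seq y n) (seq z n))) }
    ; *-comm = λ x y → pointwise {x *ᴿ y} {y *ᴿ x} (λ n → ℚ.*-comm (seq x n) (seq y n)) } }

-- The rational lower bound `δ` separates the sequence from zero. Positive terms alone would admit
-- null sequences, and the notion would not respect `_≃_`.
Positiveᴿ : ℝ → Set
Positiveᴿ x = ∃₂ λ δ N → 0ℚ ℚ.< δ × (∀ n → N ℕ.≤ n → δ ℚ.≤ seq x n)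

p≤∣p∣ : ∀ p → p ℚ.≤ ℚ.∣ p ∣
p≤∣p∣ p with ℚ.≤-total 0ℚ p
... | inj₁ 0≤p = ℚ.≤-reflexive (≡.sym (ℚ.0≤p⇒∣p∣≡p 0≤p))
... | inj₂ p≤0 = ℚ.≤-trans p≤0 (ℚ.0≤∣p∣ p)

half-below : ∀ {δ a b} → δ ℚ.≤ a → ℚ.∣ a ℚ.- b ∣ ℚ.< ½ ℚ.* δ → ½ ℚ.* δ ℚ.≤ b
half-below {δ} {a} {b} δ≤a close = ℚ.≮⇒≥ λ b<½δ → ℚ.<-irrefl ≡.refl (begin-strict
  δ                                ≤⟨ δ≤a ⟩
  a                                ≡⟨ shift a b ⟩
  b ℚ.+ (a ℚ.- b)                  ≤⟨ ℚ.+-monoʳ-≤ b (p≤∣p∣ (a ℚ.- b)) ⟩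
  b ℚ.+ ℚ.∣ a ℚ.- b ∣              <⟨ ℚ.+-mono-< b<½δ close ⟩
  ½ ℚ.* δ ℚ.+ ½ ℚ.* δ              ≡⟨ half+half δ ⟩
  δ                                ∎)
  where
  open ℚ.≤-Reasoning

positiveᴿ-resp : ∀ {x y} → x ≃ y → Positiveᴿ x → Positiveᴿ y
positiveᴿ-resp x≃y (δ , M , 0<δ , δ≤x) with x≃y (½ ℚ.* δ) (half-pos 0<δ)
... | N , close = ½ ℚ.* δ , M ℕ.⊔ N , half-pos 0<δ , λ n K≤n →
  half-below (δ≤x n (ℕ.m⊔n≤o⇒m≤o M N K≤n)) (close n (ℕ.m⊔n≤o⇒n≤o M N K≤n))

positiveᴿ-+ : ∀ {x y} → Positiveᴿ x → Positiveᴿ y → Positiveᴿ (x +ᴿ y)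
positiveᴿ-+ (δ , M , 0<δ , δ≤x) (η , N , 0<η , η≤y) = δ ℚ.+ η , M ℕ.⊔ N , ℚ.+-mono-< 0<δ 0<η , λ n K≤n →
  ℚ.+-mono-≤ (δ≤x n (ℕ.m⊔n≤o⇒m≤o M N K≤n)) (η≤y n (ℕ.m⊔n≤o⇒n≤o M N K≤n))

positive-product : ∀ {p q} → 0ℚ ℚ.< p → 0ℚ ℚ.< q → 0ℚ ℚ.< p ℚ.* q
positive-product {p} {q} 0<p 0<q = ≡.subst (ℚ._< p ℚ.* q) (ℚ.*-zeroʳ p) (ℚ.*-monoʳ-<-pos p ⦃ ℚ.positive 0<p ⦄ 0<q)

positiveᴿ-* : ∀ {x y} → Positiveᴿ x → Positiveᴿ y → Positiveᴿ (x *ᴿ y)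
positiveᴿ-* {x} {y} (δ , M , 0<δ , δ≤x) (η , N , 0<η , η≤y) = δ ℚ.* η , M ℕ.⊔ N , positive-product 0<δ 0<η , λ n K≤n →
  let δ≤xₙ = δ≤x n (ℕ.m⊔n≤o⇒m≤o M N K≤n) in
  ℚ.≤-trans (ℚ.*-monoˡ-≤-nonNeg δ ⦃ ℚ.nonNegative (ℚ.<⇒≤ 0<δ) ⦄ (η≤y n (ℕ.m⊔n≤o⇒n≤o M N K≤n)))
            (ℚ.*-monoʳ-≤-nonNeg (seq y n) ⦃ ℚ.nonNegative (ℚ.≤-trans (ℚ.<⇒≤ 0<η) (η≤y n (ℕ.m⊔n≤o⇒n≤o M N K≤n))) ⦄ δ≤xₙ)

0-not-positiveᴿ : ¬ Positiveᴿ (fromℕ 0)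
0-not-positiveᴿ (δ , N , 0<δ , δ≤0) = ℚ.<-irrefl ≡.refl (ℚ.<-≤-trans 0<δ (δ≤0 N ℕ.≤-refl))

-- A single late term decides. If it or its negative is at least ε/2, the tail, which varies by less
-- than ε/4, stays beyond ε/4 on that side, and `x` has a sign. Otherwise the whole tail lies within
-- ε of zero.
trichotomousᴿ : ∀ {x} → ¬ Positiveᴿ x → ¬ Positiveᴿ (-ᴿ x) → x ≃ fromℕ 0
trichotomousᴿ {x} ¬x>0 ¬x<0 ε 0<ε with cauchy x η 0<η
  where
  η = ½ ℚ.* (½ ℚ.* ε)
  0<η = half-pos (half-pos 0<ε)
... | N , close with ½ ℚ.* ε ℚ.≤? seq x N | ½ ℚ.* ε ℚ.≤? ℚ.- seq x N
...   | yes ε≤x | _ = contradiction (_ , N , half-pos (half-pos 0<ε) , λ n N≤n → half-below ε≤x (close N n ℕ.≤-refl N≤n)) ¬x>0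
...   | no _ | yes ε≤-x = contradiction (_ , N , half-pos (half-pos 0<ε) , λ n N≤n → half-below ε≤-x
          (≡.subst (ℚ._< ½ ℚ.* (½ ℚ.* ε)) (≡.sym (≡.trans (≡.cong ℚ.∣_∣ (neg-rearrange (seq x N) (seq x n))) (ℚ.∣-p∣≡∣p∣ (seq x N ℚ.- seq x n))))
            (close N n ℕ.≤-refl N≤n))) ¬x<0
...   | no ε≰x | no ε≰-x = N , λ n N≤n → begin-strict
  ℚ.∣ seq x n ℚ.- 0ℚ ∣                             ≡⟨ ≡.cong ℚ.∣_∣ (ℚ.+-identityʳ (seq x n)) ⟩
  ℚ.∣ seq x n ∣                                    ≡⟨ ≡.cong ℚ.∣_∣ (shift (seq x n) (seq x N)) ⟩
  ℚ.∣ seq x N ℚ.+ (seq x n ℚ.- seq x N) ∣          ≤⟨ ℚ.∣p+q∣≤∣p∣+∣q∣ (seq x N) (seq x n ℚ.- seq x N) ⟩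
  ℚ.∣ seq x N ∣ ℚ.+ ℚ.∣ seq x n ℚ.- seq x N ∣      <⟨ ℚ.+-mono-< small (ℚ.<-trans (close n N N≤n ℕ.≤-refl) η<½ε) ⟩
  ½ ℚ.* ε ℚ.+ ½ ℚ.* ε                              ≡⟨ half+half ε ⟩
  ε                                                ∎
  where
  open ℚ.≤-Reasoning
  η = ½ ℚ.* (½ ℚ.* ε)
  η<½ε : η ℚ.< ½ ℚ.* ε
  η<½ε = begin-strict
    η             ≡⟨ ℚ.+-identityʳ η ⟨
    η ℚ.+ 0ℚ      <⟨ ℚ.+-monoʳ-< η (half-pos (half-pos 0<ε)) ⟩
    η ℚ.+ η       ≡⟨ half+half (½ ℚ.* ε) ⟩
    ½ ℚ.* ε       ∎
  small : ℚ.∣ seq x N ∣ ℚ.< ½ ℚ.* ε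
  small with ℚ.∣p∣≡p∨∣p∣≡-p (seq x N)
  ... | inj₁ eq = ≡.subst (ℚ._< ½ ℚ.* ε) (≡.sym eq) (ℚ.≰⇒> ε≰x)
  ... | inj₂ eq = ≡.subst (ℚ._< ½ ℚ.* ε) (≡.sym eq) (ℚ.≰⇒> ε≰-x)

archimedeanᴿ : ∀ {x} → Positiveᴿ x → ∀ y → ∃ λ s → Positiveᴿ (s *ᴿ x -ᴿ y)
archimedeanᴿ {x} (δ , M , 0<δ , δ≤x) y with eventuallyBounded (seq y) (cauchy y)
-- The multiplier is `(B + 1) / δ`, where `B` bounds `y` and `δ` is a lower bound for `x`: the
-- difference is then eventually at least 1.
... | B , N , 0<B , bound with scale 0<δ (ℚ.+-mono-< 0<B 0<1)
...   | s , 0<s , δs≡B+1 = fromℚ s , 1ℚ , M ℕ.⊔ N , 0<1 , λ n K≤n → begin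
  1ℚ                               ≡⟨ cancel ⟩
  (B ℚ.+ 1ℚ) ℚ.- B                 ≡⟨ ≡.cong (ℚ._- B) (≡.trans (ℚ.*-comm s δ) δs≡B+1) ⟨
  s ℚ.* δ ℚ.- B                    ≤⟨ ℚ.+-mono-≤ (ℚ.*-monoˡ-≤-nonNeg s ⦃ ℚ.nonNegative (ℚ.<⇒≤ 0<s) ⦄ (δ≤x n (ℕ.m⊔n≤o⇒m≤o M N K≤n)))
                                                 (ℚ.neg-antimono-≤ (ℚ.≤-trans (p≤∣p∣ (seq y n)) (bound n (ℕ.m⊔n≤o⇒n≤o M N K≤n)))) ⟩
  s ℚ.* seq x n ℚ.- seq y n        ∎
  where
  open ℚ.≤-Reasoning
  cancel : 1ℚ ≡ (B ℚ.+ 1ℚ) ℚ.- B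
  cancel = ≡.trans (shift 1ℚ B) (≡.sym (ℚ.+-assoc B 1ℚ (ℚ.- B)))

ℝ-order : ArchimedeanOrder ℝ-commutativeRing 0ℓ
ℝ-order = record
  { Positive       = Positiveᴿ
  ; positive-resp  = λ {x} {y} → positiveᴿ-resp {x} {y}
  ; positive-+     = λ {x} {y} → positiveᴿ-+ {x} {y}
  ; positive-*     = λ {x} {y} → positiveᴿ-* {x} {y}
  ; positive-1     = 1ℚ , 0 , 0<1 , λ _ _ → ℚ.≤-refl
  ; 0-not-positive = 0-not-positiveᴿ
  ; trichotomous   = λ {x} → trichotomousᴿ {x}
  ; archimedean    = λ {x} → archimedeanᴿ {x}
  }

≤ᴿ⇒not-positive : ∀ {x y} → x ≤ᴿ y → ¬ Positiveᴿ (x -ᴿ y)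
≤ᴿ⇒not-positive {x} {y} x≤y (δ , M , 0<δ , δ≤x-y) with x≤y δ 0<δ
... | N , x<y+δ = ℚ.<-irrefl ≡.refl (begin-strict
  seq x K                             <⟨ x<y+δ K (ℕ.m≤n⊔m M N) ⟩
  seq y K ℚ.+ δ                       ≤⟨ ℚ.+-monoʳ-≤ (seq y K) (δ≤x-y K (ℕ.m≤m⊔n M N)) ⟩
  seq y K ℚ.+ (seq x K ℚ.- seq y K)   ≡⟨ shift (seq x K) (seq y K) ⟨
  seq x K                             ∎)
  where
  open ℚ.≤-Reasoning
  K = M ℕ.⊔ N

-- Geodesics, and degrees counted along them.

module GeodesicCounting where
  open import Data.Nat.Base using (_<_; z≤n; s≤s; _+_)

  module ℕΣ = SemiringSum ℕ.+-*-semiring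

  indicator : Bool → ℕ
  indicator true  = 1
  indicator false = 0

  count : ∀ {n} → (Fin n → Bool) → ℕ
  count P = ℕΣ.sum (indicator ∘ P)

  sum-mono : ∀ {n} {f g : Fin n → ℕ} → (∀ i → f i ≤ g i) → ℕΣ.sum f ≤ ℕΣ.sum g
  sum-mono {zero}  f≤g = z≤n
  sum-mono {suc n} f≤g = ℕ.+-mono-≤ (f≤g zero) (sum-mono (f≤g ∘ suc))

  count-none : ∀ {n} {P : Fin n → Bool} → (∀ i → P i ≡ false) → count P ≡ 0
  count-none {zero}  none = ≡.refl
  count-none {suc n} none = ≡.cong₂ _+_ (≡.cong indicator (none zero)) (count-none (none ∘ suc))

  count-unique : ∀ {n} {P : Fin n → Bool} → (∀ i j → P i ≡ true → P j ≡ true → i ≡ j) → count P ≤ 1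
  count-unique {zero}  unique = z≤n
  count-unique {suc n} {P} unique with P zero in P₀
  ... | false = count-unique (λ i j Pᵢ Pⱼ → Fin.suc-injective (unique (suc i) (suc j) Pᵢ Pⱼ))
  ... | true  = s≤s (ℕ.≤-reflexive (count-none λ i → Bool.¬-not λ Pᵢ → contradiction (unique zero (suc i) P₀ Pᵢ) λ ()))

  count-complement : ∀ {n} (P : Fin n → Bool) → count (not ∘ P) + count P ≡ n
  count-complement {zero}  P = ≡.refl
  count-complement {suc n} P with P zero | count-complement (P ∘ suc)
  ... | false | eq = ≡.cong suc eq
  ... | true  | eq = ≡.trans (ℕ.+-suc _ _) (≡.cong suc eq)

  sum-injection : ∀ {m n} (x : Fin m → Fin n) → (∀ i j → x i ≡ x j → i ≡ j) → (g : Fin n → ℕ) →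
    ℕΣ.sum (g ∘ x) ≤ ℕΣ.sum g
  sum-injection {zero}          x inj g = z≤n
  sum-injection {suc m} {zero}  x inj g with () ← x zero
  sum-injection {suc m} {suc n} x inj g = begin
    g (x zero) + ℕΣ.sum (g ∘ x ∘ suc)
      ≡⟨ ≡.cong (λ z → g (x zero) + z) (ℕΣ.sum-cong-≗ (λ i → ≡.cong g (≡.sym (Fin.punchIn-punchOut (x₀≢ i))))) ⟩
    g (x zero) + ℕΣ.sum (g ∘ punchIn (x zero) ∘ x′)
      ≤⟨ ℕ.+-monoʳ-≤ (g (x zero)) (sum-injection x′ inj′ (g ∘ punchIn (x zero))) ⟩
    g (x zero) + ℕΣ.sum (g ∘ punchIn (x zero))
      ≡⟨ ℕΣ.sum-remove {i = x zero} g ⟨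
    ℕΣ.sum g ∎
    where
    open ℕ.≤-Reasoning
    x₀≢ : ∀ i → x zero ≢ x (suc i)
    x₀≢ i eq with () ← inj zero (suc i) eq
    x′ : Fin m → Fin n
    x′ i = punchOut (x₀≢ i)
    inj′ : ∀ i j → x′ i ≡ x′ j → i ≡ j
    inj′ i j eq = Fin.suc-injective (inj (suc i) (suc j) (Fin.punchOut-injective (x₀≢ i) (x₀≢ j) eq))

  card-tabulate : ∀ {n} (P : Fin n → Bool) → ∣ tabulate P ∣ ≡ count P
  card-tabulate {zero}  P = ≡.refl
  card-tabulate {suc n} P with P zero
  ... | true  = ≡.cong suc (card-tabulate (P ∘ suc))
  ... | false = card-tabulate (P ∘ suc)

  module _ {n} (G : Graph n) where

    append : ∀ {u v w k l} → Walk G u v k → Walk G v w l → Walk G u w (k + l)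
    append nil        q = q
    append (cons a p) q = cons a (append p q)

    -- The field `short` bounds the distance from below by the difference of the indices, written
    -- without subtraction. Used in both directions, it makes the path injective and induced.
    record IsGeodesic (d : ℕ) (v : Fin (suc d) → Fin n) : Set where
      field
        step  : ∀ i j → suc (toℕ i) ≡ toℕ j → Adjacent G (v i) (v j)
        short : ∀ i j l → Walk G (v i) (v j) l → toℕ j ≤ toℕ i + l

    vertex : ∀ {u w k} → Walk G u w k → Fin (suc k) → Fin n
    vertex {u} _          zero    = u
    vertex     (cons _ p) (suc i) = vertex p i

    vertex-step : ∀ {u w k} (p : Walk G u w k) i j → suc (toℕ i) ≡ toℕ j → Adjacent G (vertex p i) (vertex p j)
    vertex-step (cons a nil)          zero    (suc zero) eq = a
    vertex-step (cons a (cons _ _))   zero    (suc zero) eq = a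
    vertex-step (cons _ p)            (suc i) (suc j)    eq = vertex-step p i j (ℕ.suc-injective eq)

    prefix : ∀ {u w k} (p : Walk G u w k) i → Walk G u (vertex p i) (toℕ i)
    prefix p          zero    = nil
    prefix (cons a p) (suc i) = cons a (prefix p i)

    suffix : ∀ {u w k} (p : Walk G u w k) i → ∃ λ r → toℕ i + r ≡ k × Walk G (vertex p i) w r
    suffix {k = k} p    zero    = k , ≡.refl , p
    suffix (cons a p) (suc i) with suffix p i
    ... | r , eq , q = r , ≡.cong suc eq , q

    -- A shortcut between two vertices of a shortest walk, joined to the prefix before it and the
    -- suffix after it, would give a shorter walk between the endpoints.
    distance⇒geodesic : ∀ {u w d} → Distance G u w d → ∃ (IsGeodesic d)
    distance⇒geodesic {d = d} (p , minimal) = vertex p , record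
      { step  = vertex-step p
      ; short = λ i j l q → let r , eq , s = suffix p j in ℕ.+-cancelʳ-≤ r (toℕ j) (toℕ i + l)
          (ℕ.≤-trans (ℕ.≤-reflexive eq) (minimal _ (append (append (prefix p i) q) s))) }

    module Geodesic {d} {v : Fin (suc d) → Fin n} (geo : IsGeodesic d v) where
      open IsGeodesic geo

      v-injective : ∀ i j → v i ≡ v j → i ≡ j
      v-injective i j eq = Fin.toℕ-injective (ℕ.≤-antisym (below j i (≡.sym eq)) (below i j eq))
        where
        below : ∀ i j → v i ≡ v j → toℕ j ≤ toℕ i
        below i j eq = ℕ.≤-trans (short i j 0 (≡.subst (λ z → Walk G (v i) z 0) eq nil)) (ℕ.≤-reflexive (ℕ.+-identityʳ (toℕ i)))

      swap-adjacent : ∀ {x y} → Adjacent G x y → Adjacent G y x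
      swap-adjacent {x} {y} = ≡.trans (symmetric G y x)

      near : ∀ (i j : Fin (suc d)) → i ≢ j → toℕ i ≤ suc (toℕ j) → toℕ j ≤ suc (toℕ i) → suc (toℕ i) ≡ toℕ j ⊎ suc (toℕ j) ≡ toℕ i
      near i j i≢j i≤1+j j≤1+i with ℕ.<-cmp (toℕ i) (toℕ j)
      ... | tri< i<j _ _ = inj₁ (ℕ.≤-antisym i<j j≤1+i)
      ... | tri≈ _ i≡j _ = contradiction (Fin.toℕ-injective i≡j) i≢j
      ... | tri> _ _ j<i = inj₂ (ℕ.≤-antisym j<i i≤1+j)

      consecutive⇒adjacent : ∀ i j → suc (toℕ i) ≡ toℕ j ⊎ suc (toℕ j) ≡ toℕ i → Adjacent G (v i) (v j)
      consecutive⇒adjacent i j (inj₁ eq) = step i j eq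
      consecutive⇒adjacent i j (inj₂ eq) = swap-adjacent (step j i eq)

      adjacent⇒consecutive : ∀ i j → Adjacent G (v i) (v j) → suc (toℕ i) ≡ toℕ j ⊎ suc (toℕ j) ≡ toℕ i
      adjacent⇒consecutive i j a = near i j i≢j (bound j i (swap-adjacent a)) (bound i j a)
        where
        bound : ∀ i j → Adjacent G (v i) (v j) → toℕ j ≤ suc (toℕ i)
        bound i j a = ℕ.≤-trans (short i j 1 (cons a nil)) (ℕ.≤-reflexive (ℕ.+-comm (toℕ i) 1))
        i≢j : i ≢ j
        i≢j ≡.refl with () ← ≡.trans (≡.sym a) (loopless G (v i))

      adj-path : ∀ i j → adj G (v i) (v j) ≡ adj (path (suc d)) i j
      adj-path i j = ≡.trans (as-decision (adj G (v i) (v j)))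
        (does-⇔ (mk⇔ (adjacent⇒consecutive i j) (consecutive⇒adjacent i j))
          (adj G (v i) (v j) Bool.≟ true)
          ((suc (toℕ i) ℕ.≟ toℕ j) ⊎-dec (suc (toℕ j) ℕ.≟ toℕ i)))
        where
        as-decision : ∀ b → b ≡ does (b Bool.≟ true)
        as-decision true  = ≡.refl
        as-decision false = ≡.refl

      surjective⇒≅path : (∀ z → ∃ λ i → v i ≡ z) → G ≅ path (suc d)
      surjective⇒≅path onto = record
        { bijection = mk⤖ {to = proj₁ ∘ onto} (injective , λ i → v i , λ { ≡.refl → v-injective _ i (proj₂ (onto (v i))) })
        ; preserves = λ x y → ≡.trans (≡.sym (≡.cong₂ (adj G) (proj₂ (onto x)) (proj₂ (onto y)))) (adj-path _ _)
        }
        where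
        injective : ∀ {x y} → proj₁ (onto x) ≡ proj₁ (onto y) → x ≡ y
        injective {x} {y} eq = ≡.trans (≡.sym (proj₂ (onto x))) (≡.trans (≡.cong v eq) (proj₂ (onto y)))

      -- If every vertex were on the geodesic, `adj-path` would turn it into an isomorphism with the
      -- path. The vertex set is finite, so a search converts the refutation into a vertex.
      off-path : ¬ (G ≅ path (suc d)) → ∃ λ w → ∀ i → v i ≢ w
      off-path ≇path with Fin.any? (λ w → Fin.all? (λ i → ¬? (v i Fin.≟ w)))
      ... | yes found = found
      ... | no  none  = contradiction (surjective⇒≅path onto) ≇path
        where
        onto : ∀ z → ∃ λ i → v i ≡ z
        onto z with Fin.any? (λ i → v i Fin.≟ z)
        ... | yes found = found
        ... | no  miss  = contradiction (z , λ i eq → miss (i , eq)) none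

      two-apart : ∀ {w} i j → Adjacent G (v i) w → Adjacent G (v j) w → toℕ j ≤ 2 + toℕ i
      two-apart i j iw jw = ℕ.≤-trans (short i j 2 (cons iw (cons (swap-adjacent jw) nil))) (ℕ.≤-reflexive (ℕ.+-comm (toℕ i) 2))

      -- The neighbours of w on the path are pairwise at distance at most 2. If two
      -- of them are exactly 2 apart, j is the vertex between them; otherwise any
      -- neighbour serves.
      centre : ∀ w → ∃ λ j → ∀ i → i ≢ j → Adjacent G (v i) w → Adjacent G (v i) (v j)
      centre w with Fin.any? (λ a → Fin.any? (λ b → (2 + toℕ a ℕ.≟ toℕ b) ×-dec ((adj G (v a) w Bool.≟ true) ×-dec (adj G (v b) w Bool.≟ true))))
      ... | yes (a , b , 2+a≡b , aw , bw) = j , λ i i≢j iw → consecutive⇒adjacent i j (near i j i≢j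
          (ℕ.≤-trans (two-apart a i aw iw) (ℕ.≤-reflexive (≡.cong suc (≡.sym toℕj))))
          (ℕ.≤-pred (ℕ.≤-trans (ℕ.≤-reflexive (≡.trans (≡.cong suc toℕj) 2+a≡b)) (two-apart i b iw bw))))
        where
        1+a<1+d : suc (toℕ a) < suc d
        1+a<1+d = ℕ.<-trans (ℕ.n<1+n _) (ℕ.≤-<-trans (ℕ.≤-reflexive 2+a≡b) (Fin.toℕ<n b))
        j = fromℕ< 1+a<1+d
        toℕj : toℕ j ≡ suc (toℕ a)
        toℕj = Fin.toℕ-fromℕ< 1+a<1+d
      ... | no none with Fin.any? (λ a → adj G (v a) w Bool.≟ true)
      -- When `w` has no neighbour on the path the condition on `j` is empty, and `zero` is a
      -- default.
      ...   | no  isolated = zero , λ i _ iw → contradiction (i , iw) isolated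
      ...   | yes (a , aw) = a , λ i i≢a iw → consecutive⇒adjacent i a (near i a i≢a
          (one-apart a i aw iw) (one-apart i a iw aw))
        where
        one-apart : ∀ i i′ → Adjacent G (v i) w → Adjacent G (v i′) w → toℕ i′ ≤ suc (toℕ i)
        one-apart i i′ iw i′w = ℕ.≤-pred (ℕ.≤∧≢⇒< (two-apart i i′ iw i′w) λ i′≡2+i → none (i , i′ , ≡.sym i′≡2+i , iw , i′w))

      pathDegree : Fin (suc d) → ℕ
      pathDegree i = count (λ k → adj G (v i) (v k))

      after before : Fin (suc d) → Fin (suc d) → Bool
      after  i k = does (suc (toℕ i) ℕ.≟ toℕ k)
      before i k = does (suc (toℕ k) ℕ.≟ toℕ i)

      pathDegree≤ : ∀ i → pathDegree i ≤ count (after i) + count (before i)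
      pathDegree≤ i = ℕ.≤-trans
        (sum-mono {g = λ k → indicator (after i k) + indicator (before i k)} bound)
        (ℕ.≤-reflexive (ℕΣ.∑-distrib-+ (indicator ∘ after i) (indicator ∘ before i)))
        where
        bound : ∀ k → indicator (adj G (v i) (v k)) ≤ indicator (after i k) + indicator (before i k)
        bound k rewrite adj-path i k with after i k | before i k
        ... | true  | true  = s≤s z≤n
        ... | true  | false = s≤s z≤n
        ... | false | true  = s≤s z≤n
        ... | false | false = z≤n

      does-true : ∀ {A : Set} (a? : Dec A) → does a? ≡ true → A
      does-true (yes a) _ = a

      after≤1 : ∀ i → count (after i) ≤ 1
      after≤1 i = count-unique {P = after i} λ k l p q → Fin.toℕ-injective
        (≡.trans (≡.sym (does-true (suc (toℕ i) ℕ.≟ toℕ k) p)) (does-true (suc (toℕ i) ℕ.≟ toℕ l) q))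

      before≤1 : ∀ i → count (before i) ≤ 1
      before≤1 i = count-unique {P = before i} λ k l p q → Fin.toℕ-injective (ℕ.suc-injective
        (≡.trans (does-true (suc (toℕ k) ℕ.≟ toℕ i) p) (≡.sym (does-true (suc (toℕ l) ℕ.≟ toℕ i) q))))

      pathDegree≤2 : ∀ i → pathDegree i ≤ 2
      pathDegree≤2 i = ℕ.≤-trans (pathDegree≤ i) (ℕ.+-mono-≤ (after≤1 i) (before≤1 i))

      IsEnd : Fin (suc d) → Set
      IsEnd i = toℕ i ≡ 0 ⊎ toℕ i ≡ d

      pathDegree-end : ∀ i → IsEnd i → pathDegree i ≤ 1
      pathDegree-end i (inj₁ i≡0) = ℕ.≤-trans (pathDegree≤ i) (ℕ.+-mono-≤ (after≤1 i) (ℕ.≤-reflexive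
        (count-none {P = before i} λ k → dec-false (suc (toℕ k) ℕ.≟ toℕ i) λ eq → ℕ.1+n≢0 (≡.trans eq i≡0))))
      pathDegree-end i (inj₂ i≡d) = ℕ.≤-trans (pathDegree≤ i) (ℕ.+-mono-≤ (ℕ.≤-reflexive
        (count-none {P = after i} λ k → dec-false (suc (toℕ i) ℕ.≟ toℕ k) λ eq →
          ℕ.<-irrefl (≡.trans (≡.sym eq) (≡.cong suc i≡d)) (Fin.toℕ<n k))) (before≤1 i))

      -- Every non-neighbour of u among w and the path lowers the degree of u.
      degree-bound : ∀ {w} → (∀ i → v i ≢ w) → ∀ i →
        degree G (v i) + (2 + d) ≤ n + (indicator (adj G (v i) w) + pathDegree i)
      degree-bound {w} w∉path i = begin
        degree G u + (2 + d)
          ≡⟨ ≡.cong₂ _+_ (card-tabulate (adj G u)) (≡.sym (count-complement (adj G u ∘ x))) ⟩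
        count (adj G u) + (count (not ∘ adj G u ∘ x) + count (adj G u ∘ x))
          ≤⟨ ℕ.+-monoʳ-≤ (count (adj G u)) (ℕ.+-monoˡ-≤ (count (adj G u ∘ x)) (sum-injection x x-injective (indicator ∘ not ∘ adj G u))) ⟩
        count (adj G u) + (count (not ∘ adj G u) + count (adj G u ∘ x))
          ≡⟨ rearrange (count (adj G u)) (count (not ∘ adj G u)) (count (adj G u ∘ x)) ⟩
        (count (not ∘ adj G u) + count (adj G u)) + count (adj G u ∘ x)
          ≡⟨ ≡.cong (λ z → z + count (adj G u ∘ x)) (count-complement (adj G u)) ⟩
        n + (indicator (adj G u w) + pathDegree i) ∎
        where
        open ℕ.≤-Reasoning
        u = v i
        rearrange : ∀ a b c → a + (b + c) ≡ (b + a) + c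
        rearrange = solve-∀
        x : Fin (2 + d) → Fin n
        x zero    = w
        x (suc k) = v k
        x-injective : ∀ k l → x k ≡ x l → k ≡ l
        x-injective zero    zero    eq = ≡.refl
        x-injective zero    (suc l) eq = contradiction (≡.sym eq) (w∉path l)
        x-injective (suc k) zero    eq = contradiction eq (w∉path k)
        x-injective (suc k) (suc l) eq = ≡.cong suc (v-injective k l eq)

      module Punctured {w} (w∉path : ∀ i → v i ≢ w) (j : Fin (suc d))
        (w-near-j : ∀ i → i ≢ j → Adjacent G (v i) w → Adjacent G (v i) (v j)) where

        σ : Fin d → Fin n
        σ k = v (punchIn j k)

        punctured : Fin d → Fin d → Bool
        punctured k l = adj G (σ k) (σ l)

        -- Off `j`, adjacency to `w` implies adjacency to `v j`. So the unit that `w` may contribute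
        -- in `degree-bound` is at most the unit by which deleting `v j` lowers the path degree, and
        -- the two counts add up to at most twice the path degree.
        slack-bound : ∀ k D → pathDegree (punchIn j k) ≤ D →
          degree G (σ k) + count (punctured k) + d + 2 ≤ n + (D + D)
        slack-bound k D P≤D = begin
          degree G (σ k) + T + d + 2           ≡⟨ rearrange₁ (degree G (σ k)) T d ⟩
          degree G (σ k) + (2 + d) + T         ≤⟨ ℕ.+-monoˡ-≤ T (degree-bound w∉path i) ⟩
          n + (Aʷ + P) + T                     ≤⟨ ℕ.+-monoˡ-≤ T (ℕ.+-monoʳ-≤ n (ℕ.+-monoˡ-≤ P Aʷ≤Aʲ)) ⟩
          n + (Aʲ + P) + T                     ≡⟨ rearrange₂ n Aʲ P T ⟩
          n + ((Aʲ + T) + P)                   ≡⟨ ≡.cong (λ z → n + (z + P)) (ℕΣ.sum-remove {i = j} (λ k → indicator (adj G (v i) (v k)))) ⟨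
          n + (P + P)                          ≤⟨ ℕ.+-monoʳ-≤ n (ℕ.+-mono-≤ P≤D P≤D) ⟩
          n + (D + D)                          ∎
          where
          open ℕ.≤-Reasoning
          i = punchIn j k
          T = count (punctured k)
          P = pathDegree i
          Aʷ = indicator (adj G (v i) w)
          Aʲ = indicator (adj G (v i) (v j))
          rearrange₁ : ∀ a b c → a + b + c + 2 ≡ a + (2 + c) + b
          rearrange₁ = solve-∀
          rearrange₂ : ∀ a b c e → a + (b + c) + e ≡ a + ((b + e) + c)
          rearrange₂ = solve-∀
          Aʷ≤Aʲ : Aʷ ≤ Aʲ
          Aʷ≤Aʲ with adj G (v i) w in eq
          ... | false = z≤n
          ... | true  = ℕ.≤-reflexive (≡.cong indicator (≡.sym (w-near-j i (Fin.punchInᵢ≢i j k) eq)))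

        -- The equation says that the diagonal entry `n - d + 2 - degree` is the degree within the
        -- punctured path plus `e`. Path degree at most 2 gives exactly the room for `e` to be a
        -- natural number; at an end, path degree at most 1 improves the bound by 2 and excludes `e`
        -- being zero.
        slack : ∀ k → ∃ λ e → degree G (σ k) + (count (punctured k) + e) + d ≡ n + 2 × (IsEnd (punchIn j k) → 1 ≤ e)
        slack k with ℕ.m≤n⇒∃[o]m+o≡n (ℕ.+-cancelʳ-≤ 2 _ _ (ℕ.≤-trans (slack-bound k 2 (pathDegree≤2 _)) (ℕ.≤-reflexive (≡.sym (ℕ.+-assoc n 2 2)))))
        ... | e , eq = e , ≡.trans (rearrange (degree G (σ k)) (count (punctured k)) e d) eq , positive e eq
          where
          rearrange : ∀ a b c e → a + (b + c) + e ≡ a + b + e + c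
          rearrange = solve-∀
          positive : ∀ e → degree G (σ k) + count (punctured k) + d + e ≡ n + 2 → IsEnd (punchIn j k) → 1 ≤ e
          positive (suc e) _ _ = s≤s z≤n
          positive zero eq end = contradiction (slack-bound k 1 (pathDegree-end _ end)) (ℕ.<⇒≱ (begin-strict
            n + 2                                             ≡⟨ eq ⟨
            degree G (σ k) + count (punctured k) + d + 0      <⟨ ℕ.+-monoʳ-< (degree G (σ k) + count (punctured k) + d) (s≤s z≤n) ⟩
            degree G (σ k) + count (punctured k) + d + 2      ∎))
            where open ℕ.≤-Reasoning

open GeodesicCounting

-- Signless Laplacian forms and coordinate subspaces.

module SignlessForms {c ℓ p} {R : CommutativeRing c ℓ} (O : ArchimedeanOrder R p) where
  open CommutativeRing R hiding (zero)
  open ArchimedeanOrder O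
  open OrderProperties O
  open Determinants R
  open RankOne R
  open PolynomialRoots O using (positive-⋆)
  open Inertia O
  open IntegerSolver R
  open SemiringMult semiring using (×-homo-+) renaming (_×_ to _⋆_)
  open SetoidReasoning setoid

  weight : Bool → Carrier
  weight b = indicator b ⋆ 1#

  count-⋆ : ∀ {n} (P : Fin n → Bool) → count P ⋆ 1# ≈ sum (weight ∘ P)
  count-⋆ {zero}  P = refl
  count-⋆ {suc n} P = trans (×-homo-+ 1# (indicator (P zero)) (count (P ∘ suc))) (+-congˡ (count-⋆ (P ∘ suc)))

  ⋆-nonneg : ∀ k → Nonneg (k ⋆ 1#)
  ⋆-nonneg zero    = ≈0⇒nonneg refl
  ⋆-nonneg (suc k) = positive⇒nonneg (positive-⋆ k)

  ⋆-≉0 : ∀ k → 1 ℕ.≤ k → ¬ (k ⋆ 1# ≈ 0#)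
  ⋆-≉0 (suc k) _ = positive⇒≉0 (positive-⋆ k)

  -- Symmetrising a double sum computes twice the form, and no half is assumed in the ring.
  ¬positive-double : ∀ {x} → ¬ Positive x → ¬ Positive (x + x)
  ¬positive-double {x} ¬x>0 2x>0 = positive-+-nonneg 2x>0
    (¬x>0 ∘ positive-resp (solve 1 (λ x → :- (:- x) := x) refl x))
    (¬x>0 ∘ positive-resp (solve 1 (λ x → x :+ x :+ (:- x) := x) refl x))

  -- `B` is the signless Laplacian, degrees plus adjacency, of the relation `b`, increased by the
  -- diagonal matrix of `e`.
  module _ {d} (b : Fin d → Fin d → Bool) (b-sym : ∀ k l → b k l ≡ b l k) (e : Fin d → ℕ)
    (B : Matrix Carrier d)
    (B≈ : ∀ k l → B k l ≈ (if does (k Fin.≟ l) then (count (b k) ℕ.+ e k) ⋆ 1# else 0#) + weight (b k l))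
    (a : Fin d → Carrier) where

    private
      E = sum (λ k → e k ⋆ 1# * (a k * a k))
      M = sum (λ k → sum (λ l → weight (b k l) * (a k * a k + a k * a l)))
      square-term : Fin d → Fin d → Carrier
      square-term k l = weight (b k l) * ((a k + a l) * (a k + a l))
      squares = sum (λ k → sum (square-term k))

    form-split : form B a ≈ E + M
    form-split = begin
      sum (λ k → a k * (B · a) k)
        ≈⟨ sum-cong-≋ row ⟩
      sum (λ k → e k ⋆ 1# * (a k * a k) + sum (λ l → weight (b k l) * (a k * a k + a k * a l)))
        ≈⟨ ∑-distrib-+ (λ k → e k ⋆ 1# * (a k * a k)) (λ k → sum (λ l → weight (b k l) * (a k * a k + a k * a l))) ⟩
      E + M ∎
      where
      row : ∀ k → a k * (B · a) k ≈ e k ⋆ 1# * (a k * a k) + sum (λ l → weight (b k l) * (a k * a k + a k * a l))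
      row k = begin
        a k * sum (λ l → B k l * a l)
          ≈⟨ *-congˡ (sum-cong-≋ (λ l → trans (*-congʳ (B≈ k l)) (distribʳ (a l) (diagonal l) (weight (b k l))))) ⟩
        a k * sum (λ l → diagonal l * a l + weight (b k l) * a l)
          ≈⟨ *-congˡ (∑-distrib-+ (λ l → diagonal l * a l) (λ l → weight (b k l) * a l)) ⟩
        a k * (sum (λ l → diagonal l * a l) + S)
          ≈⟨ *-congˡ (+-congʳ (trans (sum-single (λ l → diagonal l * a l) k off) at)) ⟩
        a k * ((count (b k) ℕ.+ e k) ⋆ 1# * a k + S)
          ≈⟨ *-congˡ (+-congʳ (*-congʳ (trans (×-homo-+ 1# (count (b k)) (e k)) (+-congʳ (count-⋆ (b k)))))) ⟩
        a k * ((sum (weight ∘ b k) + e k ⋆ 1#) * a k + S)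
          ≈⟨ solve 4 (λ x c e S → x :* ((c :+ e) :* x :+ S) := e :* (x :* x) :+ (c :* (x :* x) :+ x :* S)) refl (a k) (sum (weight ∘ b k)) (e k ⋆ 1#) S ⟩
        e k ⋆ 1# * (a k * a k) + (sum (weight ∘ b k) * (a k * a k) + a k * S)
          ≈⟨ +-congˡ (+-cong (*-distribʳ-sum (a k * a k) (weight ∘ b k)) (*-distribˡ-sum (a k) (λ l → weight (b k l) * a l))) ⟩
        e k ⋆ 1# * (a k * a k) + (sum (λ l → weight (b k l) * (a k * a k)) + sum (λ l → a k * (weight (b k l) * a l)))
          ≈⟨ +-congˡ (∑-distrib-+ (λ l → weight (b k l) * (a k * a k)) (λ l → a k * (weight (b k l) * a l))) ⟨
        e k ⋆ 1# * (a k * a k) + sum (λ l → weight (b k l) * (a k * a k) + a k * (weight (b k l) * a l))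
          ≈⟨ +-congˡ (sum-cong-≋ (λ l → solve 3 (λ w x y → w :* (x :* x) :+ x :* (w :* y) := w :* (x :* x :+ x :* y)) refl (weight (b k l)) (a k) (a l))) ⟩
        e k ⋆ 1# * (a k * a k) + sum (λ l → weight (b k l) * (a k * a k + a k * a l)) ∎
        where
        S = sum (λ l → weight (b k l) * a l)
        diagonal : Fin d → Carrier
        diagonal l = if does (k Fin.≟ l) then (count (b k) ℕ.+ e k) ⋆ 1# else 0#
        off : ∀ l → l ≢ k → diagonal l * a l ≈ 0#
        off l l≢k rewrite dec-false (k Fin.≟ l) (l≢k ∘ ≡.sym) = zeroˡ (a l)
        at : diagonal k * a k ≈ (count (b k) ℕ.+ e k) ⋆ 1# * a k
        at rewrite dec-true (k Fin.≟ k) ≡.refl = refl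

    -- Exchanging the two indices pairs `a k * a k + a k * a l` with `a l * a l + a l * a k`;
    -- together they are the square of `a k + a l`.
    double : M + M ≈ squares
    double = begin
      M + M
        ≈⟨ +-congˡ (∑-comm (λ k l → weight (b k l) * (a k * a k + a k * a l))) ⟩
      M + sum (λ l → sum (λ k → weight (b k l) * (a k * a k + a k * a l)))
        ≈⟨ ∑-distrib-+ (λ k → sum (λ l → weight (b k l) * (a k * a k + a k * a l))) (λ l → sum (λ k → weight (b k l) * (a k * a k + a k * a l))) ⟨
      sum (λ k → sum (λ l → weight (b k l) * (a k * a k + a k * a l)) + sum (λ l → weight (b l k) * (a l * a l + a l * a k)))
        ≈⟨ sum-cong-≋ (λ k → trans (sym (∑-distrib-+ (λ l → weight (b k l) * (a k * a k + a k * a l)) (λ l → weight (b l k) * (a l * a l + a l * a k))))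
             (sum-cong-≋ (λ l → trans (+-congˡ (*-congʳ (reflexive (≡.cong weight (b-sym l k)))))
               (solve 3 (λ w x y → w :* (x :* x :+ x :* y) :+ w :* (y :* y :+ y :* x) := w :* ((x :+ y) :* (x :+ y))) refl (weight (b k l)) (a k) (a l))))) ⟩
      squares ∎

    -- Twice the form is Σ 2 eₖ aₖ² + Σ bₖₗ (aₖ + aₗ)².
    form-definite : ¬ Positive (form B a) →
      (∀ k l → b k l ≡ true → a k + a l ≈ 0#) × (∀ k → 1 ℕ.≤ e k → a k ≈ 0#)
    form-definite ¬Q>0 = edges , loops
      where
      E-term≥0 : ∀ k → Nonneg (e k ⋆ 1# * (a k * a k))
      E-term≥0 k = nonneg-* (⋆-nonneg (e k)) (square-nonneg (a k))
      square-term≥0 : ∀ k l → Nonneg (square-term k l)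
      square-term≥0 k l = nonneg-* (⋆-nonneg (indicator (b k l))) (square-nonneg (a k + a l))
      E≥0 : Nonneg E
      E≥0 = sum-nonneg {f = λ k → e k ⋆ 1# * (a k * a k)} E-term≥0
      row≥0 : ∀ k → Nonneg (sum (square-term k))
      row≥0 k = sum-nonneg {f = square-term k} (square-term≥0 k)
      ¬total>0 : ¬ Positive ((E + E) + squares)
      ¬total>0 = ¬positive-double ¬Q>0 ∘ positive-resp (begin
        (E + E) + squares         ≈⟨ +-congˡ double ⟨
        (E + E) + (M + M)         ≈⟨ solve 2 (λ E M → (E :+ E) :+ (M :+ M) := (E :+ M) :+ (E :+ M)) refl E M ⟩
        (E + M) + (E + M)         ≈⟨ +-cong form-split form-split ⟨
        form B a + form B a       ∎)
      both : E + E ≈ 0# × squares ≈ 0#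
      both = +-nonpositive (nonneg-+ E≥0 E≥0) (sum-nonneg {f = λ k → sum (square-term k)} row≥0) ¬total>0
      E≈0 : E ≈ 0#
      E≈0 = proj₁ (+-nonpositive E≥0 E≥0 (λ 2E>0 → positive⇒≉0 2E>0 (proj₁ both)))
      loops : ∀ k → 1 ℕ.≤ e k → a k ≈ 0#
      loops k 1≤e = square≈0 (integral
        (sum-nonpositive {f = λ k → e k ⋆ 1# * (a k * a k)} E-term≥0 (λ E>0 → positive⇒≉0 E>0 E≈0) k)
        (⋆-≉0 (e k) 1≤e))
      edges : ∀ k l → b k l ≡ true → a k + a l ≈ 0#
      edges k l bₖₗ = square≈0 (integral
        (sum-nonpositive {f = λ l → square-term k l} (square-term≥0 k) (λ row>0 → positive⇒≉0 row>0
          (sum-nonpositive {f = λ k → sum (square-term k)} row≥0 (λ Σ>0 → positive⇒≉0 Σ>0 (proj₂ both)) k)) l)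
        (⋆-≉0 (indicator (b k l)) (ℕ.≤-reflexive (≡.cong indicator (≡.sym bₖₗ)))))

  module _ {n d} (σ : Fin d → Fin n) where

    coordinates : Fin n → Fin d → Carrier
    coordinates i k = if does (i Fin.≟ σ k) then 1# else 0#

    coordinates-∙ᵥ : ∀ a f → (coordinates · a) ∙ᵥ f ≈ a ∙ᵥ (f ∘ σ)
    coordinates-∙ᵥ a f = begin
      sum (λ i → sum (λ k → coordinates i k * a k) * f i)
        ≈⟨ sum-cong-≋ (λ i → *-distribʳ-sum (f i) (λ k → coordinates i k * a k)) ⟩
      sum (λ i → sum (λ k → coordinates i k * a k * f i))
        ≈⟨ ∑-comm (λ i k → coordinates i k * a k * f i) ⟩
      sum (λ k → sum (λ i → coordinates i k * a k * f i))
        ≈⟨ sum-cong-≋ (λ k → trans (sum-single (λ i → coordinates i k * a k * f i) (σ k) (off k)) (at k)) ⟩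
      sum (λ k → a k * f (σ k)) ∎
      where
      off : ∀ k i → i ≢ σ k → coordinates i k * a k * f i ≈ 0#
      off k i i≢σk rewrite dec-false (i Fin.≟ σ k) i≢σk = trans (*-congʳ (zeroˡ (a k))) (zeroˡ (f i))
      at : ∀ k → coordinates (σ k) k * a k * f (σ k) ≈ a k * f (σ k)
      at k rewrite dec-true (σ k Fin.≟ σ k) ≡.refl = *-congʳ (*-identityˡ (a k))

    form-coordinates : ∀ K a → form K (coordinates · a) ≈ form (λ k l → K (σ k) (σ l)) a
    form-coordinates K a = trans (coordinates-∙ᵥ a (K · (coordinates · a)))
      (∙ᵥ-cong {x = a} (λ _ → refl) (λ k → begin
        (K · (coordinates · a)) (σ k)               ≈⟨ ∙ᵥ-comm (K (σ k)) (coordinates · a) ⟩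
        (coordinates · a) ∙ᵥ K (σ k)                ≈⟨ coordinates-∙ᵥ a (K (σ k)) ⟩
        a ∙ᵥ (K (σ k) ∘ σ)                          ≈⟨ ∙ᵥ-comm a (K (σ k) ∘ σ) ⟩
        (K (σ k) ∘ σ) ∙ᵥ a                          ∎))

-- Laplacian eigenvalues at or above the threshold.

module ProductSplitting {c ℓ} (R : CommutativeRing c ℓ) where
  open CommutativeRing R hiding (zero)
  open Polynomials R using (product)
  open IntegerSolver R

  -- It separates the roots indexed by `S`, which `inertia` moves, from the others, whose factors
  -- form its polynomial `g`. One reindexing has to serve all `f`, because the factors depend on
  -- `y`.
  product-split : ∀ {n} (S : Subset n) → ∃ λ r → ∃ λ (κ : Fin r → Fin n) → ∃ λ (ι : Fin ∣ S ∣ → Fin n) →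
    (∀ k → ι k ∈ S) × (∀ f → product f ≈ product (f ∘ κ) * product (f ∘ ι))
  product-split []          = 0 , id , id , (λ ()) , λ f → sym (*-identityʳ 1#)
  product-split (true ∷ S)  with product-split S
  ... | r , κ , ι , ι∈S , eq = r , suc ∘ κ , ι⁺ , ι⁺∈S , λ f →
    trans (*-congˡ (eq (f ∘ suc))) (solve 3 (λ x y z → x :* (y :* z) := y :* (x :* z)) refl (f zero) (product (f ∘ suc ∘ κ)) (product (f ∘ suc ∘ ι)))
    where
    ι⁺ : Fin (suc ∣ S ∣) → Fin _
    ι⁺ zero    = zero
    ι⁺ (suc k) = suc (ι k)
    ι⁺∈S : ∀ k → ι⁺ k ∈ true ∷ S
    ι⁺∈S zero    = here
    ι⁺∈S (suc k) = there (ι∈S k)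
  product-split (false ∷ S) with product-split S
  ... | r , κ , ι , ι∈S , eq = suc r , κ⁺ , suc ∘ ι , (there ∘ ι∈S) , λ f →
    trans (*-congˡ (eq (f ∘ suc))) (sym (*-assoc (f zero) (product (f ∘ suc ∘ κ)) (product (f ∘ suc ∘ ι))))
    where
    κ⁺ : Fin (suc r) → Fin _
    κ⁺ zero    = zero
    κ⁺ (suc k) = suc (κ k)

module LaplacianBound {c ℓ p} {R : CommutativeRing c ℓ} (O : ArchimedeanOrder R p) {n} (G : Graph n) where
  open CommutativeRing R hiding (zero)
  open ArchimedeanOrder O
  open Determinants R using (det)
  open Inertia O
  open SignlessForms O
  open Polynomials R
  open IntegerSolver R
  open ProductSplitting R
  open SemiringMult semiring using (×-homo-+; ×-congˡ) renaming (_×_ to _⋆_)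
  open SetoidReasoning setoid

  -- The off-diagonal field concerns `- L i j` because that is the entry of `c₀ - L`. There the
  -- adjacency weights carry a plus sign, which is why squares of sums, and not of differences,
  -- arise.
  record IsLaplacian (L : Matrix Carrier n) : Set (c ⊔ ℓ) where
    field
      diagonal    : ∀ i → L i i ≈ degree G i ⋆ 1#
      offDiagonal : ∀ i j → i ≢ j → - L i j ≈ weight (adj G i j)

  module _ {L : Matrix Carrier n} (L-laplacian : IsLaplacian L) where
    open IsLaplacian L-laplacian

    laplacian-symmetric : Symmetric L
    laplacian-symmetric i j with i Fin.≟ j
    ... | yes ≡.refl = refl
    ... | no  i≢j    = begin
      L i j                  ≈⟨ solve 1 (λ x → x := :- (:- x)) refl (L i j) ⟩
      - - L i j              ≈⟨ -‿cong (offDiagonal i j i≢j) ⟩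
      - weight (adj G i j)   ≡⟨ ≡.cong (λ b → - weight b) (symmetric G i j) ⟩
      - weight (adj G j i)   ≈⟨ -‿cong (offDiagonal j i (i≢j ∘ ≡.sym)) ⟨
      - - L j i              ≈⟨ solve 1 (λ x → :- (:- x) := x) refl (L j i) ⟩
      L j i                  ∎

    characteristic-diagonal : ∀ c₀ i → characteristic L c₀ i i ≈ c₀ - degree G i ⋆ 1#
    characteristic-diagonal c₀ i rewrite dec-true (i Fin.≟ i) ≡.refl = +-congˡ (-‿cong (diagonal i))

    characteristic-offDiagonal : ∀ c₀ i j → i ≢ j → characteristic L c₀ i j ≈ 0# + weight (adj G i j)
    characteristic-offDiagonal c₀ i j i≢j rewrite dec-false (i Fin.≟ j) i≢j = +-congˡ (offDiagonal i j i≢j)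

    module _ {d} {v : Fin (suc d) → Fin n} (geo : IsGeodesic G d v)
      {c₀ : Carrier} (c₀≈ : c₀ + d ⋆ 1# ≈ n ⋆ 1# + 2 ⋆ 1#)
      {w} (w∉path : ∀ i → v i ≢ w) (j : Fin (suc d))
      (w-near-j : ∀ i → i ≢ j → Adjacent G (v i) w → Adjacent G (v i) (v j)) where
      open Geodesic G geo
      open IsGeodesic geo
      open Punctured w∉path j w-near-j

      private
        excess : Fin d → ℕ
        excess k = proj₁ (slack k)

      -- On the diagonal this is the natural-number equation of `slack` carried into the ring, where
      -- `d` is cancelled; the remaining adjacency weight is zero by looplessness. Off the diagonal,
      -- distinct indices are distinct vertices because the geodesic is injective.
      punctured-entry : ∀ k l → characteristic L c₀ (σ k) (σ l) ≈
        (if does (k Fin.≟ l) then (count (punctured k) ℕ.+ excess k) ⋆ 1# else 0#) + weight (punctured k l)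
      punctured-entry k l with k Fin.≟ l
      ... | no k≢l = characteristic-offDiagonal c₀ (σ k) (σ l) (k≢l ∘ Fin.punchIn-injective j k l ∘ v-injective _ _)
      ... | yes ≡.refl = begin
        characteristic L c₀ (σ k) (σ k)
          ≈⟨ characteristic-diagonal c₀ (σ k) ⟩
        c₀ - deg
          ≈⟨ solve 3 (λ c d a → c :- a := c :+ d :- d :- a) refl c₀ (d ⋆ 1#) deg ⟩
        c₀ + d ⋆ 1# - d ⋆ 1# - deg
          ≈⟨ +-congʳ (+-congʳ total) ⟩
        deg + rest + d ⋆ 1# - d ⋆ 1# - deg
          ≈⟨ solve 3 (λ a b d → a :+ b :+ d :- d :- a := b :+ con (+ 0)) refl deg rest (d ⋆ 1#) ⟩
        rest + 0#
          ≡⟨ ≡.cong (λ b → rest + weight b) (loopless G (σ k)) ⟨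
        rest + weight (punctured k k) ∎
        where
        deg = degree G (σ k) ⋆ 1#
        rest = (count (punctured k) ℕ.+ excess k) ⋆ 1#
        total : c₀ + d ⋆ 1# ≈ deg + rest + d ⋆ 1#
        total = begin
          c₀ + d ⋆ 1#
            ≈⟨ c₀≈ ⟩
          n ⋆ 1# + 2 ⋆ 1#
            ≈⟨ ×-homo-+ 1# n 2 ⟨
          (n ℕ.+ 2) ⋆ 1#
            ≈⟨ ×-congˡ (≡.sym (proj₁ (proj₂ (slack k)))) ⟩
          (degree G (σ k) ℕ.+ (count (punctured k) ℕ.+ excess k) ℕ.+ d) ⋆ 1#
            ≈⟨ ×-homo-+ 1# (degree G (σ k) ℕ.+ (count (punctured k) ℕ.+ excess k)) d ⟩
          (degree G (σ k) ℕ.+ (count (punctured k) ℕ.+ excess k)) ⋆ 1# + d ⋆ 1#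
            ≈⟨ +-congʳ (×-homo-+ 1# (degree G (σ k)) (count (punctured k) ℕ.+ excess k)) ⟩
          deg + rest + d ⋆ 1# ∎

      module Propagation (a : Fin d → Carrier)
        (edge : ∀ k l → punctured k l ≡ true → a k + a l ≈ 0#)
        (end : ∀ k → IsEnd (punchIn j k) → a k ≈ 0#) where

        propagate : ∀ {k l} → punctured k l ≡ true → a l ≈ 0# → a k ≈ 0#
        propagate {k} {l} kl aₗ≈0 = begin
          a k              ≈⟨ solve 2 (λ x y → x := x :+ y :- y) refl (a k) (a l) ⟩
          a k + a l - a l  ≈⟨ +-cong (edge k l kl) (-‿cong aₗ≈0) ⟩
          0# - 0#          ≈⟨ -‿inverseʳ 0# ⟩
          0#               ∎

        neighbour : ∀ k {i} (j≢i : j ≢ i) → Adjacent G (σ k) (v i) → punctured k (punchOut j≢i) ≡ true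
        neighbour k j≢i adjacent = ≡.trans (≡.cong (λ i → adj G (σ k) (v i)) (Fin.punchIn-punchOut j≢i)) adjacent

        from-start : ∀ m k → toℕ (punchIn j k) ≡ m → m ℕ.< toℕ j → a k ≈ 0#
        from-start zero    k eq _   = end k (inj₁ eq)
        from-start (suc m) k eq m<j = propagate
          (neighbour k j≢i (consecutive⇒adjacent (punchIn j k) i (inj₂ (≡.trans (≡.cong suc toℕi) (≡.sym eq)))))
          (from-start m (punchOut j≢i) (≡.trans (≡.cong toℕ (Fin.punchIn-punchOut j≢i)) toℕi) (ℕ.<-trans (ℕ.n<1+n m) m<j))
          where
          m<1+d : m ℕ.< suc d
          m<1+d = ℕ.<-trans (ℕ.n<1+n m) (ℕ.<-trans m<j (Fin.toℕ<n j))
          i = fromℕ< m<1+d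
          toℕi = Fin.toℕ-fromℕ< m<1+d
          j≢i : j ≢ i
          j≢i j≡i = ℕ.<-irrefl (≡.trans (≡.sym toℕi) (≡.cong toℕ (≡.sym j≡i))) (ℕ.<-trans (ℕ.n<1+n m) m<j)

        -- The distance `m` to the last vertex decreases while the index increases, which makes the
        -- recursion structural.
        from-end : ∀ m k → toℕ (punchIn j k) ℕ.+ m ≡ d → toℕ j ℕ.< toℕ (punchIn j k) → a k ≈ 0#
        from-end zero    k eq _   = end k (inj₂ (≡.trans (≡.sym (ℕ.+-identityʳ _)) eq))
        from-end (suc m) k eq j<k = propagate
          (neighbour k j≢i (step (punchIn j k) i (≡.sym toℕi)))
          (from-end m (punchOut j≢i)
            (≡.trans (≡.cong (ℕ._+ m) toℕi′) (≡.trans (≡.sym (ℕ.+-suc (toℕ (punchIn j k)) m)) eq))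
            (≡.subst (toℕ j ℕ.<_) (≡.sym toℕi′) j<i))
          where
          i<1+d : suc (toℕ (punchIn j k)) ℕ.< suc d
          i<1+d = ℕ.s≤s (≡.subst (suc (toℕ (punchIn j k)) ℕ.≤_) (≡.trans (≡.sym (ℕ.+-suc (toℕ (punchIn j k)) m)) eq) (ℕ.m≤m+n _ m))
          i = fromℕ< i<1+d
          toℕi = Fin.toℕ-fromℕ< i<1+d
          j<i : toℕ j ℕ.< suc (toℕ (punchIn j k))
          j<i = ℕ.<-trans j<k (ℕ.n<1+n _)
          j≢i : j ≢ i
          j≢i j≡i = ℕ.<-irrefl (≡.trans (≡.cong toℕ j≡i) toℕi) j<i
          toℕi′ = ≡.trans (≡.cong toℕ (Fin.punchIn-punchOut j≢i)) toℕi

        -- Deleting `v j` cuts the path into at most two pieces, each keeping an end of the path.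
        -- The coefficient is zero at that end and changes only by a sign along an edge, so it is
        -- zero on the whole piece.
        everywhere : ∀ k → a k ≈ 0#
        everywhere k with ℕ.<-cmp (toℕ (punchIn j k)) (toℕ j)
        ... | tri< k<j _ _ = from-start _ k ≡.refl k<j
        ... | tri≈ _ k≡j _ = contradiction (Fin.toℕ-injective k≡j) (Fin.punchInᵢ≢i j k)
        ... | tri> _ _ j<k with ℕ.m≤n⇒∃[o]m+o≡n (ℕ.≤-pred (Fin.toℕ<n (punchIn j k)))
        ...   | m , eq = from-end m k eq j<k

      path-definite : DefiniteOn (characteristic L c₀) (coordinates σ)
      path-definite a ¬Q>0 = Propagation.everywhere a (proj₁ conclusions)
        (λ k is-end → proj₂ conclusions k (proj₂ (proj₂ (slack k)) is-end))
        where
        conclusions = form-definite punctured (λ k l → symmetric G (σ k) (σ l)) excess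
          (λ k l → characteristic L c₀ (σ k) (σ l)) punctured-entry a
          (¬Q>0 ∘ positive-resp (sym (form-coordinates σ (characteristic L c₀) a)))

    eigenvalue-bound : ∀ {d} {v : Fin (suc d) → Fin n} → IsGeodesic G d v → ¬ (G ≅ path (suc d)) →
      ∀ {c₀} → c₀ + d ⋆ 1# ≈ n ⋆ 1# + 2 ⋆ 1# →
      (λs : Fin n → Carrier) → (∀ y → det (characteristic L y) ≈ product (λ i → y - λs i)) →
      (S : Subset n) → (∀ i → i ∈ S → ¬ Positive (c₀ - λs i)) → ¬ (n ℕ.< ∣ S ∣ ℕ.+ d)
    eigenvalue-bound {d} {v} geo ≇path {c₀} c₀≈ λs factors S large =
      let w , w∉path = off-path ≇path
          j , w-near-j = centre w
          r , κ , ι , ι∈S , split = product-split S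
      in inertia c₀ ∣ S ∣ d L laplacian-symmetric
        (polynomial-product (λ k → polynomial-+ polynomial-id (polynomial-const (- λs (κ k)))))
        (λs ∘ ι) (λ k → large (ι k) (ι∈S k))
        (λ y → trans (factors y) (split (λ i → y - λs i)))
        (coordinates (v ∘ punchIn j)) (path-definite geo c₀≈ w∉path j w-near-j)
      where open Geodesic G geo

  threshold : ∀ {d N D T} → N ≈ n ⋆ 1# → D ≈ d ⋆ 1# → T ≈ 2 ⋆ 1# → (N - D + T) + d ⋆ 1# ≈ n ⋆ 1# + 2 ⋆ 1#
  threshold {d} {N} {D} {T} N≈ D≈ T≈ = begin
    (N - D + T) + d ⋆ 1#                  ≈⟨ +-congʳ (+-cong (+-cong N≈ (-‿cong D≈)) T≈) ⟩
    (n ⋆ 1# - d ⋆ 1# + 2 ⋆ 1#) + d ⋆ 1#   ≈⟨ solve 3 (λ n d t → (n :- d :+ t) :+ d := n :+ t) refl (n ⋆ 1#) (d ⋆ 1#) (2 ⋆ 1#) ⟩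
    n ⋆ 1# + 2 ⋆ 1#                       ∎

-- Specialisation to the reals.

module ℝ-Naturals where
  open CommutativeRing ℝ-commutativeRing using (semiring; trans; +-congˡ)
  open SemiringMult semiring public using () renaming (_×_ to _⋆_)

  -- For a variable `m` the normalisation of `+ m ℚ./ 1` is stuck; coprimality with 1 shows that the
  -- fraction is in lowest terms, after which the addition unfolds.
  /1-suc : ∀ m → + suc m ℚ./ 1 ≡ 1ℚ ℚ.+ + m ℚ./ 1
  /1-suc m = ≡.sym (≡.trans (≡.cong (1ℚ ℚ.+_) (ℚ.normalize-coprime (Coprimality.sym (Coprimality.1-coprimeTo m))))
    (≡.cong (λ i → (+ 1 ℤ.+ i) ℚ./ 1) (ℤ.*-identityʳ (+ m))))

  fromℕ-⋆ : ∀ m → fromℕ m ≃ m ⋆ fromℕ 1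
  fromℕ-⋆ zero    = pointwise {fromℕ 0} {fromℕ 0} (λ _ → ≡.refl)
  fromℕ-⋆ (suc m) = trans {fromℕ (suc m)} {fromℕ 1 +ᴿ fromℕ m} {suc m ⋆ fromℕ 1}
    (pointwise {fromℕ (suc m)} {fromℕ 1 +ᴿ fromℕ m} (λ _ → /1-suc m))
    (+-congˡ {fromℕ 1} {fromℕ m} {m ⋆ fromℕ 1} (fromℕ-⋆ m))

open ℝ-Naturals
open LaplacianBound ℝ-order using (IsLaplacian; eigenvalue-bound; threshold)

laplacian-isLaplacian : ∀ {n} (G : Graph n) → IsLaplacian G (λ i j → fromℤ (laplacian G i j))
laplacian-isLaplacian G = record { diagonal = diagonal ; offDiagonal = offDiagonal }
  where
  diagonal : ∀ i → fromℤ (laplacian G i i) ≃ degree G i ⋆ fromℕ 1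
  diagonal i rewrite dec-true (i Fin.≟ i) ≡.refl | loopless G i | ℕ.+-identityʳ (degree G i) = fromℕ-⋆ (degree G i)
  offDiagonal : ∀ i j → i ≢ j → -ᴿ fromℤ (laplacian G i j) ≃ indicator (adj G i j) ⋆ fromℕ 1
  offDiagonal i j i≢j rewrite dec-false (i Fin.≟ j) i≢j with adj G i j
  ... | true  = pointwise { -ᴿ fromℤ (+ 0 ℤ.- + 1)} {1 ⋆ fromℕ 1} (λ _ → ≡.refl)
  ... | false = pointwise { -ᴿ fromℤ (+ 0 ℤ.- + 0)} {0 ⋆ fromℕ 1} (λ _ → ≡.refl)

theorem3p1 : ∀ (n : ℕ) (G : Graph n) (d : ℕ) → Connected G → Diameter G d → 2 ≤ d →
    ¬ (G ≅ path (suc d)) →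
    ∀ (m : ℕ) → LaplacianCount G (fromℕ n -ᴿ fromℕ d +ᴿ fromℕ 2) (fromℕ n) m → m ≤ n ∸ d
theorem3p1 n G d _ ((_ , _ , distance) , _) _ ≇path m (λs , eigenvalues , S , S-spec , ≡.refl) =
  ℕ.≮⇒≥ λ n∸d<m → eigenvalue-bound G (laplacian-isLaplacian G) (proj₂ (distance⇒geodesic G distance)) ≇path
    {fromℕ n -ᴿ fromℕ d +ᴿ fromℕ 2}
    (threshold G {d} {fromℕ n} {fromℕ d} {fromℕ 2} (fromℕ-⋆ n) (fromℕ-⋆ d) (fromℕ-⋆ 2))
    λs eigenvalues S
    (λ i i∈S → ≤ᴿ⇒not-positive {fromℕ n -ᴿ fromℕ d +ᴿ fromℕ 2} {λs i} (proj₁ (Equivalence.to (S-spec i) i∈S)))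
    -- Truncated subtraction still satisfies `n ≤ d + (n ∸ d)`, so `n ∸ d < m` yields `n < m + d`.
    (ℕ.≤-<-trans (ℕ.m≤n+m∸n n d) (≡.subst (ℕ._< m ℕ.+ d) (ℕ.+-comm (n ∸ d) d) (ℕ.+-monoˡ-< d n∸d<m)))
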